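{- For every positive integer $k$ there is a constant $n_0(k)$, depending only on $k$, such that the following holds for every integer $n>n_0(k)$. Let $T_n,T_{n-1},\dots,T_{n-k+1}$ be $k$ trees such that, for each $j\in\{0,1,\dots,k-1\}$, the tree $T_{n-j}$ has exactly $n-j$ vertices, and $T_{n-j}$ has at least $k-1-j$ leaves or has a pending path of order $k-1-j$. Then $T_n,T_{n-1},\dots,T_{n-k+1}$ pack into the complete graph $K_n$.
   Context: Graphs $G_1,\dots,G_k$ with at most $n$ vertices each are said to pack into $K_n$ if there are injections $f_j:V(G_j)\to V(K_n)$, $j=1,\dots,k$, such that for $i\neq j$ the edge sets $\{f_i(u)f_i(v):uv\in E(G_i)\}$ and $\{f_j(u)f_j(v):uv\in E(G_j)\}$ are disjoint. A tree $T$ has a pending path of order $t$ if there exists an edge $e\in E(T)$ such that one component of $T-e$ is a path $P$ on $t$ vertices and $d_T(v)\le 2$ for every $v\in V(P)$. -}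

module Defs where

open import Data.Nat using (ℕ; zero; suc; _+_; _∸_; _≤_; _<_)
open import Data.Fin using (Fin; toℕ)
open import Data.Bool using (Bool; true; false; T)
open import Data.List using (List; []; _∷_; _++_; [_]; length; filter; allFin)
open import Data.List.Relation.Unary.Unique.Propositional using (Unique)
open import Data.Product using (Σ; ∃; _×_; _,_)
open import Data.Sum using (_⊎_)
open import Data.Unit using (⊤)
open import Data.Empty using (⊥)
open import Function.Definitions using (Injective)
open import Relation.Binary.PropositionalEquality using (_≡_)
open import Relation.Nullary using (¬_)
open import Function.Bundles using (_⇔_)

record Graph (m : ℕ) : Set where
  field
    adj    : Fin m → Fin m → Bool
    sym    : ∀ u v → adj u v ≡ adj v u
    irrefl : ∀ v → adj v v ≡ false
open Graph public

module _ {m : ℕ} (G : Graph m) where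

  Adj : Fin m → Fin m → Set
  Adj u v = T (adj G u v)

  degree : Fin m → ℕ
  degree v = length (filter (λ u → Data.Bool.T? (adj G v u)) (allFin m))
    where import Data.Bool

  leaves : ℕ
  leaves = length (filter (λ v → degree v Data.Nat.≟ 1) (allFin m))
    where import Data.Nat

  data Reach : Fin m → Fin m → Set where
    here : ∀ {v} → Reach v v
    step : ∀ {u w x} → Reach u w → Adj w x → Reach u x

  Connected : Set
  Connected = ∀ u v → Reach u v

  WalkList : List (Fin m) → Set
  WalkList []           = ⊤
  WalkList (x ∷ [])     = ⊤
  WalkList (x ∷ y ∷ xs) = Adj x y × WalkList (y ∷ xs)

  HasCycle : Set
  HasCycle = Σ (Fin m) λ x → Σ (List (Fin m)) λ ys →
               (2 ≤ length ys) × Unique (x ∷ ys) × WalkList (x ∷ ys ++ [ x ])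

  Acyclic : Set
  Acyclic = ¬ HasCycle

  IsTree : Set
  IsTree = (1 ≤ m) × Connected × Acyclic

  data ReachAvoid (a b : Fin m) : Fin m → Fin m → Set where
    here : ∀ {v} → ReachAvoid a b v v
    step : ∀ {u w x} → ReachAvoid a b u w → Adj w x →
           ¬ ((w ≡ a × x ≡ b) ⊎ (w ≡ b × x ≡ a)) → ReachAvoid a b u x

  Consec : {t : ℕ} → Fin t → Fin t → Set
  Consec i j = (suc (toℕ i) ≡ toℕ j) ⊎ (suc (toℕ j) ≡ toℕ i)

  -- G has a pending path of order t: an edge e = ab such that the component
  -- of G - e containing b is a path p₀ p₁ … p_{t-1} (on t vertices), and every
  -- vertex of it has degree ≤ 2 in G.
  PendingPath : ℕ → Set
  PendingPath t = Σ (Fin m) λ a → Σ (Fin m) λ b → Adj a b ×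
    Σ (Fin t → Fin m) λ p →
      Injective _≡_ _≡_ p ×
      (∀ v → ReachAvoid a b b v ⇔ (∃ λ i → p i ≡ v)) ×
      -- the component (whose edges are the edges of G among its vertices,
      -- since a lies outside it) is the path p₀ … p_{t-1}
      (∀ i j → Adj (p i) (p j) ⇔ Consec i j) ×
      (∀ i → degree (p i) ≤ 2)

Pack : (n : ℕ) {k : ℕ} (sz : Fin k → ℕ) → ((j : Fin k) → Graph (sz j)) → Set
Pack n {k} sz G =
  (∀ j → sz j ≤ n) ×
  Σ ((j : Fin k) → Fin (sz j) → Fin n) λ f →
    (∀ j → Injective _≡_ _≡_ (f j)) ×
    (∀ i j → ¬ i ≡ j → ∀ u v x y →
       Adj (G i) u v → Adj (G j) x y →
       f i u ≡ f j x → f i v ≡ f j y → ⊥)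

{-# OPTIONS --safe #-}
-- Each tree is padded with isolated dummy vertices to n vertices, so that a packing becomes a family of permutations.
-- A tree is star-like if some vertex, its centre, has degree at least 3n/5; such a centre carries linearly many leaves.
-- Boundedly many vertices of K_n, the slots, are filled first.  Every vertex of large degree gets a slot of its own, and
-- every other tree covers that slot by a vertex all of whose neighbours lie on slots too, so that only the owner has edges
-- from the slot to the rest of K_n.  The centre of a star-like tree may be adjacent to everything except the slots of its
-- dummies; the earlier trees cover it by one of their leaves or by a vertex of their pending path, and the dummies are
-- put on the neighbours of these vertices.  What remains are graphs of maximum degree at most εn, which are packed one
-- after the other by exchanging vertices, as in the theorem of Sauer and Spencer.

module Submission where

open import Defs hiding (sym)
open import Data.Nat using (ℕ; zero; suc; pred; _+_; _*_; _∸_; _/_; _≤_; _<_; _<ᵇ_; _≟_; _≤?_; _<?_; z≤n; s≤s; NonZero; >-nonZero)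
open import Data.Nat.Properties hiding (_≟_; _≤?_; _<?_)
open import Data.Nat.DivMod using (m/n*n≤m; m≡m%n+[m/n]*n; m%n<n; /-monoʳ-≤; /-monoˡ-≤; m*n/n≡m)
open import Data.Nat.Tactic.RingSolver using (solve-∀)
open import Data.Fin using (Fin; zero; suc; toℕ; fromℕ<; inject≤; opposite; splitAt; _↑ˡ_; _↑ʳ_)
open import Data.Fin.Properties as Fin using (any?)
open import Data.Fin.Permutation as Perm using (Permutation′; _⟨$⟩ʳ_; _⟨$⟩ˡ_; _∘ₚ_)
open import Data.Bool using (Bool; true; false; _∧_; _∨_; not; T)
open import Data.Bool.Properties as Bool using (T?)
open import Data.List using (List; []; _∷_; [_]; _++_; length; foldr; map; concatMap; filter; tabulate; lookup; allFin)
import Data.List.Properties as List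
open import Data.List.Relation.Unary.All as All using (All; []; _∷_)
import Data.List.Relation.Unary.All.Properties as All
open import Data.List.Relation.Unary.AllPairs using ([]; _∷_)
open import Data.List.Relation.Unary.Any as Any using (here; there)
open import Data.List.Relation.Unary.Any.Properties using (lookup-index)
open import Data.List.Relation.Unary.Unique.Propositional using (Unique)
open import Data.List.Membership.Propositional using (_∈_; find; lose)
open import Data.List.Membership.Propositional.Properties using (∈-lookup; ∈-allFin; ∈-++⁺ˡ; ∈-++⁺ʳ; ∈-++⁻; ∈-map⁺; ∈-map⁻; ∈-concatMap⁺; ∈-concatMap⁻; ∈-filter⁺; ∈-filter⁻)
open import Data.Product using (Σ; ∃; _×_; _,_; proj₁; proj₂)
open import Data.Product.Properties using (≡-dec)
open import Data.Sum using (_⊎_; inj₁; inj₂; [_,_]′)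
open import Data.Empty using (⊥; ⊥-elim)
open import Data.Unit using (⊤; tt)
open import Function using (_∘_; id; case_of_)
open import Function.Bundles using (Equivalence)
open import Relation.Nullary using (¬_; Dec; yes; no; does)
open import Relation.Nullary.Decidable using (_×-dec_; ¬?)
open import Relation.Unary using (Decidable)
open import Relation.Binary using (tri<; tri≈; tri>)
open import Relation.Binary.Definitions using (DecidableEquality)
open import Relation.Binary.PropositionalEquality hiding ([_])
import Algebra.Properties.CommutativeMonoid.Sum +-0-commutativeMonoid as CSum
import Algebra.Properties.Semiring.Sum +-*-semiring as SSum

-- Tree `j` has one dummy for each earlier tree and must cover the centre of each later star-like
-- tree, at most `k ∸ 1 ∸ toℕ j` of them. A star-like tree `i` can thus spend one dummy on tree `j`.
-- This suffices for a leaf, with its single neighbour, but not for a path vertex, with two. So the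
-- path is filled in an order that makes most neighbours centres again: of two star-like trees one
-- has to avoid the centre of the other anyway, and that dummy serves the second neighbour.
-- Path-like trees use different rank differences `R`, hence join different pairs of centres. The
-- fraction 3/5 lies between 1/2, above which the degree sum forces linearly many leaves at a
-- centre, and 4/5: a tree with few vertices of bounded degree away from the high degrees has about
-- 4n/5 leaves at boundedly many vertices, more than one of these can hold. Two families with
-- disjoint neighbourhoods are sought because two trees each cover slots of the other and must not
-- use the same edge in doing so. Two degree thresholds appear since slots without an owner need a
-- degree small against `n` divided by the number of slots, which depends on the first threshold.

private variable n m : ℕ

-- Counting in finite sets

⟦_⟧ : Bool → ℕ
⟦ true ⟧ = 1
⟦ false ⟧ = 0

_==_ : Fin n → Fin n → Bool
x == y = does (x Fin.≟ y)

==-refl : (x : Fin n) → (x == x) ≡ true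
==-refl x with x Fin.≟ x
... | yes _ = refl
... | no x≢x = ⊥-elim (x≢x refl)

==⇒≡ : {x y : Fin n} → (x == y) ≡ true → x ≡ y
==⇒≡ {x = x} {y} h with x Fin.≟ y
... | yes p = p

≢⇒== : {x y : Fin n} → x ≢ y → (x == y) ≡ false
≢⇒== {x = x} {y} h with x Fin.≟ y
... | yes p = ⊥-elim (h p)
... | no _ = refl

∧-elim : ∀ {a b} → a ∧ b ≡ true → a ≡ true × b ≡ true
∧-elim {true} {true} _ = refl , refl

∧-intro : ∀ {a b} → a ≡ true → b ≡ true → a ∧ b ≡ true
∧-intro refl refl = refl

true≢false : ∀ {a} → a ≡ true → a ≡ false → ⊥
true≢false refl ()

decBool : (a : Bool) → a ≡ true ⊎ a ≡ false
decBool true = inj₁ refl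
decBool false = inj₂ refl

¬true⇒false : ∀ {a} → (a ≡ true → ⊥) → a ≡ false
¬true⇒false {true} h = ⊥-elim (h refl)
¬true⇒false {false} h = refl

⇔⇒≡ : ∀ {a b} → (a ≡ true → b ≡ true) → (b ≡ true → a ≡ true) → a ≡ b
⇔⇒≡ {true} f _ = sym (f refl)
⇔⇒≡ {false} {true} _ g = g refl
⇔⇒≡ {false} {false} _ _ = refl

not-elim : ∀ {a} → not a ≡ true → a ≡ false
not-elim {false} _ = refl

not-intro : ∀ {a} → a ≡ false → not a ≡ true
not-intro refl = refl

⟦⟧≤1 : ∀ b → ⟦ b ⟧ ≤ 1
⟦⟧≤1 true = ≤-refl
⟦⟧≤1 false = z≤n

⟦⟧-true : ∀ {b} → b ≡ true → ⟦ b ⟧ ≡ 1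
⟦⟧-true refl = refl

⟦⟧-false : ∀ {b} → b ≡ false → ⟦ b ⟧ ≡ 0
⟦⟧-false refl = refl

⟦⟧-mono : ∀ {a b} → (a ≡ true → b ≡ true) → ⟦ a ⟧ ≤ ⟦ b ⟧
⟦⟧-mono {true} h rewrite h refl = ≤-refl
⟦⟧-mono {false} h = z≤n

⟦∧⟧ : ∀ a b → ⟦ a ∧ b ⟧ ≡ ⟦ a ⟧ * ⟦ b ⟧
⟦∧⟧ true b = sym (+-identityʳ ⟦ b ⟧)
⟦∧⟧ false b = refl

opaque
  sum : (Fin n → ℕ) → ℕ
  sum = CSum.sum

  sum-suc : (f : Fin (suc n) → ℕ) → sum f ≡ f zero + sum (f ∘ suc)
  sum-suc f = refl

  sum-zero : (f : Fin 0 → ℕ) → sum f ≡ 0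
  sum-zero f = refl

  sum-cong : {f g : Fin n → ℕ} → (∀ i → f i ≡ g i) → sum f ≡ sum g
  sum-cong = CSum.sum-cong-≗

  sum-+ : (f g : Fin n → ℕ) → sum (λ i → f i + g i) ≡ sum f + sum g
  sum-+ = CSum.∑-distrib-+

  sum-comm : (f : Fin m → Fin n → ℕ) → sum (λ i → sum (f i)) ≡ sum (λ j → sum (λ i → f i j))
  sum-comm = CSum.∑-comm

  sum-permute : (f : Fin n → ℕ) (π : Permutation′ n) → sum f ≡ sum (λ i → f (π ⟨$⟩ʳ i))
  sum-permute f π = CSum.sum-permute f π

  sum-* : ∀ c (f : Fin n → ℕ) → sum (λ i → c * f i) ≡ c * sum f
  sum-* c f = sym (SSum.*-distribˡ-sum c f)

  sum-*ʳ : ∀ c (f : Fin n → ℕ) → sum (λ i → f i * c) ≡ sum f * c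
  sum-*ʳ c f = sym (SSum.*-distribʳ-sum c f)

  sum-mono : {f g : Fin n → ℕ} → (∀ i → f i ≤ g i) → sum f ≤ sum g
  sum-mono {zero} h = z≤n
  sum-mono {suc n} h = +-mono-≤ (h zero) (sum-mono (h ∘ suc))

  sum-mono-< : {f g : Fin n → ℕ} → (∀ i → f i ≤ g i) → (i : Fin n) → f i < g i → sum f < sum g
  sum-mono-< h zero lt = +-mono-<-≤ lt (sum-mono (h ∘ suc))
  sum-mono-< h (suc i) lt = +-mono-≤-< (h zero) (sum-mono-< (h ∘ suc) i lt)

  term≤sum : (f : Fin n → ℕ) (i : Fin n) → f i ≤ sum f
  term≤sum f zero = m≤m+n _ _
  term≤sum f (suc i) = ≤-trans (term≤sum (f ∘ suc) i) (m≤n+m _ _)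

  sum-const : ∀ n c → sum {n} (λ _ → c) ≡ n * c
  sum-const zero c = refl
  sum-const (suc n) c = cong (c +_) (sum-const n c)

sum-0 : sum {n} (λ _ → 0) ≡ 0
sum-0 {n} = trans (sum-const n 0) (*-zeroʳ n)

sum-1 : sum {n} (λ _ → 1) ≡ n
sum-1 {n} = trans (sum-const n 1) (*-identityʳ n)

⟦⟧*-mono : ∀ b {x y} → (b ≡ true → x ≤ y) → ⟦ b ⟧ * x ≤ ⟦ b ⟧ * y
⟦⟧*-mono true h = *-monoʳ-≤ 1 (h refl)
⟦⟧*-mono false h = z≤n

⟦⟧*-cong : ∀ b {x y} → (b ≡ true → x ≡ y) → ⟦ b ⟧ * x ≡ ⟦ b ⟧ * y
⟦⟧*-cong true h = cong (1 *_) (h refl)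
⟦⟧*-cong false h = refl

sum-bound : ∀ c {f : Fin n → ℕ} → (∀ i → f i ≤ c) → sum f ≤ n * c
sum-bound {n} c h = ≤-trans (sum-mono h) (≤-reflexive (sum-const n c))

sum-delta : (x : Fin n) (f : Fin n → ℕ) → sum (λ i → ⟦ x == i ⟧ * f i) ≡ f x
sum-delta zero f = trans (sum-suc _) (trans (cong₂ _+_ (+-identityʳ (f zero)) sum-0) (+-identityʳ _))
sum-delta (suc x) f = trans (sum-suc _) (trans (sum-cong λ i → cong (λ b → ⟦ b ⟧ * f (suc i)) (lem i)) (sum-delta x (f ∘ suc)))
  where
  lem : ∀ i → (suc x == suc i) ≡ (x == i)
  lem i with x Fin.≟ i
  ... | yes _ = refl
  ... | no _ = refl

count : (Fin n → Bool) → ℕ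
count P = sum (λ i → ⟦ P i ⟧)

count-mono : {P Q : Fin n → Bool} → (∀ i → P i ≡ true → Q i ≡ true) → count P ≤ count Q
count-mono h = sum-mono λ i → ⟦⟧-mono (h i)

count-single : (x : Fin n) → count (x ==_) ≡ 1
count-single x = trans (sum-cong λ i → sym (*-identityʳ _)) (sum-delta x (λ _ → 1))

markov : ∀ c (P : Fin n → Bool) (f : Fin n → ℕ) → (∀ i → P i ≡ true → c ≤ f i) → count P * c ≤ sum f
markov c P f h = ≤-trans (≤-reflexive (sym (sum-*ʳ c _))) (sum-mono go)
  where
  go : ∀ i → ⟦ P i ⟧ * c ≤ f i
  go i with P i in eq
  ... | true = ≤-trans (≤-reflexive (+-identityʳ c)) (h i eq)
  ... | false = z≤n

anyF : (Fin n → Bool) → Bool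
anyF P = does (any? (λ i → P i Bool.≟ true))

anyF-intro : {P : Fin n → Bool} (i : Fin n) → P i ≡ true → anyF P ≡ true
anyF-intro {P = P} i h with any? (λ i → P i Bool.≟ true)
... | yes _ = refl
... | no ¬p = ⊥-elim (¬p (i , h))

anyF-elim : {P : Fin n → Bool} → anyF P ≡ true → ∃ λ i → P i ≡ true
anyF-elim {P = P} h with any? (λ i → P i Bool.≟ true)
... | yes p = p

anyF-none : {P : Fin n → Bool} → anyF P ≡ false → ∀ i → P i ≡ false
anyF-none h i = ¬true⇒false λ e → true≢false (anyF-intro i e) h

anyF≤count : (P : Fin n → Bool) → ⟦ anyF P ⟧ ≤ count P
anyF≤count P with anyF P in eq
... | false = z≤n
... | true = let (i , h) = anyF-elim {P = P} eq in ≤-trans (≤-reflexive (sym (⟦⟧-true h))) (term≤sum _ i)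

count-any : (P : Fin m → Bool) (R : Fin m → Fin n → Bool) →
  count (λ a → anyF (λ q → P q ∧ R q a)) ≤ sum (λ q → ⟦ P q ⟧ * count (R q))
count-any P R = begin
  count (λ a → anyF (λ q → P q ∧ R q a)) ≤⟨ sum-mono (λ a → anyF≤count _) ⟩
  sum (λ a → sum (λ q → ⟦ P q ∧ R q a ⟧)) ≡⟨ sum-comm (λ a q → ⟦ P q ∧ R q a ⟧) ⟩
  sum (λ q → sum (λ a → ⟦ P q ∧ R q a ⟧)) ≡⟨ sum-cong (λ q → trans (sum-cong λ a → ⟦∧⟧ (P q) (R q a)) (sum-* ⟦ P q ⟧ _)) ⟩
  sum (λ q → ⟦ P q ⟧ * count (R q)) ∎
  where open ≤-Reasoning

sumL : List ℕ → ℕ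
sumL = foldr _+_ 0

orL : List (Fin n → Bool) → Fin n → Bool
orL [] x = false
orL (P ∷ Ps) x = P x ∨ orL Ps x

orL-none : (Ps : List (Fin n → Bool)) {x : Fin n} → orL Ps x ≡ false → All (λ P → P x ≡ false) Ps
orL-none [] h = []
orL-none (P ∷ Ps) {x} h with P x in eq
... | false = eq ∷ orL-none Ps h

count-orL : (Ps : List (Fin n → Bool)) → count (orL Ps) ≤ sumL (map count Ps)
count-orL {n} [] = ≤-reflexive (sum-0)
count-orL {n} (P ∷ Ps) = ≤-trans (sum-mono {g = λ x → ⟦ P x ⟧ + ⟦ orL Ps x ⟧} go) (≤-trans (≤-reflexive (sum-+ _ _)) (+-monoʳ-≤ (count P) (count-orL Ps)))
  where
  go : ∀ x → ⟦ P x ∨ orL Ps x ⟧ ≤ ⟦ P x ⟧ + ⟦ orL Ps x ⟧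
  go x with P x
  ... | true = s≤s z≤n
  ... | false = ≤-refl

count-full : {P : Fin n → Bool} → (∀ x → P x ≡ true) → count P ≡ n
count-full {n} h = trans (sum-cong λ x → ⟦⟧-true (h x)) sum-1

sumL-bound : ∀ c b (l : List ℕ) → All (λ x → c * x ≤ b) l → c * sumL l ≤ length l * b
sumL-bound c b [] [] = ≤-reflexive (*-zeroʳ c)
sumL-bound c b (x ∷ l) (h ∷ hs) = ≤-trans (≤-reflexive (*-distribˡ-+ c x _)) (+-mono-≤ h (sumL-bound c b l hs))

-- Union bound: r sets, each containing at most a fraction 1/(r+1) of the points, cannot cover a
-- nonempty set.
avoid : (Ps : List (Fin n → Bool)) → 1 ≤ n → All (λ P → suc (length Ps) * count P ≤ n) Ps →
  ∃ λ x → All (λ P → P x ≡ false) Ps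
avoid {n} Ps 1≤n hs with any? (λ x → orL Ps x Bool.≟ false)
... | yes (x , h) = x , orL-none Ps h
... | no ¬h = ⊥-elim (<-irrefl refl (<-≤-trans lt (≤-trans (*-monoʳ-≤ (suc r) le) (≤-trans (sumL-bound (suc r) n (map count Ps) (All.map⁺ hs)) (≤-reflexive (cong (_* n) (List.length-map count Ps)))))))
  where
  r = length Ps
  le : n ≤ sumL (map count Ps)
  le = ≤-trans (≤-reflexive (sym (count-full {P = orL Ps} λ x → full x))) (count-orL Ps)
    where
    full : ∀ x → orL Ps x ≡ true
    full x with orL Ps x in eq
    ... | true = refl
    ... | false = ⊥-elim (¬h (x , eq))
  lt : r * n < suc r * n
  lt = ≤-trans (+-monoˡ-≤ (r * n) 1≤n) ≤-refl

pick : ∀ M (P : Fin n → Bool) → M ≤ count P →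
  Σ (Fin M → Fin n) λ f → (∀ {i j} → f i ≡ f j → i ≡ j) × (∀ i → P (f i) ≡ true)
pick zero P h = (λ ()) , (λ {i} → case i of λ ()) , λ ()
pick {zero} (suc M) P h = ⊥-elim (n≮0 (≤-trans h (≤-reflexive (sum-zero _))))
pick {suc n} (suc M) P h with P zero in eq | ≤-trans h (≤-reflexive (sum-suc _))
... | false | h′ = let (f , inj , pf) = pick (suc M) (P ∘ suc) h′ in suc ∘ f , inj ∘ Fin.suc-injective , pf
... | true | h′ with pick M (P ∘ suc) (≤-pred h′)
... | (f , inj , pf) = g , (λ {i} {j} → ginj i j) , gp
  where
  g : Fin (suc M) → Fin (suc n)
  g zero = zero
  g (suc i) = suc (f i)
  ginj : ∀ i j → g i ≡ g j → i ≡ j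
  ginj zero zero _ = refl
  ginj (suc i) (suc j) e = cong suc (inj (Fin.suc-injective e))
  gp : ∀ i → P (g i) ≡ true
  gp zero = eq
  gp (suc i) = pf i

-- Each value of an injection is hit once, so summing over the indices and over the values agree.
inj-count : ∀ {M} (P : Fin n → Bool) (f : Fin M → Fin n) → (∀ {i j} → f i ≡ f j → i ≡ j) →
  (∀ i → P (f i) ≡ true) → M ≤ count P
inj-count {n} {M} P f inj pf = begin
  M                                        ≡⟨ sym sum-1 ⟩
  sum {M} (λ _ → 1)                        ≡⟨ sum-cong (λ i → sym (count-single (f i))) ⟩
  sum (λ i → sum (λ x → ⟦ f i == x ⟧))     ≡⟨ sum-comm (λ i x → ⟦ f i == x ⟧) ⟩
  sum (λ x → sum (λ i → ⟦ f i == x ⟧))     ≤⟨ sum-mono go ⟩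
  count P ∎
  where
  open ≤-Reasoning
  go : ∀ x → sum (λ i → ⟦ f i == x ⟧) ≤ ⟦ P x ⟧
  go x with any? (λ i → f i Fin.≟ x)
  ... | yes (i , refl) = ≤-trans (sum-mono λ j → ⟦⟧-mono {f j == f i} {i == j} λ e → trans (cong (i ==_) (inj (==⇒≡ e))) (==-refl i)) (≤-reflexive (trans (count-single i) (sym (⟦⟧-true (pf i)))))
  ... | no ¬p = ≤-trans (sum-mono {g = λ _ → 0} λ i → ≤-reflexive (⟦⟧-false (≢⇒== λ e → ¬p (i , e)))) (≤-trans (≤-reflexive sum-0) z≤n)

lookup-injective : {A : Set} {l : List A} → Unique l → ∀ i j → lookup l i ≡ lookup l j → i ≡ j
lookup-injective (_ ∷ _) zero zero _ = refl
lookup-injective {l = _ ∷ l} (p ∷ _) zero (suc j) e = ⊥-elim (All.lookup p (∈-lookup {xs = l} j) e)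
lookup-injective {l = _ ∷ l} (p ∷ _) (suc i) zero e = ⊥-elim (All.lookup p (∈-lookup {xs = l} i) (sym e))
lookup-injective (_ ∷ ps) (suc i) (suc j) e = cong suc (lookup-injective ps i j e)

unique≤count : {P : Fin n → Bool} {l : List (Fin n)} → Unique l → All (λ x → P x ≡ true) l → length l ≤ count P
unique≤count {P = P} {l} uq ps = inj-count P (lookup l) (λ {i} {j} → lookup-injective uq i j) (λ i → All.lookup ps (∈-lookup {xs = l} i))

_∈ᵇ_ : Fin n → List (Fin n) → Bool
x ∈ᵇ [] = false
x ∈ᵇ (y ∷ l) = (y == x) ∨ (x ∈ᵇ l)

∈⇒∈ᵇ : {x : Fin n} {l : List (Fin n)} → x ∈ l → (x ∈ᵇ l) ≡ true
∈⇒∈ᵇ {x = x} (here refl) rewrite ==-refl x = refl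
∈⇒∈ᵇ {x = x} {y ∷ l} (there h) with y == x
... | true = refl
... | false = ∈⇒∈ᵇ h

∈ᵇ⇒∈ : {x : Fin n} {l : List (Fin n)} → (x ∈ᵇ l) ≡ true → x ∈ l
∈ᵇ⇒∈ {x = x} {y ∷ l} h with y Fin.≟ x
... | yes refl = here refl
... | no _ = there (∈ᵇ⇒∈ h)

count-∈ᵇ : (l : List (Fin n)) → count (_∈ᵇ l) ≤ length l
count-∈ᵇ {n} [] = ≤-reflexive (sum-0)
count-∈ᵇ {n} (y ∷ l) = ≤-trans (sum-mono {g = λ x → ⟦ y == x ⟧ + ⟦ x ∈ᵇ l ⟧} go) (≤-trans (≤-reflexive (sum-+ _ _)) (+-mono-≤ (≤-reflexive (count-single y)) (count-∈ᵇ l)))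
  where
  go : ∀ x → ⟦ (y == x) ∨ (x ∈ᵇ l) ⟧ ≤ ⟦ y == x ⟧ + ⟦ x ∈ᵇ l ⟧
  go x with y == x
  ... | true = s≤s z≤n
  ... | false = ≤-refl

-- Graphs as Boolean matrices, and their copies under permutations

Gr : ℕ → Set
Gr n = Fin n → Fin n → Bool

deg : Gr n → Fin n → ℕ
deg E v = count (E v)

-- `π` sends a vertex of the host to the vertex placed on it, so `E ^ π` is the copy of `E` in the
-- host. Exchanging the contents of two hosts is precomposition with a transposition.
_^_ : Gr n → Permutation′ n → Gr n
(E ^ π) a b = E (π ⟨$⟩ʳ a) (π ⟨$⟩ʳ b)

Symm : Gr n → Set
Symm E = ∀ u v → E u v ≡ E v u

Irr : Gr n → Set
Irr E = ∀ v → E v v ≡ false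

deg-^ : (E : Gr n) (π : Permutation′ n) (a : Fin n) → deg (E ^ π) a ≡ deg E (π ⟨$⟩ʳ a)
deg-^ E π a = sym (sum-permute (λ b → ⟦ E (π ⟨$⟩ʳ a) b ⟧) π)

sum-deg-^ : (E : Gr n) (π : Permutation′ n) → sum (deg (E ^ π)) ≡ sum (deg E)
sum-deg-^ E π = trans (sum-cong (deg-^ E π)) (sym (sum-permute (deg E) π))

perm-inj : (π : Permutation′ n) {a b : Fin n} → π ⟨$⟩ʳ a ≡ π ⟨$⟩ʳ b → a ≡ b
perm-inj π {a} {b} e = trans (sym (Perm.inverseˡ π)) (trans (cong (π ⟨$⟩ˡ_) e) (Perm.inverseˡ π))

transp-l : (i j : Fin n) → Perm.transpose i j ⟨$⟩ʳ i ≡ j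
transp-l i j with i Fin.≟ i
... | yes _ = refl
... | no i≢i = ⊥-elim (i≢i refl)

transp-r : (i j : Fin n) → Perm.transpose i j ⟨$⟩ʳ j ≡ i
transp-r i j with j Fin.≟ i
... | yes refl = refl
... | no _ with j Fin.≟ j
...   | yes _ = refl
...   | no j≢j = ⊥-elim (j≢j refl)

transp-o : (i j : Fin n) {k : Fin n} → k ≢ i → k ≢ j → Perm.transpose i j ⟨$⟩ʳ k ≡ k
transp-o i j {k} ki kj with k Fin.≟ i
... | yes e = ⊥-elim (ki e)
... | no _ with k Fin.≟ j
...   | yes e = ⊥-elim (kj e)
...   | no _ = refl

-- Packing two graphs of small maximum degree

ltb : ℕ → ℕ → Bool
ltb c x = c <ᵇ x

ltb-true : ∀ {c x} → ltb c x ≡ true → c < x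
ltb-true {c} {x} h = <ᵇ⇒< c x (subst T (sym h) _)

ltb-intro : ∀ {c x} → c < x → ltb c x ≡ true
ltb-intro {c} {x} h with c <ᵇ x | <⇒<ᵇ h
... | true | _ = refl

ltb-false : ∀ {c x} → ltb c x ≡ false → x ≤ c
ltb-false {c} {x} h = ≮⇒≥ λ p → true≢false (ltb-intro p) h

-- Linear arithmetic by certificate: `l ≤ r` is the chosen combination of the hypotheses, `s` the
-- slack, and a ring identity shows that the combination yields the goal.
lin : ∀ {a b l r} s → l ≤ r → b + l ≡ a + r + s → a ≤ b
lin {a} {b} {l} {r} s h e = +-cancelʳ-≤ l a b (≤-trans (+-monoʳ-≤ a h) (≤-trans (m≤m+n (a + r) s) (≤-reflexive (sym e))))

∨-elim : ∀ {a b} → a ∨ b ≡ true → a ≡ true ⊎ b ≡ true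
∨-elim {true} h = inj₁ refl
∨-elim {false} h = inj₂ h

∨-introˡ : ∀ {a b} → a ≡ true → a ∨ b ≡ true
∨-introˡ refl = refl

∨-introʳ : ∀ {a b} → b ≡ true → a ∨ b ≡ true
∨-introʳ {true} _ = refl
∨-introʳ {false} h = h

avoid≤ : ∀ c (Ps : List (Fin n → Bool)) → 1 ≤ n → suc (length Ps) ≤ c → All (λ P → c * count P ≤ n) Ps →
  ∃ λ x → All (λ P → P x ≡ false) Ps
avoid≤ c Ps 1≤n h hs = avoid Ps 1≤n (All.map (λ {P} q → ≤-trans (*-monoˡ-≤ (count P) h) q) hs)

any-false : ∀ {m} (P R : Fin m → Bool) → anyF (λ q → P q ∧ R q) ≡ false → ∀ q → P q ≡ true → R q ≡ true → ⊥
any-false P R h q p r = true≢false (∧-intro p r) (anyF-none h q)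

-- Opaque, since products with these numerals would unfold to long sums.
opaque
  c120 c240 c270 c2160 : ℕ
  c120 = 120
  c240 = 240
  c270 = 270
  c2160 = 2160

  c120-eq : c120 ≡ 8 * 15
  c120-eq = refl

  c240-eq : c240 ≡ 2 * c120
  c240-eq = refl

  c270-eq : c270 ≡ 9 * (15 * 2)
  c270-eq = refl

  c2160-eq : c2160 ≡ 8 * c270
  c2160-eq = refl

  c240≤c270 : c240 ≤ c270
  c240≤c270 = m≤m+n 240 30

  1≤c270 : 1 ≤ c270
  1≤c270 = s≤s z≤n

  81≤c2160 : 9 * 9 ≤ c2160
  81≤c2160 = m≤m+n 81 2079

-- `G` is the union of the copies already placed and `F` the graph to be added; `SL` is the set of
-- hosts whose contents are fixed. The total degrees over `SL` bound its neighbourhoods, so that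
-- hosts away from them can still be found.
record Hyp (k d : ℕ) (SL : Fin n → Bool) (G F : Gr n) : Set where
  field
    1≤n : 1 ≤ n
    1≤k : 1 ≤ k
    symF : Symm F
    symG : Symm G
    irrG : Irr G
    sumF : sum (deg F) ≤ 2 * n
    sumG : sum (deg G) ≤ (2 * k) * n
    degF : ∀ a → deg F a ≤ d
    degG : ∀ a → deg G a ≤ d
    small-d : (c2160 * k) * d ≤ n
    small-S : 8 * count SL ≤ n
    small-SF : 8 * sum (λ s → ⟦ SL s ⟧ * deg F s) ≤ n
    small-SG : 8 * sum (λ s → ⟦ SL s ⟧ * deg G s) ≤ n
    disjoint-S : ∀ a b → SL a ≡ true → SL b ≡ true → F a b ≡ true → G a b ≡ true → ⊥

-- After Sauer and Spencer: a conflict at a is removed by exchanging a with a vertex x, and few choices of x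
-- create a new conflict when a has low G-degree and the neighbours of a have small total G-degree.
module OneStep {k d : ℕ} {SL : Fin n → Bool} {G F : Gr n} (hyp : Hyp k d SL G F) where
  open Hyp hyp

  Fix : Permutation′ n → Set
  Fix π = ∀ s → SL s ≡ true → π ⟨$⟩ʳ s ≡ s

  -- Since the `G`-degrees sum to at most `(2 * k) * n`, at most n/120 hosts exceed this threshold.
  -- Each receives a vertex with at most 15 neighbours, and 120 = 8 * 15 keeps all these neighbours
  -- within n/8 hosts.
  D : ℕ
  D = c240 * k

  GH : Fin n → Bool
  GH a = ltb D (deg G a) ∧ not (SL a)

  instance
    k≢0 : NonZero (2 * k)
    k≢0 = >-nonZero (≤-trans 1≤k (m≤m+n k _))
    n≢0 : NonZero n
    n≢0 = >-nonZero 1≤n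

  GH-count : c120 * count GH ≤ n
  GH-count = *-cancelˡ-≤ (2 * k) (≤-trans (≤-reflexive (trans (eq c120 k (count GH)) (cong (λ z → count GH * (z * k)) (sym c240-eq)))) (≤-trans (markov D GH (deg G) λ i h → <⇒≤ (ltb-true {D} (proj₁ (∧-elim h)))) sumG))
    where
    eq : ∀ u k c → (2 * k) * (u * c) ≡ c * ((2 * u) * k)
    eq = solve-∀

  GH⇒¬SL : ∀ {a} → GH a ≡ true → SL a ≡ false
  GH⇒¬SL h = not-elim (proj₂ (∧-elim h))

  8≤120 : ∀ {a b} → c120 * a ≤ b → 8 * a ≤ b
  8≤120 {a} h = ≤-trans (*-monoˡ-≤ a (≤-trans (m≤m*n 8 15) (≤-reflexive (sym c120-eq)))) h

  small-d′ : ∀ {c} → c ≤ (c270 * k) * d → 8 * c ≤ n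
  small-d′ h = ≤-trans (*-monoʳ-≤ 8 h) (≤-trans (≤-reflexive (trans (eq c270 k d) (cong (λ z → (z * k) * d) (sym c2160-eq)))) small-d)
    where
    eq : ∀ u k d → 8 * ((u * k) * d) ≡ ((8 * u) * k) * d
    eq = solve-∀

  d≤ : d ≤ (c270 * k) * d
  d≤ = ≤-trans (≤-reflexive (sym (+-identityʳ d))) (*-monoˡ-≤ d (*-mono-≤ 1≤c270 1≤k))

  -- Bounds the number of hosts forbidden for u by its neighbours in Dn.
  load : Gr n → (Fin n → Bool) → Fin n → ℕ
  load E Dn u = sum (λ q → ⟦ E u q ∧ Dn q ⟧ * deg G q)

  -- Low vertices of F are placed one by one on the hosts of high G-degree; Dn marks the hosts done.
  record Stage₁ (Dn : Fin n → Bool) : Set where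
    field
      π : Permutation′ n
      fix : Fix π
      sub : ∀ {a} → Dn a ≡ true → GH a ≡ true
      low : ∀ {a} → Dn a ≡ true → deg (F ^ π) a ≤ 15
      load≤ : ∀ u → 9 * load (F ^ π) Dn u ≤ n + 9 * d
      disj : ∀ a b → Dn a ∨ SL a ≡ true → Dn b ∨ SL b ≡ true → (F ^ π) a b ≡ true → G a b ≡ true → ⊥

  start : Stage₁ (λ _ → false)
  start = record
    { π = Perm.id ; fix = λ s _ → refl ; sub = λ () ; low = λ ()
    ; load≤ = λ u → ≤-trans (≤-reflexive (trans (cong (9 *_) (trans (sum-cong λ q → cong (λ b → ⟦ b ⟧ * deg G q) (Bool.∧-zeroʳ (F u q))) sum-0)) (*-zeroʳ 9))) z≤n
    ; disj = disjoint-S }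

  SLdeg : ∀ {π} → Fix π → sum (λ s → ⟦ SL s ⟧ * deg (F ^ π) s) ≡ sum (λ s → ⟦ SL s ⟧ * deg F s)
  SLdeg {π} fix = sum-cong go
    where
    go : ∀ s → ⟦ SL s ⟧ * deg (F ^ π) s ≡ ⟦ SL s ⟧ * deg F s
    go s with SL s in eq
    ... | false = refl
    ... | true = cong (1 *_) (trans (deg-^ F π s) (cong (deg F) (fix s eq)))

  module Step₁ {Dn : Fin n → Bool} (st : Stage₁ Dn) (g : Fin n) (GHg : GH g ≡ true) (¬Dg : Dn g ≡ false) where
    open Stage₁ st
    F′ = F ^ π

    degF′ : ∀ a → deg F′ a ≤ d
    degF′ a = ≤-trans (≤-reflexive (deg-^ F π a)) (degF _)

    symF′ : Symm F′
    symF′ u v = symF _ _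

    -- A further placement can raise a load by one `G`-degree, at most `d`. Never placing a
    -- neighbour of a saturated vertex therefore keeps every load at n/9 + d or less.
    sat : Fin n → Bool
    sat q = ltb n (9 * load F′ Dn q)

    -- Each host in `Dn` carries a vertex with at most 15 neighbours, so the loads add up to at most
    -- 15 * (2 * k) * n. Dividing by the threshold n/9 gives 270 * k. With `d` neighbours each and a
    -- share of 1/8 this is the origin of `c2160`.
    sat-count : count sat ≤ c270 * k
    sat-count = *-cancelʳ-≤ _ _ n (≤-trans (markov n sat (λ u → 9 * load F′ Dn u) λ i h → <⇒≤ (ltb-true {n} h)) (≤-trans (≤-reflexive (sum-* 9 _)) (≤-trans (*-monoʳ-≤ 9 tot) (≤-reflexive (eq c270 15 k n c270-eq)))))
      where
      aux : ∀ u k n → 9 * (u * ((2 * k) * n)) ≡ ((9 * (u * 2)) * k) * n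
      aux = solve-∀
      eq : ∀ w u k n → w ≡ 9 * (u * 2) → 9 * (u * ((2 * k) * n)) ≡ (w * k) * n
      eq w u k n e = trans (aux u k n) (cong (λ z → (z * k) * n) (sym e))
      pt : ∀ q → sum (λ u → ⟦ F′ u q ∧ Dn q ⟧ * deg G q) ≤ 15 * deg G q
      pt q with Dn q in eq
      ... | false = ≤-trans (≤-reflexive (trans (sum-cong λ u → cong (λ b → ⟦ b ⟧ * deg G q) (Bool.∧-zeroʳ (F′ u q))) sum-0)) z≤n
      ... | true = ≤-trans (≤-reflexive (trans (sum-*ʳ (deg G q) _) (cong (_* deg G q) (sum-cong λ u → cong ⟦_⟧ (trans (Bool.∧-identityʳ (F′ u q)) (symF′ u q)))))) (*-monoˡ-≤ (deg G q) (low eq))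
      tot : sum (load F′ Dn) ≤ 15 * ((2 * k) * n)
      tot = ≤-trans (≤-reflexive (sum-comm (λ u q → ⟦ F′ u q ∧ Dn q ⟧ * deg G q))) (≤-trans (sum-mono pt) (≤-trans (≤-reflexive (sum-* 15 _)) (*-monoʳ-≤ 15 sumG)))

    P₃ P₄ P₅ P₆ : Fin n → Bool
    P₃ x = ltb 15 (deg F′ x)
    P₄ x = anyF (λ q → Dn q ∧ F′ q x)
    P₅ x = anyF (λ q → SL q ∧ F′ q x)
    P₆ x = anyF (λ q → sat q ∧ F′ q x)

    -- With degree sum at most `2 * n`, at most n/8 vertices have degree 16 or more, whence the
    -- bound 15 on the vertices placed here.
    c₃ : 8 * count P₃ ≤ n
    c₃ = *-cancelˡ-≤ 2 (≤-trans (≤-reflexive (eq (count P₃))) (≤-trans (markov 16 P₃ (deg F′) λ i h → ltb-true {15} h) (≤-trans (≤-reflexive (sum-deg-^ F π)) sumF)))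
      where
      eq : ∀ c → 2 * (8 * c) ≡ c * 16
      eq = solve-∀

    c₄ : 8 * count P₄ ≤ n
    c₄ = ≤-trans (*-monoʳ-≤ 8 (≤-trans (count-any Dn F′) (≤-trans (sum-mono pt) (≤-reflexive (sum-*ʳ 15 (λ q → ⟦ GH q ⟧)))))) (≤-trans (≤-reflexive (eq c120 15 (count GH) c120-eq)) GH-count)
      where
      aux : ∀ u c → 8 * (c * u) ≡ (8 * u) * c
      aux = solve-∀
      eq : ∀ w u c → w ≡ 8 * u → 8 * (c * u) ≡ w * c
      eq w u c e = trans (aux u c) (cong (_* c) (sym e))
      pt : ∀ q → ⟦ Dn q ⟧ * count (F′ q) ≤ ⟦ GH q ⟧ * 15
      pt q with Dn q in eq
      ... | false = z≤n
      ... | true rewrite sub eq = *-monoʳ-≤ 1 (low eq)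

    c₅ : 8 * count P₅ ≤ n
    c₅ = ≤-trans (*-monoʳ-≤ 8 (≤-trans (count-any SL F′) (≤-reflexive (SLdeg {π} fix)))) small-SF

    c₆ : 8 * count P₆ ≤ n
    c₆ = small-d′ (≤-trans (count-any sat F′) (≤-trans (sum-mono λ q → *-monoʳ-≤ ⟦ sat q ⟧ (degF′ q)) (≤-trans (≤-reflexive (sum-*ʳ d _)) (*-monoˡ-≤ d sat-count))))

    found : ∃ λ x → All (λ P → P x ≡ false) (GH ∷ SL ∷ P₃ ∷ P₄ ∷ P₅ ∷ P₆ ∷ [])
    found = avoid≤ 8 _ 1≤n (m≤m+n 7 1) (8≤120 {count GH} GH-count ∷ small-S ∷ c₃ ∷ c₄ ∷ c₅ ∷ c₆ ∷ [])

    Dn′ : Fin n → Bool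
    Dn′ a = Dn a ∨ (g == a)

    module Place (x : Fin n) (¬GH : GH x ≡ false) (¬SL : SL x ≡ false) (¬4 : P₄ x ≡ false) (¬5 : P₅ x ≡ false) (¬6 : P₆ x ≡ false) (¬3 : P₃ x ≡ false) where
      sw : Fin n → Fin n
      sw a = Perm.transpose g x ⟨$⟩ʳ a
      π′ = Perm.transpose g x ∘ₚ π
      old : ∀ {a} → Dn a ∨ SL a ≡ true → sw a ≡ a
      old {a} h = transp-o g x
        (λ { refl → [ (λ e → true≢false e ¬Dg) , (λ e → true≢false e (GH⇒¬SL GHg)) ]′ (∨-elim {Dn a} h) })
        (λ { refl → [ (λ e → true≢false (sub e) ¬GH) , (λ e → true≢false e ¬SL) ]′ (∨-elim {Dn a} h) })
      fix′ : Fix π′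
      fix′ s h = trans (cong (π ⟨$⟩ʳ_) (old (∨-introʳ {Dn s} h))) (fix s h)
      sub′ : ∀ {a} → Dn′ a ≡ true → GH a ≡ true
      sub′ {a} h with ∨-elim {Dn a} h
      ... | inj₁ e = sub e
      ... | inj₂ e = subst (λ z → GH z ≡ true) (==⇒≡ e) GHg
      deg′ : ∀ a → deg (F ^ π′) a ≡ deg F′ (sw a)
      deg′ a = trans (deg-^ F π′ a) (sym (deg-^ F π (sw a)))
      low′ : ∀ {a} → Dn′ a ≡ true → deg (F ^ π′) a ≤ 15
      low′ {a} h with ∨-elim {Dn a} h
      ... | inj₁ e = ≤-trans (≤-reflexive (trans (deg′ a) (cong (deg F′) (old (∨-introˡ e))))) (low e)
      ... | inj₂ e with ==⇒≡ {x = g} e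
      ...   | refl = ≤-trans (≤-reflexive (trans (deg′ g) (cong (deg F′) (transp-l g x)))) (ltb-false {15} ¬3)
      -- Only the new host `g` can add to a load, and only at neighbours of the vertex taken from
      -- `x`; these are unsaturated by the choice of `x`. Elsewhere the old bound is inherited from
      -- the exchanged position `sw u`.
      load′ : ∀ u → 9 * load (F ^ π′) Dn′ u ≤ n + 9 * d
      load′ u = ≤-trans (*-monoʳ-≤ 9 le) fin
        where
        pt : ∀ q → ⟦ F′ (sw u) (sw q) ∧ Dn′ q ⟧ * deg G q ≤ ⟦ F′ (sw u) q ∧ Dn q ⟧ * deg G q + ⟦ g == q ⟧ * (⟦ F′ (sw u) x ⟧ * deg G q)
        pt q with Dn q in eq | g Fin.≟ q
        ... | true | _ rewrite old {q} (∨-introˡ eq) = m≤m+n _ _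
        ... | false | no _ rewrite Bool.∧-zeroʳ (F′ (sw u) (sw q)) = z≤n
        ... | false | yes refl rewrite Bool.∧-identityʳ (F′ (sw u) (sw g)) | transp-l g x = ≤-trans (≤-reflexive (sym (+-identityʳ _))) (m≤n+m _ (⟦ F′ (sw u) g ∧ false ⟧ * deg G g))
        le : load (F ^ π′) Dn′ u ≤ load F′ Dn (sw u) + ⟦ F′ (sw u) x ⟧ * deg G g
        le = ≤-trans (sum-mono pt) (≤-reflexive (trans (sum-+ _ _) (cong (load F′ Dn (sw u) +_) (sum-delta g _))))
        fin : 9 * (load F′ Dn (sw u) + ⟦ F′ (sw u) x ⟧ * deg G g) ≤ n + 9 * d
        fin with F′ (sw u) x in eq
        ... | false = ≤-trans (≤-reflexive (cong (9 *_) (+-identityʳ (load F′ Dn (sw u))))) (load≤ (sw u))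
        ... | true = ≤-trans (≤-reflexive (*-distribˡ-+ 9 (load F′ Dn (sw u)) _)) (+-mono-≤ {9 * load F′ Dn (sw u)} {n} {9 * (1 * deg G g)} {9 * d} (ltb-false {n} (¬true⇒false λ e → any-false sat (λ q → F′ q x) ¬6 (sw u) e eq)) (*-monoʳ-≤ 9 (≤-trans (≤-reflexive (+-identityʳ _)) (degG g))))
      new-old : ∀ {b} → Dn b ∨ SL b ≡ true → F′ x b ≡ true → ⊥
      new-old {b} h e with ∨-elim {Dn b} h
      ... | inj₁ p = any-false Dn (λ q → F′ q x) ¬4 b p (trans (symF′ b x) e)
      ... | inj₂ p = any-false SL (λ q → F′ q x) ¬5 b p (trans (symF′ b x) e)
      split : ∀ {a} → Dn′ a ∨ SL a ≡ true → Dn a ∨ SL a ≡ true ⊎ g ≡ a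
      split {a} h with ∨-elim {Dn′ a} h
      ... | inj₂ e = inj₁ (∨-introʳ {Dn a} e)
      ... | inj₁ e with ∨-elim {Dn a} e
      ...   | inj₁ p = inj₁ (∨-introˡ p)
      ...   | inj₂ p = inj₂ (==⇒≡ p)
      disj′ : ∀ a b → Dn′ a ∨ SL a ≡ true → Dn′ b ∨ SL b ≡ true → (F ^ π′) a b ≡ true → G a b ≡ true → ⊥
      disj′ a b ha hb f e with split {a} ha | split {b} hb
      ... | inj₁ p | inj₁ q = disj a b p q (subst₂ (λ y z → F′ y z ≡ true) (old p) (old q) f) e
      ... | inj₂ refl | inj₁ q = new-old q (subst₂ (λ y z → F′ y z ≡ true) (transp-l g x) (old q) f)
      ... | inj₁ p | inj₂ refl = new-old p (trans (symF′ x a) (subst₂ (λ y z → F′ y z ≡ true) (old p) (transp-l g x) f))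
      ... | inj₂ refl | inj₂ refl = true≢false e (irrG g)
      placed : Stage₁ Dn′
      placed = record { π = π′ ; fix = fix′ ; sub = sub′ ; low = low′ ; load≤ = load′ ; disj = disj′ }

    next : Stage₁ Dn′
    next = go found
      where
      go : (∃ λ x → All (λ P → P x ≡ false) (GH ∷ SL ∷ P₃ ∷ P₄ ∷ P₅ ∷ P₆ ∷ [])) → Stage₁ Dn′
      go (x , ¬GH ∷ ¬SL ∷ ¬3 ∷ ¬4 ∷ ¬5 ∷ ¬6 ∷ []) = Place.placed x ¬GH ¬SL ¬4 ¬5 ¬6 ¬3

  run₁ : (l : List (Fin n)) {Dn : Fin n → Bool} → Stage₁ Dn →
    Σ (Fin n → Bool) λ Dn′ → Stage₁ Dn′ × (∀ {a} → Dn a ≡ true → Dn′ a ≡ true) × (∀ {a} → a ∈ l → GH a ≡ true → Dn′ a ≡ true)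
  run₁ [] {Dn} st = Dn , st , id , λ ()
  run₁ (g ∷ l) {Dn} st with decBool (GH g) | decBool (Dn g)
  ... | inj₁ h | inj₂ e =
    let (Dn′ , st′ , mono , all) = run₁ l (Step₁.next st g h e)
    in Dn′ , st′ , (λ {a} p → mono (∨-introˡ p)) , λ { (here refl) _ → mono (∨-introʳ {Dn g} (==-refl g)) ; (there p) q → all p q }
  ... | inj₂ h | _ =
    let (Dn′ , st′ , mono , all) = run₁ l st
    in Dn′ , st′ , mono , λ { (here refl) q → ⊥-elim (true≢false q h) ; (there p) q → all p q }
  ... | inj₁ h | inj₁ e =
    let (Dn′ , st′ , mono , all) = run₁ l st
    in Dn′ , st′ , mono , λ { (here refl) q → mono e ; (there p) q → all p q }

  record Stage₂ : Set where
    field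
      π : Permutation′ n
      fix : Fix π
      load≤ : ∀ u → 8 * load (F ^ π) GH u ≤ n
      disj : ∀ a b → GH a ∨ SL a ≡ true → GH b ∨ SL b ≡ true → (F ^ π) a b ≡ true → G a b ≡ true → ⊥

  conflicts : Gr n → ℕ
  conflicts E = sum (λ a → count (λ b → E a b ∧ G a b))

  start₂ : Stage₂
  start₂ = record
    { π = π ; fix = fix
    -- The excess is absorbed: for a load l, 9l ≤ n + 9d and 81d ≤ n give 81l ≤ 10n, hence 8l ≤ n.
    ; load≤ = λ u → *-cancelˡ-≤ 10 (arith (load (F ^ π) GH u) n d (≤-trans (*-monoʳ-≤ 9 (load-mono u)) (load≤ u)) 81d)
    ; disj = λ a b p q → disj a b (tr p) (tr q) }
    where
    r = run₁ (allFin n) start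
    Dn = proj₁ r
    open Stage₁ (proj₁ (proj₂ r))
    dn : ∀ {a} → GH a ≡ true → Dn a ≡ true
    dn {a} h = proj₂ (proj₂ (proj₂ r)) (∈-allFin a) h
    tr : ∀ {a} → GH a ∨ SL a ≡ true → Dn a ∨ SL a ≡ true
    tr {a} h = [ (λ e → ∨-introˡ (dn e)) , ∨-introʳ {Dn a} ]′ (∨-elim {GH a} h)
    load-mono : ∀ u → load (F ^ π) GH u ≤ load (F ^ π) Dn u
    load-mono u = sum-mono λ q → *-monoˡ-≤ (deg G q) (⟦⟧-mono {(F ^ π) u q ∧ GH q} {(F ^ π) u q ∧ Dn q} λ h → ∧-intro (proj₁ (∧-elim {(F ^ π) u q} h)) (dn (proj₂ (∧-elim {(F ^ π) u q} h))))
    81d : 9 * (9 * d) ≤ n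
    81d = ≤-trans (≤-reflexive (sym (*-assoc 9 9 d))) (≤-trans (*-monoˡ-≤ d (≤-trans 81≤c2160 (≤-trans (≤-reflexive (sym (*-identityʳ c2160))) (*-monoʳ-≤ c2160 1≤k)))) small-d)
    arith : ∀ l n d → 9 * l ≤ n + 9 * d → 9 * (9 * d) ≤ n → 10 * (8 * l) ≤ 10 * n
    arith l n d h1 h2 = lin l (+-mono-≤ (*-monoʳ-≤ 9 h1) h2) (eq l n d)
      where
      eq : ∀ l n d → 10 * n + (9 * (9 * l) + 9 * (9 * d)) ≡ 10 * (8 * l) + (9 * (n + 9 * d) + n) + l
      eq = solve-∀

  module Step₂ (st : Stage₂) (a b : Fin n) (ab : ((F ^ Stage₂.π st) a b) ≡ true) (Gab : G a b ≡ true)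
    (¬GHa : GH a ≡ false) (¬SLa : SL a ≡ false) where
    open Stage₂ st
    F′ = F ^ π

    degF′ : ∀ a → deg F′ a ≤ d
    degF′ a = ≤-trans (≤-reflexive (deg-^ F π a)) (degF _)

    symF′ : Symm F′
    symF′ u v = symF _ _

    lowG : ∀ {q} → GH q ≡ false → SL q ≡ false → deg G q ≤ D
    lowG {q} h e = ltb-false {D} (¬true⇒false λ p → true≢false (∧-intro p (not-intro e)) h)

    rest : Fin n → Bool
    rest q = F′ a q ∧ (not (GH q) ∧ not (SL q))

    -- The vertex leaving `a` for `x` has its neighbours on hosts of high `G`-degree, on slots, or
    -- on other hosts; `P₃`, `P₄` and `P₅` keep `x` off the `G`-neighbourhoods of these. `P₆` guards
    -- the vertex arriving at `a`.
    P₃ P₄ P₅ P₆ : Fin n → Bool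
    P₃ x = anyF (λ q → (F′ a q ∧ GH q) ∧ G q x)
    P₄ x = anyF (λ q → SL q ∧ G q x)
    P₅ x = anyF (λ q → rest q ∧ G q x)
    P₆ x = anyF (λ q → G a q ∧ F′ q x)

    240≤270 : c240 * k * d ≤ (c270 * k) * d
    240≤270 = *-monoˡ-≤ d (*-monoˡ-≤ k c240≤c270)

    c₅ : 8 * count P₅ ≤ n
    c₅ = small-d′ (≤-trans (count-any rest G) (≤-trans (sum-mono pt) (≤-trans (≤-reflexive (sum-*ʳ D _)) (≤-trans (≤-trans (*-monoˡ-≤ D (degF′ a)) (≤-reflexive (*-comm d D))) 240≤270))))
      where
      pt : ∀ q → ⟦ rest q ⟧ * count (G q) ≤ ⟦ F′ a q ⟧ * D
      pt q with rest q in eq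
      ... | false = z≤n
      ... | true with ∧-elim {F′ a q} eq
      ...   | (h₁ , h₂) with ∧-elim {not (GH q)} h₂
      ...     | (h₃ , h₄) rewrite h₁ = *-monoʳ-≤ 1 (lowG (not-elim h₃) (not-elim h₄))

    c₆ : 8 * count P₆ ≤ n
    c₆ = small-d′ (≤-trans (count-any (G a) F′) (≤-trans (sum-mono λ q → *-monoʳ-≤ ⟦ G a q ⟧ (degF′ q)) (≤-trans (≤-reflexive (sum-*ʳ d _)) (≤-trans (*-monoˡ-≤ d (lowG ¬GHa ¬SLa)) 240≤270))))

    -- The last set, `F′ a`, ensures that `x` is not `b`; otherwise the conflict between the two
    -- exchanged hosts would stay. Seven sets with a share of 1/8 each are the most that a union
    -- bound with 8 admits.
    found : ∃ λ x → All (λ P → P x ≡ false) (GH ∷ SL ∷ P₃ ∷ P₄ ∷ P₅ ∷ P₆ ∷ F′ a ∷ [])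
    found = avoid≤ 8 _ 1≤n ≤-refl
      (8≤120 {count GH} GH-count ∷ small-S ∷ ≤-trans (*-monoʳ-≤ 8 (count-any (λ q → F′ a q ∧ GH q) G)) (load≤ a)
       ∷ ≤-trans (*-monoʳ-≤ 8 (count-any SL G)) small-SG ∷ c₅ ∷ c₆ ∷ small-d′ (≤-trans (degF′ a) d≤) ∷ [])

    module Exchange (x : Fin n) (¬GH : GH x ≡ false) (¬SL : SL x ≡ false) (¬3 : P₃ x ≡ false) (¬4 : P₄ x ≡ false) (¬5 : P₅ x ≡ false) (¬6 : P₆ x ≡ false) (¬7 : F′ a x ≡ false) where
      sw : Fin n → Fin n
      sw u = Perm.transpose a x ⟨$⟩ʳ u

      π′ = Perm.transpose a x ∘ₚ π

      A→ : ∀ v → F′ x v ≡ true → G a v ≡ true → ⊥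
      A→ v h e = any-false (G a) (λ q → F′ q x) ¬6 v e (trans (symF′ v x) h)
      ←A : ∀ v → F′ a v ≡ true → G x v ≡ true → ⊥
      ←A v h e with decBool (GH v) | decBool (SL v)
      ... | inj₁ p | _ = any-false (λ q → F′ a q ∧ GH q) (λ q → G q x) ¬3 v (∧-intro h p) (trans (symG v x) e)
      ... | inj₂ _ | inj₁ q = any-false SL (λ q → G q x) ¬4 v q (trans (symG v x) e)
      ... | inj₂ p | inj₂ q = any-false rest (λ q → G q x) ¬5 v (∧-intro h (∧-intro (not-intro p) (not-intro q))) (trans (symG v x) e)
      old : ∀ {q} → GH q ∨ SL q ≡ true → sw q ≡ q
      old {q} h = transp-o a x
        (λ { refl → [ (λ e → true≢false e ¬GHa) , (λ e → true≢false e ¬SLa) ]′ (∨-elim {GH q} h) })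
        (λ { refl → [ (λ e → true≢false e ¬GH) , (λ e → true≢false e ¬SL) ]′ (∨-elim {GH q} h) })
      fix′ : Fix π′
      fix′ s h = trans (cong (π ⟨$⟩ʳ_) (old (∨-introʳ {GH s} h))) (fix s h)
      disj′ : ∀ u v → GH u ∨ SL u ≡ true → GH v ∨ SL v ≡ true → (F ^ π′) u v ≡ true → G u v ≡ true → ⊥
      disj′ u v hu hv f e = disj u v hu hv (subst₂ (λ y z → F′ y z ≡ true) (old hu) (old hv) f) e
      load′ : ∀ u → 8 * load (F ^ π′) GH u ≤ n
      load′ u = ≤-trans (≤-reflexive (cong (8 *_) (sum-cong pt))) (load≤ (sw u))
        where
        pt : ∀ q → ⟦ F′ (sw u) (sw q) ∧ GH q ⟧ * deg G q ≡ ⟦ F′ (sw u) q ∧ GH q ⟧ * deg G q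
        pt q with decBool (GH q)
        ... | inj₁ h rewrite old {q} (∨-introˡ h) = refl
        ... | inj₂ h rewrite h | Bool.∧-zeroʳ (F′ (sw u) (sw q)) | Bool.∧-zeroʳ (F′ (sw u) q) = refl
      data Pos (u : Fin n) : Set where
        isA : u ≡ a → sw u ≡ x → Pos u
        isX : u ≡ x → sw u ≡ a → Pos u
        other : sw u ≡ u → Pos u
      pos : ∀ u → Pos u
      pos u with u Fin.≟ a | u Fin.≟ x
      ... | yes refl | _ = isA refl (transp-l u x)
      ... | no _ | yes refl = isX refl (transp-r a u)
      ... | no p | no q = other (transp-o a x p q)
      -- Only pairs meeting `a` or `x` change. The pair of `a` and `x` carries the same edge before
      -- and after; for every other such pair `A→` and `←A` exclude a conflict.
      shrink : ∀ u v → (F ^ π′) u v ∧ G u v ≡ true → F′ u v ∧ G u v ≡ true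
      shrink u v h with ∧-elim {(F ^ π′) u v} h
      ... | (f , e) with pos u | pos v
      ...   | isA refl p | isA refl q = ⊥-elim (true≢false e (irrG u))
      ...   | isA refl p | isX refl q = ∧-intro (trans (symF′ a x) (subst₂ (λ y z → F′ y z ≡ true) p q f)) e
      ...   | isA refl p | other q = ⊥-elim (A→ v (subst₂ (λ y z → F′ y z ≡ true) p q f) e)
      ...   | isX refl p | isA refl q = ∧-intro (trans (symF′ x a) (subst₂ (λ y z → F′ y z ≡ true) p q f)) e
      ...   | isX refl p | isX refl q = ⊥-elim (true≢false e (irrG u))
      ...   | isX refl p | other q = ⊥-elim (←A v (subst₂ (λ y z → F′ y z ≡ true) p q f) e)
      ...   | other p | isA refl q = ⊥-elim (A→ u (trans (symF′ x u) (subst₂ (λ y z → F′ y z ≡ true) p q f)) (trans (symG a u) e))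
      ...   | other p | isX refl q = ⊥-elim (←A u (trans (symF′ a u) (subst₂ (λ y z → F′ y z ≡ true) p q f)) (trans (symG x u) e))
      ...   | other p | other q = ∧-intro (subst₂ (λ y z → F′ y z ≡ true) p q f) e
      gone : (F ^ π′) a b ≡ true → ⊥
      gone f with pos b
      ... | isA refl q = true≢false Gab (irrG a)
      ... | isX refl q = true≢false ab ¬7
      ... | other q = A→ b (subst₂ (λ y z → F′ y z ≡ true) (transp-l a x) q f) Gab
      dec : conflicts (F ^ π′) < conflicts F′
      dec = sum-mono-< (λ u → count-mono (shrink u)) a (sum-mono-< (λ v → ⟦⟧-mono (shrink a v)) b
        (≤-trans (s≤s (≤-reflexive (⟦⟧-false (¬true⇒false λ h → gone (proj₁ (∧-elim h)))))) (≤-reflexive (sym (⟦⟧-true (∧-intro ab Gab))))))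

    next : Σ Stage₂ λ st′ → conflicts (F ^ Stage₂.π st′) < conflicts F′
    next = go found
      where
      go : (∃ λ x → All (λ P → P x ≡ false) (GH ∷ SL ∷ P₃ ∷ P₄ ∷ P₅ ∷ P₆ ∷ F′ a ∷ [])) → Σ Stage₂ λ st′ → conflicts (F ^ Stage₂.π st′) < conflicts F′
      go (x , ¬GH ∷ ¬SL ∷ ¬3 ∷ ¬4 ∷ ¬5 ∷ ¬6 ∷ ¬7 ∷ []) = record { π = π′ ; fix = fix′ ; load≤ = load′ ; disj = disj′ } , dec
        where open Exchange x ¬GH ¬SL ¬3 ¬4 ¬5 ¬6 ¬7

  run₂ : ∀ c (st : Stage₂) → conflicts (F ^ Stage₂.π st) ≤ c →
    Σ (Permutation′ n) λ π → Fix π × (∀ a b → (F ^ π) a b ≡ true → G a b ≡ true → ⊥)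
  run₂ c st le with any? (λ a → any? (λ b → ((F ^ Stage₂.π st) a b ∧ G a b) Bool.≟ true))
  ... | no none = Stage₂.π st , Stage₂.fix st , λ a b f e → none (a , b , ∧-intro f e)
  ... | yes (a , b , h) = resolve c le
    where
    E = F ^ Stage₂.π st
    ab = ∧-elim {E a b} h
    -- a conflict has an end outside the hosts treated in the first stage
    improved : Σ Stage₂ λ st′ → conflicts (F ^ Stage₂.π st′) < conflicts E
    improved with decBool (GH a ∨ SL a) | decBool (GH b ∨ SL b)
    ... | inj₁ p | inj₁ q = ⊥-elim (Stage₂.disj st a b p q (proj₁ ab) (proj₂ ab))
    ... | inj₂ p | _ = Step₂.next st a b (proj₁ ab) (proj₂ ab) (¬true⇒false λ e → true≢false (∨-introˡ e) p) (¬true⇒false λ e → true≢false (∨-introʳ {GH a} e) p)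
    ... | inj₁ _ | inj₂ q = Step₂.next st b a (trans (symF _ _) (proj₁ ab)) (trans (symG b a) (proj₂ ab)) (¬true⇒false λ e → true≢false (∨-introˡ e) q) (¬true⇒false λ e → true≢false (∨-introʳ {GH b} e) q)
    resolve : ∀ c → conflicts E ≤ c → Σ (Permutation′ n) λ π → Fix π × (∀ a b → (F ^ π) a b ≡ true → G a b ≡ true → ⊥)
    resolve zero le = ⊥-elim (n≮0 (<-≤-trans (proj₂ improved) le))
    resolve (suc c) le = run₂ c (proj₁ improved) (≤-pred (<-≤-trans (proj₂ improved) le))

  result : Σ (Permutation′ n) λ π → Fix π × (∀ a b → (F ^ π) a b ≡ true → G a b ≡ true → ⊥)
  result = run₂ _ start₂ ≤-refl

-- Packing several graphs around common slots

count-any′ : ∀ {m} (R : Fin m → Fin n → Bool) → count (λ a → anyF (λ q → R q a)) ≤ sum (λ q → count (R q))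
count-any′ R = ≤-trans (sum-mono λ a → anyF≤count (λ q → R q a)) (≤-reflexive (sum-comm (λ a q → ⟦ R q a ⟧)))

_⟂_ : Gr n → Gr n → Set
E ⟂ E′ = ∀ a b → E a b ≡ true → E′ a b ≡ true → ⊥

-- The factor `K` in `SL-F` lets up to `K` such graphs share the allowance of n/8 hosts next to
-- slots. No edge runs inside `SL`, because edges between slots are compared when the slots are
-- filled.
record Light (K d : ℕ) (SL : Fin n → Bool) (F : Gr n) : Set where
  field
    sym-F : Symm F
    irr-F : Irr F
    sum-F : sum (deg F) ≤ 2 * n
    deg-F : ∀ a → deg F a ≤ d
    SL-F : (8 * K) * sum (λ s → ⟦ SL s ⟧ * deg F s) ≤ n
    indep-SL : ∀ a b → SL a ≡ true → SL b ≡ true → F a b ≡ true → ⊥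
open Light

module Sequential {K d : ℕ} {SL : Fin n → Bool} (1≤n : 1 ≤ n) (1≤K : 1 ≤ K)
  (small-d : (c2160 * K) * (K * d) ≤ n) (small-S : 8 * count SL ≤ n) where

  Fix : Permutation′ n → Set
  Fix π = ∀ s → SL s ≡ true → π ⟨$⟩ʳ s ≡ s

  instance
    K≢0 : NonZero K
    K≢0 = >-nonZero 1≤K

  module Union {k : ℕ} (k≤K : k ≤ K) (H : Fin k → Gr n) (L : ∀ i → Light K d SL (H i)) (π : Fin k → Permutation′ n) (fix : ∀ i → Fix (π i)) where
    G : Gr n
    G a b = anyF (λ i → (H i ^ π i) a b)

    degG : ∀ a → deg G a ≤ sum (λ i → deg (H i ^ π i) a)
    degG a = count-any′ (λ i → (H i ^ π i) a)

    degG≤ : ∀ a → deg G a ≤ K * d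
    degG≤ a = ≤-trans (degG a) (≤-trans (sum-bound d λ i → ≤-trans (≤-reflexive (deg-^ (H i) (π i) a)) (deg-F (L i) _)) (*-monoˡ-≤ d k≤K))

    sumG≤ : sum (deg G) ≤ (2 * K) * n
    sumG≤ = ≤-trans (sum-mono degG) (≤-trans (≤-reflexive (sum-comm (λ a i → deg (H i ^ π i) a)))
      (≤-trans (sum-bound (2 * n) λ i → ≤-trans (≤-reflexive (sum-deg-^ (H i) (π i))) (sum-F (L i))) (≤-trans (*-monoˡ-≤ (2 * n) k≤K) (≤-reflexive (eq K n)))))
      where
      eq : ∀ K n → K * (2 * n) ≡ (2 * K) * n
      eq = solve-∀

    SLG≤ : 8 * sum (λ s → ⟦ SL s ⟧ * deg G s) ≤ n
    SLG≤ = *-cancelˡ-≤ K (≤-trans (≤-reflexive (eq K _)) (≤-trans (*-monoʳ-≤ (8 * K) le) (≤-trans (≤-reflexive (sym (sum-* (8 * K) (λ i → x i)))) (≤-trans (sum-bound n λ i → SL-F (L i)) (*-monoˡ-≤ n k≤K)))))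
      where
      eq : ∀ K x → K * (8 * x) ≡ (8 * K) * x
      eq = solve-∀
      x : Fin k → ℕ
      x i = sum (λ s → ⟦ SL s ⟧ * deg (H i) s)
      pt : ∀ s i → ⟦ SL s ⟧ * deg (H i ^ π i) s ≡ ⟦ SL s ⟧ * deg (H i) s
      pt s i = ⟦⟧*-cong (SL s) λ e → (trans (deg-^ (H i) (π i) s) (cong (deg (H i)) (fix i s e)))
      le : sum (λ s → ⟦ SL s ⟧ * deg G s) ≤ sum x
      le = ≤-trans (sum-mono λ s → ≤-trans (*-monoʳ-≤ ⟦ SL s ⟧ (degG s)) (≤-reflexive (trans (sym (sum-* ⟦ SL s ⟧ _)) (sum-cong (pt s)))))
        (≤-reflexive (sum-comm (λ s i → ⟦ SL s ⟧ * deg (H i) s)))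

    symG : Symm G
    symG u v = ⇔⇒≡ (flip u v) (flip v u)
      where
      flip : ∀ u v → G u v ≡ true → G v u ≡ true
      flip u v h = let (i , e) = anyF-elim {P = λ i → (H i ^ π i) u v} h in anyF-intro i (trans (sym-F (L i) _ _) e)

    irrG : Irr G
    irrG v = ¬true⇒false λ h → let (i , e) = anyF-elim {P = λ i → (H i ^ π i) v v} h in true≢false e (irr-F (L i) _)

  pack-light : ∀ {k} → k ≤ K → (H : Fin k → Gr n) → (∀ i → Light K d SL (H i)) →
    Σ (Fin k → Permutation′ n) λ π → (∀ i → Fix (π i)) × (∀ i j → i ≢ j → (H i ^ π i) ⟂ (H j ^ π j))
  pack-light {zero} k≤K H L = (λ ()) , (λ ()) , λ ()
  pack-light {suc k} k≤K H L with pack-light {k} (≤-trans (n≤1+n k) k≤K) (H ∘ suc) (L ∘ suc)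
  ... | (π , fix , disj) = π′ , fix′ , disj′
    where
    open Union (≤-trans (n≤1+n k) k≤K) (H ∘ suc) (L ∘ suc) π fix
    L₀ = L zero
    res = OneStep.result {k = K} {d = K * d} {SL = SL} {G = G} {F = H zero} record
      { 1≤n = 1≤n ; 1≤k = 1≤K ; symF = sym-F L₀ ; symG = symG ; irrG = irrG ; sumF = sum-F L₀ ; sumG = sumG≤
      ; degF = λ a → ≤-trans (deg-F L₀ a) (m≤n*m d K) ; degG = degG≤ ; small-d = small-d ; small-S = small-S
      ; small-SF = ≤-trans (*-monoˡ-≤ _ (m≤m*n 8 K)) (SL-F L₀) ; small-SG = SLG≤
      ; disjoint-S = λ a b p q f _ → indep-SL L₀ a b p q f }
    π₀ = proj₁ res
    π′ : Fin (suc k) → Permutation′ n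
    π′ zero = π₀
    π′ (suc i) = π i
    fix′ : ∀ i → Fix (π′ i)
    fix′ zero = proj₁ (proj₂ res)
    fix′ (suc i) = fix i
    disj′ : ∀ i j → i ≢ j → (H i ^ π′ i) ⟂ (H j ^ π′ j)
    disj′ zero zero i≢j = ⊥-elim (i≢j refl)
    disj′ zero (suc j) _ a b p q = proj₂ (proj₂ res) a b p (anyF-intro j q)
    disj′ (suc i) zero _ a b p q = proj₂ (proj₂ res) a b q (anyF-intro i p)
    disj′ (suc i) (suc j) i≢j = disj i j (i≢j ∘ cong suc)

  -- W marks the slots where one tree may have large degree; the other trees keep their neighbourhoods there inside SL.
  module _ (k≤K : ∃ λ k → k ≤ K) {d₂ : ℕ} (W : Fin n → Bool) (H : Fin (proj₁ k≤K) → Gr n)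
    (d₂≤d : d₂ ≤ d) (small : (8 * K) * (count SL * d₂) ≤ n)
    (symH : ∀ i → Symm (H i)) (irrH : ∀ i → Irr (H i)) (sumH : ∀ i → sum (deg (H i)) ≤ 2 * n)
    (degH : ∀ i a → SL a ≡ false → deg (H i) a ≤ d) (degY : ∀ i a → SL a ≡ true → W a ≡ false → deg (H i) a ≤ d₂)
    (closed : ∀ a → W a ≡ true → ∃ λ o → ∀ j → j ≢ o → ∀ b → H j a b ≡ true → SL b ≡ true)
    (disjH : ∀ i j → i ≢ j → ∀ a b → SL a ≡ true → SL b ≡ true → H i a b ≡ true → H j a b ≡ true → ⊥) where

    -- What is removed is already settled: edges inside `SL` stay fixed and are disjoint by `disjH`,
    -- and those from `W` to the rest are disjoint by `closed`. The remainder is light because every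
    -- slot outside `W` has degree at most `d₂`.
    F : Fin (proj₁ k≤K) → Gr n
    F i a b = H i a b ∧ (not (SL a ∧ SL b) ∧ (not (W a) ∧ not (W b)))

    degF≤degH : ∀ i a → deg (F i) a ≤ deg (H i) a
    degF≤degH i a = count-mono λ b h → proj₁ (∧-elim h)

    F-intro : ∀ i {a b} → H i a b ≡ true → SL a ∧ SL b ≡ false → W a ≡ false → W b ≡ false → F i a b ≡ true
    F-intro i p q r s = ∧-intro p (∧-intro (not-intro q) (∧-intro (not-intro r) (not-intro s)))

    degW : ∀ i a → W a ≡ true → deg (F i) a ≡ 0
    degW i a h = trans (sum-cong λ b → ⟦⟧-false (¬true⇒false λ e → true≢false h (not-elim (proj₁ (∧-elim (proj₂ (∧-elim {not (SL a ∧ SL b)} (proj₂ (∧-elim {H i a b} e))))))))) sum-0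

    lightF : ∀ i → Light K d SL (F i)
    lightF i = record
      { sym-F = λ u v → cong₂ _∧_ (symH i u v) (cong₂ (λ x y → not x ∧ y) (Bool.∧-comm (SL u) (SL v)) (Bool.∧-comm (not (W u)) (not (W v))))
      ; irr-F = λ v → cong (_∧ _) (irrH i v)
      ; sum-F = ≤-trans (sum-mono (degF≤degH i)) (sumH i)
      ; deg-F = λ a → degF a
      ; SL-F = ≤-trans (*-monoʳ-≤ (8 * K) (≤-trans (sum-mono pt) (≤-reflexive (sum-*ʳ d₂ _)))) small
      ; indep-SL = λ a b p q h → true≢false (∧-intro p q) (not-elim (proj₁ (∧-elim (proj₂ (∧-elim {H i a b} h))))) }
      where
      onS : ∀ a → SL a ≡ true → deg (F i) a ≤ d₂
      onS a h with decBool (W a)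
      ... | inj₁ w = ≤-trans (≤-reflexive (degW i a w)) z≤n
      ... | inj₂ w = ≤-trans (degF≤degH i a) (degY i a h w)
      degF : ∀ a → deg (F i) a ≤ d
      degF a with decBool (SL a)
      ... | inj₁ s = ≤-trans (onS a s) d₂≤d
      ... | inj₂ s = ≤-trans (degF≤degH i a) (degH i a s)
      pt : ∀ s → ⟦ SL s ⟧ * deg (F i) s ≤ ⟦ SL s ⟧ * d₂
      pt s = ⟦⟧*-mono (SL s) (onS s)

    pack-heavy : (∀ a → W a ≡ true → SL a ≡ true) →
      Σ (Fin (proj₁ k≤K) → Permutation′ n) λ π → (∀ i j → i ≢ j → (H i ^ π i) ⟂ (H j ^ π j))
    pack-heavy W⊆SL with pack-light (proj₂ k≤K) F lightF
    ... | (π , fix , disj) = π , disj′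
      where
      off : ∀ i a → SL a ≡ false → SL (π i ⟨$⟩ʳ a) ≡ false
      off i a h = ¬true⇒false λ e → true≢false (trans (cong SL (sym (perm-inj (π i) (fix i _ e)))) e) h
      Woff : ∀ i a → W a ≡ false → W (π i ⟨$⟩ʳ a) ≡ false
      Woff i a h = ¬true⇒false λ e → true≢false (trans (cong W (sym (perm-inj (π i) (fix i _ (W⊆SL _ e))))) e) h
      -- At least one of two different trees is not the owner `o`. Its neighbours at `a` all lie on
      -- slots, whereas a permutation fixing the slots keeps `b` off them.
      atW : ∀ i j → i ≢ j → ∀ a b → W a ≡ true → SL b ≡ false → (H i ^ π i) a b ≡ true → (H j ^ π j) a b ≡ true → ⊥
      atW i j i≢j a b w nb p q with closed a w
      ... | (o , cl) with i Fin.≟ o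
      ...   | no i≢o = true≢false (cl i i≢o _ (subst (λ z → H i z (π i ⟨$⟩ʳ b) ≡ true) (fix i a (W⊆SL a w)) p)) (off i b nb)
      ...   | yes refl = true≢false (cl j (i≢j ∘ sym) _ (subst (λ z → H j z (π j ⟨$⟩ʳ b) ≡ true) (fix j a (W⊆SL a w)) q)) (off j b nb)
      inS : ∀ i j → i ≢ j → ∀ {a b} → SL a ≡ true → SL b ≡ true → (H i ^ π i) a b ≡ true → (H j ^ π j) a b ≡ true → ⊥
      inS i j i≢j {a} {b} sa sb p q = disjH i j i≢j a b sa sb (moved i p) (moved j q)
        where
        moved : ∀ i → (H i ^ π i) a b ≡ true → H i a b ≡ true
        moved i = subst₂ (λ y z → H i y z ≡ true) (fix i a sa) (fix i b sb)
      disj′ : ∀ i j → i ≢ j → (H i ^ π i) ⟂ (H j ^ π j)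
      disj′ i j i≢j a b p q with decBool (W a) | decBool (W b)
      ... | inj₁ wa | _ = atW i j i≢j a b wa (¬true⇒false λ e → inS i j i≢j (W⊆SL a wa) e p q) p q
      ... | inj₂ _ | inj₁ wb = atW i j i≢j b a wb (¬true⇒false λ e → inS i j i≢j e (W⊆SL b wb) p q) (trans (symH i _ _) p) (trans (symH j _ _) q)
      ... | inj₂ wa | inj₂ wb with decBool (SL a ∧ SL b)
      ...   | inj₁ h = inS i j i≢j (proj₁ (∧-elim h)) (proj₂ (∧-elim {SL a} h)) p q
      ...   | inj₂ h = disj i j i≢j a b (lift i p) (lift j q)
        where
        SLeq : ∀ i → SL (π i ⟨$⟩ʳ a) ∧ SL (π i ⟨$⟩ʳ b) ≡ false
        SLeq i with decBool (SL a)
        ... | inj₂ e = cong (_∧ SL (π i ⟨$⟩ʳ b)) (off i a e)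
        ... | inj₁ e with decBool (SL b)
        ...   | inj₁ e′ = ⊥-elim (true≢false (∧-intro e e′) h)
        ...   | inj₂ e′ = trans (cong (SL (π i ⟨$⟩ʳ a) ∧_) (off i b e′)) (Bool.∧-zeroʳ _)
        lift : ∀ i → (H i ^ π i) a b ≡ true → (F i ^ π i) a b ≡ true
        lift i p = F-intro i p (SLeq i) (Woff i a wa) (Woff i b wb)

-- Edge counts of acyclic graphs

T⇒≡ : ∀ {b} → T b → b ≡ true
T⇒≡ {true} _ = refl

≡⇒T : ∀ {b} → b ≡ true → T b
≡⇒T refl = tt

length-filter-tabulate : ∀ {A : Set} {Q : A → Set} (Q? : Decidable Q) (f : Fin m → A) →
  length (filter Q? (tabulate f)) ≡ count (λ i → does (Q? (f i)))
length-filter-tabulate {zero} Q? f = sym (sum-zero _)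
length-filter-tabulate {suc m} Q? f with does (Q? (f zero)) in eq
... | true = trans (cong suc (length-filter-tabulate Q? (f ∘ suc))) (sym (trans (sum-suc _) (cong (λ b → ⟦ b ⟧ + count (λ i → does (Q? (f (suc i))))) eq)))
... | false = trans (length-filter-tabulate Q? (f ∘ suc)) (sym (trans (sum-suc _) (cong (λ b → ⟦ b ⟧ + count (λ i → does (Q? (f (suc i))))) eq)))

module Cycles (G : Graph m) where
  E : Gr m
  E = adj G

  pre : ∀ {z} (l : List (Fin m)) → z ∈ l → List (Fin m)
  pre (a ∷ l) (here _) = a ∷ []
  pre (a ∷ l) (there h) = a ∷ pre l h

  pre-All : ∀ {P : Fin m → Set} {z} (l : List (Fin m)) (h : z ∈ l) → All P l → All P (pre l h)
  pre-All (a ∷ l) (here _) (p ∷ _) = p ∷ []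
  pre-All (a ∷ l) (there h) (p ∷ ps) = p ∷ pre-All l h ps

  pre-Unique : ∀ {z} (l : List (Fin m)) (h : z ∈ l) → Unique l → Unique (pre l h)
  pre-Unique (a ∷ l) (here _) (p ∷ _) = [] ∷ []
  pre-Unique (a ∷ l) (there h) (p ∷ ps) = pre-All l h p ∷ pre-Unique l h ps

  pre-length : ∀ {z} (l : List (Fin m)) (h : z ∈ l) → 1 ≤ length (pre l h)
  pre-length (a ∷ l) (here _) = s≤s z≤n
  pre-length (a ∷ l) (there h) = s≤s z≤n

  pre-walk : ∀ {z} x w (l : List (Fin m)) (h : z ∈ l) → WalkList G (w ∷ l) → Adj G z x → WalkList G (w ∷ pre l h ++ [ x ])
  pre-walk x w (a ∷ []) (here refl) (p , _) zx = p , zx , tt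
  pre-walk x w (a ∷ b ∷ l) (here refl) (p , _) zx = p , zx , tt
  pre-walk x w (a ∷ l) (there h) (p , ps) zx = p , pre-walk x a l h ps zx

  module _ (acyc : Acyclic G) (U : Fin m → Bool) (two : ∀ u → U u ≡ true → 2 ≤ count (λ v → U v ∧ E u v)) where

    another : ∀ u (y : Fin m) → U u ≡ true → ∃ λ z → z ≢ y × U z ≡ true × E u z ≡ true
    another u y h with pick 2 (λ v → U v ∧ E u v) (two u h)
    ... | (f , inj , pf) with f zero Fin.≟ y
    ...   | no ne = f zero , ne , ∧-elim (pf zero)
    ...   | yes refl = f (suc zero) , (λ e → case inj e of λ ()) , ∧-elim (pf (suc zero))

    -- A path in `U` is prolonged at its front `x` by a neighbour other than `y`. A repeated vertex
    -- closes a cycle; otherwise the path finally has more than `m` vertices, and `L` counts the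
    -- prolongations left until then.
    grow : ∀ L x y l → U x ≡ true → Unique (x ∷ y ∷ l) → WalkList G (x ∷ y ∷ l) → L + length (x ∷ y ∷ l) ≡ suc m → ⊥
    grow zero x y l Ux uq wk len = <-irrefl refl (≤-trans (≤-reflexive (sym len)) (Fin.injective⇒≤ (λ {i} {j} → lookup-injective uq i j)))
    grow (suc L) x y l Ux uq wk len with another x y Ux
    ... | (z , z≢y , Uz , xz) with any? (λ i → lookup (x ∷ y ∷ l) i Fin.≟ z)
    ...   | no none = grow L z x (y ∷ l) Uz (fresh ∷ uq) (≡⇒T (trans (Graph.sym G z x) xz) , wk) (trans (+-suc L _) len)
      where
      fresh : All (z ≢_) (x ∷ y ∷ l)
      fresh = All.tabulate λ {a} a∈ e → none (Any.index a∈ , trans (sym (lookup-index a∈)) (sym e))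
    ...   | yes (zero , refl) = true≢false xz (Graph.irrefl G x)
    ...   | yes (suc zero , e) = z≢y (sym e)
    ...   | yes (suc (suc i) , refl) with uq
    ...     | (x≢y ∷ x∉) ∷ (y∉ ∷ uql) = acyc (x , y ∷ pre l h , s≤s (pre-length l h) , (x≢y ∷ pre-All l h x∉) ∷ (pre-All l h y∉ ∷ pre-Unique l h uql)
              , proj₁ wk , pre-walk x y l h (proj₂ wk) (≡⇒T (trans (Graph.sym G _ x) xz)))
      where
      h = ∈-lookup {xs = l} i

    empty : ∀ u → U u ≡ true → ⊥
    empty u Uu with pick 2 (λ v → U v ∧ E u v) (two u Uu)
    ... | (f , inj , pf) with ∧-elim (pf zero)
    ...   | (Uy , uy) = go (f zero) Uy uy
      where
      go : ∀ y → U y ≡ true → E u y ≡ true → ⊥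
      go y Uy uy = grow (suc m ∸ 2) y u [] Uy ((y≢u ∷ []) ∷ ([] ∷ [])) (≡⇒T (trans (Graph.sym G y u) uy) , tt) (m∸n+n≡m (≤-trans 2≤m (n≤1+n m)))
        where
        y≢u : y ≢ u
        y≢u refl = true≢false uy (Graph.irrefl G u)
        2≤m : 2 ≤ m
        2≤m = ≤-trans (unique≤count {P = λ _ → true} ((y≢u ∷ []) ∷ ([] ∷ [])) (refl ∷ refl ∷ [])) (≤-reflexive (count-full {P = λ _ → true} λ _ → refl))

  edges : (Fin m → Bool) → ℕ
  edges U = sum (λ a → count (λ b → U a ∧ (U b ∧ E a b)))

  -- Unless `U` is empty, `empty` provides a vertex with at most one neighbour in `U`; deleting it
  -- loses at most two ordered edges.
  acyclic-edges : Acyclic G → ∀ c (U : Fin m → Bool) → count U ≤ c → edges U ≤ 2 * c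
  acyclic-edges acyc c U le with any? (λ u → (U u ∧ ltb (count (λ v → U v ∧ E u v)) 2) Bool.≟ true)
  ... | no none = ≤-trans (≤-reflexive (trans (sum-cong λ a → trans (sum-cong λ b → ⟦⟧-false (¬true⇒false λ h → noU a (proj₁ (∧-elim h)))) sum-0) sum-0)) z≤n
    where
    noU : ∀ u → U u ≡ true → ⊥
    noU = empty acyc U λ u Uu → ≮⇒≥ λ lt → none (u , ∧-intro Uu (ltb-intro lt))
  ... | yes (u , h) = drop c le
    where
    Uu = proj₁ (∧-elim h)
    d = count (λ v → U v ∧ E u v)
    d≤1 : d ≤ 1
    d≤1 = ≤-pred (ltb-true {d} (proj₂ (∧-elim {U u} h)))
    U′ : Fin m → Bool
    U′ a = U a ∧ not (u == a)
    count′ : suc (count U′) ≤ count U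
    count′ = sum-mono-< (λ a → ⟦⟧-mono {U′ a} λ e → proj₁ (∧-elim e)) u
      (≤-trans (s≤s (≤-reflexive (⟦⟧-false (trans (cong (λ b → U u ∧ not b) (==-refl u)) (Bool.∧-zeroʳ (U u)))))) (≤-reflexive (sym (⟦⟧-true Uu))))
    f : Fin m → Fin m → ℕ
    f a b = ⟦ U′ a ∧ (U′ b ∧ E a b) ⟧
    pt : ∀ a b → ⟦ U a ∧ (U b ∧ E a b) ⟧ ≤ f a b + (⟦ u == a ⟧ * ⟦ U b ∧ E u b ⟧ + ⟦ u == b ⟧ * ⟦ U a ∧ E u a ⟧)
    pt a b with u Fin.≟ a | u Fin.≟ b
    ... | yes refl | _ = ≤-trans (⟦⟧-mono {b = U b ∧ E u b} λ e → proj₂ (∧-elim {U u} e)) (≤-trans (≤-trans (m≤m+n _ 0) (m≤m+n _ _)) (m≤n+m _ ⟦ (U u ∧ false) ∧ _ ⟧))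
    ... | no _ | yes refl = ≤-trans (⟦⟧-mono {b = U a ∧ E u a} λ e → ∧-intro (proj₁ (∧-elim {U a} e)) (trans (Graph.sym G u a) (proj₂ (∧-elim {U u} (proj₂ (∧-elim {U a} e)))))) (≤-trans (m≤m+n _ 0) (m≤n+m _ ⟦ (U a ∧ true) ∧ ((U u ∧ false) ∧ E a u) ⟧))
    ... | no _ | no _ = ≤-trans (⟦⟧-mono λ e → ∧-intro (∧-intro (proj₁ (∧-elim {U a} e)) refl) (∧-intro (∧-intro (proj₁ (∧-elim {U b} (proj₂ (∧-elim {U a} e)))) refl) (proj₂ (∧-elim {U b} (proj₂ (∧-elim {U a} e)))))) (m≤m+n _ _)
    total : edges U ≤ edges U′ + (d + d)
    total = ≤-trans (sum-mono λ a → sum-mono (pt a)) (≤-reflexive (trans (sum-cong λ a → trans (sum-+ (f a) _) (cong (sum (f a) +_) (trans (sum-+ _ _) (cong₂ _+_ (sum-* ⟦ u == a ⟧ _) (sum-delta u (λ _ → ⟦ U a ∧ E u a ⟧))))))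
      (trans (sum-+ _ _) (cong (edges U′ +_) (trans (sum-+ _ _) (cong₂ _+_ (sum-delta u _) refl))))))
    drop : ∀ c → count U ≤ c → edges U ≤ 2 * c
    drop zero le = ⊥-elim (n≮0 (≤-trans count′ le))
    drop (suc c) le = ≤-trans total (≤-trans (+-mono-≤ (acyclic-edges acyc c U′ (≤-pred (≤-trans count′ le))) (+-mono-≤ d≤1 d≤1)) (≤-reflexive (eq c)))
      where
      eq : ∀ c → 2 * c + 2 ≡ 2 * suc c
      eq = solve-∀

  acyclic-deg : Acyclic G → sum (deg E) ≤ 2 * m
  acyclic-deg acyc = acyclic-edges acyc m (λ _ → true) (≤-reflexive (count-full {P = λ _ → true} λ _ → refl))

degree≡deg : (G : Graph m) (v : Fin m) → degree G v ≡ deg (adj G) v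
degree≡deg G v = length-filter-tabulate (λ u → T? (adj G v u)) id

leaves≡ : (G : Graph m) → leaves G ≡ count (λ v → does (degree G v ≟ 1))
leaves≡ G = length-filter-tabulate (λ v → degree G v ≟ 1) id

-- Covering vertices in forests

-- Each choice rules out at most `β` candidates, and `P` has more than `r * β`.
greedy : (P : Fin n → Bool) (B : Gr n) (β : ℕ) → Symm B → (∀ x → P x ≡ true → count (B x) ≤ β) →
  ∀ r → r * β < count P →
  Σ (Fin r → Fin n) λ f → (∀ i → P (f i) ≡ true) × (∀ i j → i ≢ j → B (f i) (f j) ≡ false)
greedy P B β symB B≤ zero lt = (λ ()) , (λ ()) , λ ()
greedy {n} P B β symB B≤ (suc r) lt = extend (greedy P B β symB B≤ r (≤-<-trans (m≤n+m (r * β) β) lt))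
  where
  extend : (Σ (Fin r → Fin n) λ f → (∀ i → P (f i) ≡ true) × (∀ i j → i ≢ j → B (f i) (f j) ≡ false)) →
    Σ (Fin (suc r) → Fin n) λ f → (∀ i → P (f i) ≡ true) × (∀ i j → i ≢ j → B (f i) (f j) ≡ false)
  extend (f , pf , bf) with any? (λ x → (P x ∧ not (anyF (λ i → B (f i) x))) Bool.≟ true)
  ... | yes (x , h) = g , gp , gb
    where
    g : Fin (suc r) → Fin n
    g zero = x
    g (suc i) = f i
    gp : ∀ i → P (g i) ≡ true
    gp zero = proj₁ (∧-elim h)
    gp (suc i) = pf i
    new : ∀ i → B (f i) x ≡ false
    new = anyF-none {P = λ i → B (f i) x} (not-elim (proj₂ (∧-elim {P x} h)))
    gb : ∀ i j → i ≢ j → B (g i) (g j) ≡ false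
    gb zero zero ne = ⊥-elim (ne refl)
    gb zero (suc j) _ = trans (symB x (f j)) (new j)
    gb (suc i) zero _ = new i
    gb (suc i) (suc j) ne = bf i j (ne ∘ cong suc)
  ... | no none = ⊥-elim (<-irrefl refl (<-≤-trans lt (≤-trans (count-mono {Q = λ x → anyF (λ i → B (f i) x)} all) (≤-trans (count-any′ (λ i x → B (f i) x))
      (≤-trans (sum-bound β λ i → B≤ (f i) (pf i)) (m≤n+m (r * β) β))))))
    where
    all : ∀ x → P x ≡ true → anyF (λ i → B (f i) x) ≡ true
    all x p with decBool (anyF (λ i → B (f i) x))
    ... | inj₁ e = e
    ... | inj₂ e = ⊥-elim (none (x , ∧-intro p (not-intro e)))

opaque
  -- As degrees sum to at most `2 * n`, at most n/20 vertices have degree above 40.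
  D₀ : ℕ
  D₀ = 40

  2≤D₀ : 2 ≤ D₀
  2≤D₀ = s≤s (s≤s z≤n)

  40≤D₀ : 2 * 20 ≤ D₀
  40≤D₀ = ≤-refl

leaf : Gr n → Fin n → Bool
leaf E u = ltb 0 (deg E u) ∧ not (ltb 1 (deg E u))

leaf⇒ : (E : Gr n) (u : Fin n) → leaf E u ≡ true → deg E u ≡ 1
leaf⇒ E u h = ≤-antisym (ltb-false {1} (not-elim (proj₂ (∧-elim {ltb 0 (deg E u)} h)))) (ltb-true {0} (proj₁ (∧-elim h)))

⇒leaf : (E : Gr n) (u : Fin n) → deg E u ≡ 1 → leaf E u ≡ true
⇒leaf E u h = subst (λ z → ltb 0 z ∧ not (ltb 1 z) ≡ true) (sym h) refl

nbr⇒deg : (E : Gr n) {u v : Fin n} → E u v ≡ true → 1 ≤ deg E u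
nbr⇒deg E {u} {v} h = ≤-trans (≤-reflexive (sym (⟦⟧-true h))) (term≤sum (λ b → ⟦ E u b ⟧) v)

two-nbrs : (E : Gr n) {u v w : Fin n} → E u v ≡ true → E u w ≡ true → v ≢ w → 2 ≤ deg E u
two-nbrs E hv hw v≢w = unique≤count ((v≢w ∷ []) ∷ ([] ∷ [])) (hv ∷ hw ∷ [])

leaf-unique : (E : Gr n) {u v w : Fin n} → deg E u ≡ 1 → E u v ≡ true → E u w ≡ true → v ≡ w
leaf-unique E {u} {v} {w} d hv hw with v Fin.≟ w
... | yes e = e
... | no ne = ⊥-elim (<-irrefl refl (≤-trans (two-nbrs E hv hw ne) (≤-reflexive d)))

-- A stock of vertices for covering foreign slots: two families, together independent, whose
-- neighbours have small degree or are among at most two hubs `AB`. `Sp` is for vertices reserved in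
-- connection with the centres of star-like trees. The vertices put on those centres have degree at
-- most two, so `AB-deg` keeps the hubs apart from them.
record Cover (M d₂ : ℕ) (E : Gr n) (Sp : List (Fin n)) : Set where
  field
    X : Bool → Fin M → Fin n
    X-inj : ∀ {c i c′ i′} → X c i ≡ X c′ i′ → c ≡ c′ × i ≡ i′
    X-deg₁ : ∀ c i → 1 ≤ deg E (X c i)
    X-deg : ∀ c i → deg E (X c i) ≤ D₀
    X-Sp : ∀ c i → ¬ (X c i ∈ Sp)
    X-ind : ∀ c i c′ i′ → E (X c i) (X c′ i′) ≡ true → ⊥
    AB : List (Fin n)
    AB-length : length AB ≤ 2
    AB-deg : ∀ {v} → v ∈ AB → 3 ≤ deg E v
    X-AB : ∀ c i → ¬ (X c i ∈ AB)
    X-nbr : ∀ c i v → E (X c i) v ≡ true → v ∈ AB ⊎ deg E v ≤ d₂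

-- Expresses that the two families have disjoint neighbourhoods, by a colour that can be read off at
-- the neighbour alone.
Coloured : {M d₂ : ℕ} {E : Gr n} {Sp : List (Fin n)} → Cover M d₂ E Sp → Set
Coloured {n} {E = E} C = Σ (Fin n → Bool) λ col → ∀ c i v → E (X c i) v ≡ true → col v ≡ c
  where open Cover C

side : ∀ {M} → Bool → Fin M → Fin (M + M)
side {M} true i = i ↑ˡ M
side {M} false i = M ↑ʳ i

side-inj : ∀ {M} c c′ {i i′ : Fin M} → side c i ≡ side c′ i′ → c ≡ c′ × i ≡ i′
side-inj {M} true true {i} {i′} e = refl , Fin.↑ˡ-injective M i i′ e
side-inj {M} false false {i} {i′} e = refl , Fin.↑ʳ-injective M i i′ e
side-inj {M} true false {i} {i′} e with trans (sym (Fin.splitAt-↑ˡ M i M)) (trans (cong (splitAt M) e) (Fin.splitAt-↑ʳ M M i′))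
... | ()
side-inj {M} false true {i} {i′} e with trans (sym (Fin.splitAt-↑ʳ M M i)) (trans (cong (splitAt M) e) (Fin.splitAt-↑ˡ M i′ M))
... | ()

one-of-five : ∀ a p h s f → (a ≡ false → p ≡ false → h ≡ false → s ≡ false → f ≡ false → ⊥) →
  1 ≤ (((⟦ a ⟧ + ⟦ p ⟧) + ⟦ h ⟧) + ⟦ s ⟧) + ⟦ f ⟧
one-of-five true p h s f _ = s≤s z≤n
one-of-five false true h s f _ = s≤s z≤n
one-of-five false false true s f _ = s≤s z≤n
one-of-five false false false true f _ = s≤s z≤n
one-of-five false false false false true _ = s≤s z≤n
one-of-five false false false false false c = ⊥-elim (c refl refl refl refl refl)

module Forest {n k : ℕ} (E : Gr n) (symE : Symm E) (irrE : Irr E) (sumE : sum (deg E) ≤ 2 * n)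
  (real : Fin n → Bool) (fake≤k : count (λ v → not (real v)) ≤ k) (real⇒ : ∀ v → real v ≡ true → 1 ≤ deg E v) where

  isolated≤ : ∀ u → 1 ≤ deg E u + ⟦ not (real u) ⟧
  isolated≤ u with decBool (real u)
  ... | inj₁ h = ≤-trans (real⇒ u h) (m≤m+n _ _)
  ... | inj₂ h = ≤-trans (≤-reflexive (sym (⟦⟧-true (not-intro h)))) (m≤n+m _ _)

  at-least-two : ∀ {u v} → E v u ≡ true → leaf E u ≡ false → 2 ≤ deg E u
  at-least-two {u} {v} h l = ≰⇒> λ le → true≢false (⇒leaf E u (≤-antisym le (nbr⇒deg E (trans (symE u v) h)))) l

  -- Every neighbour of `c` that is not a leaf has degree at least two. With d the degree of `c`,
  -- the degree sum then gives at least 2d - n - k - 1 leaves at `c`, which is at least n/5 - k - 1.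
  star-leaves : ∀ c R → 3 * n ≤ 5 * deg E c → 5 * (R + k + 1) ≤ n → R ≤ count (λ u → E c u ∧ leaf E u)
  star-leaves c R big room = *-cancelˡ-≤ 5 (arith (deg E c) n k R ℓ total big room)
    where
    d = deg E c
    ℓ = count (λ u → E c u ∧ leaf E u)
    1≤d : 1 ≤ d
    1≤d = ≰⇒> λ le → <-irrefl refl (≤-trans (≤-trans (≤-trans (s≤s z≤n) (≤-trans (≤-reflexive (eq R k)) room)) (m≤m+n n _)) (≤-trans big (≤-trans (*-monoʳ-≤ 5 le) (≤-reflexive refl))))
      where
      eq : ∀ R k → 1 + (4 + 5 * (R + k)) ≡ 5 * (R + k + 1)
      eq = solve-∀
    f : Fin n → ℕ
    f u = ⟦ E c u ⟧ + 1
    g : Fin n → ℕ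
    g u = ⟦ E c u ∧ leaf E u ⟧ + deg E u
    pt : ∀ u → (⟦ E c u ⟧ + 1) + ⟦ c == u ⟧ * (d ∸ 1) ≤ (⟦ E c u ∧ leaf E u ⟧ + deg E u) + ⟦ not (real u) ⟧
    pt u with c Fin.≟ u
    ... | yes refl rewrite irrE c = ≤-trans (≤-reflexive (trans (cong suc (+-identityʳ (d ∸ 1))) (m+[n∸m]≡n 1≤d))) (m≤m+n d _)
    ... | no _ with E c u in e
    ...   | false = ≤-trans (isolated≤ u) (≤-reflexive refl)
    ...   | true with leaf E u in l
    ...     | true = ≤-trans (s≤s (nbr⇒deg E (trans (symE u c) e))) (m≤m+n _ _)
    ...     | false = ≤-trans (at-least-two e l) (m≤m+n _ _)
    total : (d + n) + (d ∸ 1) ≤ (ℓ + 2 * n) + k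
    total = ≤-trans (≤-reflexive (sym (trans (sum-+ f _) (cong₂ _+_ (trans (sum-+ _ _) (cong (d +_) sum-1)) (sum-delta c (λ _ → d ∸ 1))))))
      (≤-trans (sum-mono pt) (≤-trans (≤-reflexive (trans (sum-+ g _) (cong (_+ count (not ∘ real)) (sum-+ _ _)))) (+-mono-≤ (+-monoʳ-≤ ℓ sumE) fake≤k)))
    arith : ∀ d n k R ℓ → (d + n) + (d ∸ 1) ≤ (ℓ + 2 * n) + k → 3 * n ≤ 5 * d → 5 * (R + k + 1) ≤ n → 5 * R ≤ 5 * ℓ
    arith d n k R ℓ t b r = go (d ∸ 1) (m≤n+m∸n d 1) t
      where
      eq : ∀ d n k R ℓ e → 5 * ℓ + (5 * (d + n + e) + 2 * (3 * n) + 5 * (R + k + 1) + 5 * d) ≡ 5 * R + (5 * (ℓ + 2 * n + k) + 2 * (5 * d) + n + 5 * (1 + e)) + 0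
      eq = solve-∀
      go : ∀ e → d ≤ 1 + e → (d + n) + e ≤ (ℓ + 2 * n) + k → 5 * R ≤ 5 * ℓ
      go e d≤ t = lin 0 (+-mono-≤ (+-mono-≤ (+-mono-≤ (*-monoʳ-≤ 5 t) (*-monoʳ-≤ 2 b)) r) (*-monoʳ-≤ 5 d≤)) (eq d n k R ℓ e)

  star-cover : ∀ c M d₂ → 3 * n ≤ 5 * deg E c → 5 * ((M + M) + k + 1) ≤ n → 3 ≤ M → Σ (Cover M d₂ E []) λ C → ∀ b i v → E (Cover.X C b i) v ≡ true → v ≡ c
  star-cover c M d₂ big room 3≤M = go (pick (M + M) (λ u → E c u ∧ leaf E u) (star-leaves c (M + M) big room))
    where
    go : (Σ (Fin (M + M) → Fin n) λ f → (∀ {i j} → f i ≡ f j → i ≡ j) × (∀ i → E c (f i) ∧ leaf E (f i) ≡ true)) → _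
    go (f , inj , pf) = record
      { X = X ; X-inj = λ {a} {i} {b} {j} e → side-inj a b (inj e) ; X-deg₁ = λ a i → ≤-reflexive (sym (X1 a i)) ; X-deg = λ a i → ≤-trans (≤-reflexive (X1 a i)) (≤-trans (n≤1+n 1) 2≤D₀)
      ; X-Sp = λ _ _ () ; X-ind = λ a i b j h → notX b j (only a i _ h)
      ; AB = c ∷ [] ; AB-length = s≤s z≤n ; AB-deg = λ { (here refl) → 3≤deg } ; X-AB = λ { a i (here e) → notX a i e }
      ; X-nbr = λ a i v h → inj₁ (here (only a i v h)) } , only
      where
      X : Bool → Fin M → Fin n
      X b i = f (side b i)
      X1 : ∀ b i → deg E (X b i) ≡ 1
      X1 b i = leaf⇒ E _ (proj₂ (∧-elim {E c (X b i)} (pf (side b i))))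
      only : ∀ b i v → E (X b i) v ≡ true → v ≡ c
      only b i v h = leaf-unique E (X1 b i) h (trans (symE _ c) (proj₁ (∧-elim (pf (side b i)))))
      3≤deg : 3 ≤ deg E c
      3≤deg = ≤-trans 3≤M (≤-trans (m≤m+n M M) (inj-count (E c) f inj λ i → proj₁ (∧-elim (pf i))))
      notX : ∀ b i → X b i ≢ c
      notX b i e = true≢false (proj₁ (∧-elim (pf (side b i)))) (trans (cong (E c) e) (irrE c))

  -- Either linearly many vertices of bounded degree have no neighbour of degree above d₂, or, by counting degrees,
  -- almost all vertices are leaves at vertices of degree above d₂; as no degree exceeds 3n/5, two of these then have many leaves.
  module Dichotomy (M d₂ η σ : ℕ) (Sp : List (Fin n)) (Sp≤ : length Sp ≤ σ) (3≤M : 3 ≤ M)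
    (H≤ : count (λ u → ltb d₂ (deg E u)) ≤ η)
    (flat : ∀ v → 5 * deg E v ≤ 3 * n)
    (room₁ : 20 * ((M + M) * (1 + D₀ + D₀ * d₂)) ≤ n)
    (room₂ : 20 * (η * M) + (80 * σ + 60 * k + 40 * η) < 4 * n) where

    H : Fin n → Bool
    H u = ltb d₂ (deg E u)

    adjH : Fin n → Bool
    adjH u = anyF (λ h → H h ∧ E h u)

    pool : Fin n → Bool
    pool u = ltb 0 (deg E u) ∧ (not (ltb D₀ (deg E u)) ∧ (not (adjH u) ∧ not (u ∈ᵇ Sp)))

    pool⇒ : ∀ {u} → pool u ≡ true → 1 ≤ deg E u × deg E u ≤ D₀ × adjH u ≡ false × ¬ (u ∈ Sp)
    pool⇒ {u} h = let (a , h₁) = ∧-elim {ltb 0 (deg E u)} h ; (b , h₂) = ∧-elim {not (ltb D₀ (deg E u))} h₁ ; (c , d) = ∧-elim {not (adjH u)} h₂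
      in ltb-true {0} a , ltb-false {D₀} (not-elim b) , not-elim c , λ m → true≢false (∈⇒∈ᵇ m) (not-elim d)

    module Many (many : n < 20 * count pool) where
      common : Gr n
      common x y = anyF (λ z → E x z ∧ E z y)

      -- Vertices that are pairwise not bad have disjoint neighbourhoods, so any splitting of them
      -- into two families can be coloured. A vertex of the pool has at most `D₀` neighbours, of
      -- degree at most `d₂`, and hence few bad partners.
      Bad : Gr n
      Bad x y = (x == y) ∨ (E x y ∨ common x y)

      common-sym : ∀ {x y} → common x y ≡ true → common y x ≡ true
      common-sym {x} {y} h = let (z , e) = anyF-elim {P = λ z → E x z ∧ E z y} h ; (a , b) = ∧-elim {E x z} e
        in anyF-intro z (∧-intro (trans (symE y z) b) (trans (symE z x) a))

      Bad-sym→ : ∀ {x y} → Bad x y ≡ true → Bad y x ≡ true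
      Bad-sym→ {x} {y} h with ∨-elim {x == y} h
      ... | inj₁ e = ∨-introˡ (trans (cong (y ==_) (==⇒≡ {x = x} e)) (==-refl y))
      ... | inj₂ e with ∨-elim {E x y} e
      ...   | inj₁ p = ∨-introʳ {y == x} (∨-introˡ (trans (symE y x) p))
      ...   | inj₂ p = ∨-introʳ {y == x} (∨-introʳ {E y x} (common-sym p))

      Bad-sym : Symm Bad
      Bad-sym x y = ⇔⇒≡ (Bad-sym→ {x} {y}) (Bad-sym→ {y} {x})

      count-∨ : (P Q : Fin n → Bool) → count (λ x → P x ∨ Q x) ≤ count P + count Q
      count-∨ P Q = ≤-trans (sum-mono {g = λ x → ⟦ P x ⟧ + ⟦ Q x ⟧} go) (≤-reflexive (sum-+ _ _))
        where
        go : ∀ x → ⟦ P x ∨ Q x ⟧ ≤ ⟦ P x ⟧ + ⟦ Q x ⟧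
        go x with P x
        ... | true = s≤s z≤n
        ... | false = ≤-refl

      Bad≤ : ∀ x → pool x ≡ true → count (Bad x) ≤ 1 + D₀ + D₀ * d₂
      Bad≤ x h with pool⇒ h
      ... | (_ , d≤ , nH , _) = ≤-trans (count-∨ (x ==_) _) (≤-trans (+-mono-≤ (≤-reflexive (count-single x)) (≤-trans (count-∨ (E x) (common x)) (+-mono-≤ d≤ com≤))) (≤-reflexive (sym (+-assoc 1 D₀ (D₀ * d₂)))))
        where
        com≤ : count (common x) ≤ D₀ * d₂
        com≤ = ≤-trans (count-any (E x) E) (≤-trans (sum-mono λ z → ⟦⟧*-mono (E x z) λ e → ltb-false {d₂} (¬true⇒false λ hz → true≢false (anyF-intro z (∧-intro hz (trans (symE z x) e))) nH))
          (≤-trans (≤-reflexive (sum-*ʳ d₂ _)) (*-monoˡ-≤ d₂ d≤)))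

      selected = greedy pool Bad (1 + D₀ + D₀ * d₂) Bad-sym Bad≤ (M + M) (*-cancelˡ-< 20 _ _ (≤-<-trans room₁ many))

      finish : (Σ (Fin (M + M) → Fin n) λ f → (∀ i → pool (f i) ≡ true) × (∀ i j → i ≢ j → Bad (f i) (f j) ≡ false)) →
        Σ (Cover M d₂ E Sp) Coloured
      finish (f , pf , bf) = record
        { X = X ; X-inj = λ {a} {i} {b} {j} e → side-inj a b (inj (side a i) (side b j) e)
        ; X-deg₁ = λ c i → proj₁ (props c i) ; X-deg = λ c i → proj₁ (proj₂ (props c i))
        ; X-Sp = λ c i → proj₂ (proj₂ (proj₂ (props c i))) ; X-ind = λ c i c′ i′ h → ind (side c i) (side c′ i′) h
        ; AB = [] ; AB-length = z≤n ; AB-deg = λ () ; X-AB = λ _ _ ()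
        ; X-nbr = λ c i v h → inj₂ (ltb-false {d₂} (¬true⇒false λ hz → true≢false (anyF-intro v (∧-intro hz (trans (symE v _) h))) (proj₁ (proj₂ (proj₂ (props c i)))))) }
        , col , col-ok
        where
        X : Bool → Fin M → Fin n
        X c i = f (side c i)
        props : ∀ c i → 1 ≤ deg E (X c i) × deg E (X c i) ≤ D₀ × adjH (X c i) ≡ false × ¬ (X c i ∈ Sp)
        props c i = pool⇒ (pf (side c i))
        inj : ∀ i j → f i ≡ f j → i ≡ j
        inj i j e with i Fin.≟ j
        ... | yes p = p
        ... | no ne = ⊥-elim (true≢false (∨-introˡ {f i == f j} (trans (cong (f i ==_) (sym e)) (==-refl (f i)))) (bf i j ne))
        ind : ∀ i j → E (f i) (f j) ≡ true → ⊥
        ind i j h with i Fin.≟ j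
        ... | yes refl = true≢false h (irrE (f i))
        ... | no ne = true≢false (∨-introʳ {f i == f j} (∨-introˡ h)) (bf i j ne)
        apart : ∀ i j v → i ≢ j → E (f i) v ≡ true → E (f j) v ≡ true → ⊥
        apart i j v ne hi hj = true≢false (∨-introʳ {f i == f j} (∨-introʳ {E (f i) (f j)} (anyF-intro v (∧-intro hi (trans (symE v (f j)) hj))))) (bf i j ne)
        col : Fin n → Bool
        col v = anyF (λ i → E (X true i) v)
        col-ok : ∀ c i v → E (X c i) v ≡ true → col v ≡ c
        col-ok true i v h = anyF-intro i h
        col-ok false i v h = ¬true⇒false λ e → let (j , q) = anyF-elim {P = λ i → E (X true i) v} e in apart (side true j) (side false i) v (λ e′ → case proj₁ (side-inj true false e′) of λ ()) q h

    module Few (few : 20 * count pool ≤ n) where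
      free : Fin n → Bool
      free u = leaf E u ∧ not (u ∈ᵇ Sp)

      ℓ : Fin n → ℕ
      ℓ h = count (λ u → E h u ∧ free u)

      LH A : ℕ
      LH = sum (λ h → ⟦ H h ⟧ * ℓ h)
      A = count adjH

      hi : Fin n → Bool
      hi u = ltb D₀ (deg E u)

      hi≤ : 20 * count hi ≤ n
      hi≤ = *-cancelˡ-≤ 2 (≤-trans (≤-reflexive (trans (sym (*-assoc 2 20 (count hi))) (*-comm 40 (count hi)))) (≤-trans (*-monoʳ-≤ (count hi) 40≤D₀) (≤-trans (markov D₀ hi (deg E) λ i h → <⇒≤ (ltb-true {D₀} h)) sumE)))

      inSp fake : Fin n → Bool
      inSp u = u ∈ᵇ Sp
      fake u = not (real u)

      pt₁ : ∀ u → 1 ≤ (((⟦ adjH u ⟧ + ⟦ pool u ⟧) + ⟦ hi u ⟧) + ⟦ inSp u ⟧) + ⟦ fake u ⟧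
      pt₁ u = one-of-five (adjH u) (pool u) (hi u) (inSp u) (fake u) λ a p h s f →
        true≢false (∧-intro (ltb-intro {0} (real⇒ u (not-fake f))) (∧-intro (not-intro h) (∧-intro (not-intro a) (not-intro s)))) p
        where
        not-fake : ∀ {b} → not b ≡ false → b ≡ true
        not-fake {true} _ = refl

      f : Fin n → ℕ
      f u = sum (λ h → ⟦ H h ⟧ * ⟦ E h u ∧ free u ⟧)

      f≥1 : ∀ u → adjH u ≡ true → free u ≡ true → 1 ≤ f u
      f≥1 u a fr = let (h , e) = anyF-elim {P = λ h → H h ∧ E h u} a ; (p , q) = ∧-elim {H h} e in
        ≤-trans (≤-reflexive (sym (cong₂ _*_ (⟦⟧-true p) (⟦⟧-true (∧-intro q fr))))) (term≤sum (λ h → ⟦ H h ⟧ * ⟦ E h u ∧ free u ⟧) h)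

      -- A local form of the degree count. A vertex next to `H` has degree at least two unless it is
      -- a leaf, and such a leaf is counted by `f` or lies in `Sp`. Vertices of `H` carry their own
      -- degree on both sides.
      pt₂ : ∀ u → (⟦ adjH u ⟧ + 1) + ⟦ H u ⟧ * deg E u ≤ (((f u + deg E u) + 2 * ⟦ H u ⟧) + 2 * ⟦ inSp u ⟧) + ⟦ fake u ⟧
      pt₂ u with decBool (H u)
      ... | inj₁ p rewrite p = ≤-trans (≤-trans (+-mono-≤ (+-monoˡ-≤ 1 (⟦⟧≤1 (adjH u))) (≤-reflexive (+-identityʳ (deg E u)))) (≤-trans (≤-reflexive (+-comm 2 (deg E u))) (+-monoˡ-≤ 2 (m≤n+m (deg E u) (f u))))) (≤-trans (m≤m+n _ (2 * ⟦ inSp u ⟧)) (m≤m+n _ ⟦ fake u ⟧))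
      ... | inj₂ p rewrite p with decBool (adjH u)
      ...   | inj₂ a rewrite a = ≤-trans (isolated≤ u) (+-monoˡ-≤ ⟦ fake u ⟧ (≤-trans (≤-trans (m≤n+m (deg E u) (f u)) (m≤m+n _ 0)) (m≤m+n _ (2 * ⟦ inSp u ⟧))))
      ...   | inj₁ a = ≤-trans (≤-trans (≤-reflexive (+-identityʳ _)) (+-monoˡ-≤ 1 (⟦⟧≤1 (adjH u)))) main
        where
        hE : ∃ λ h → E h u ≡ true
        hE = let (h , e) = anyF-elim {P = λ h → H h ∧ E h u} a in h , proj₂ (∧-elim {H h} e)
        dg : 1 ≤ deg E u
        dg = nbr⇒deg E (trans (symE u _) (proj₂ hE))
        main : 2 ≤ (((f u + deg E u) + 0) + 2 * ⟦ inSp u ⟧) + ⟦ fake u ⟧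
        main with decBool (leaf E u) | decBool (inSp u)
        ... | inj₂ l | _ = ≤-trans (at-least-two (proj₂ hE) l) (≤-trans (≤-trans (≤-trans (m≤n+m (deg E u) (f u)) (m≤m+n _ 0)) (m≤m+n _ (2 * ⟦ inSp u ⟧))) (m≤m+n _ ⟦ fake u ⟧))
        ... | inj₁ l | inj₁ s rewrite s = ≤-trans (m≤n+m 2 _) (m≤m+n _ ⟦ fake u ⟧)
        ... | inj₁ l | inj₂ s = ≤-trans (+-mono-≤ (f≥1 u a (∧-intro l (not-intro s))) dg) (≤-trans (≤-trans (m≤m+n _ 0) (m≤m+n _ (2 * ⟦ inSp u ⟧))) (m≤m+n _ ⟦ fake u ⟧))

      A≤ : A ≤ sum (λ u → ⟦ H u ⟧ * deg E u)
      A≤ = count-any H E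

      tot₁ : n ≤ (((A + count pool) + count hi) + σ) + k
      tot₁ = ≤-trans (≤-reflexive (sym sum-1)) (≤-trans (sum-mono pt₁) (≤-trans (≤-reflexive
        (trans (sum-+ _ _) (cong (_+ count fake) (trans (sum-+ _ _) (cong (_+ count inSp) (trans (sum-+ _ _) (cong (_+ count hi) (sum-+ _ _))))))))
        (+-mono-≤ (+-monoʳ-≤ (A + count pool + count hi) (≤-trans (count-∈ᵇ Sp) Sp≤)) fake≤k)))

      LH≡ : sum f ≡ LH
      LH≡ = trans (sum-comm (λ u h → ⟦ H h ⟧ * ⟦ E h u ∧ free u ⟧)) (sum-cong λ h → sum-* ⟦ H h ⟧ _)

      tot₂ : (A + n) + sum (λ u → ⟦ H u ⟧ * deg E u) ≤ (((LH + 2 * n) + 2 * η) + 2 * σ) + k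
      tot₂ = ≤-trans (≤-reflexive (sym (trans (sum-+ (λ u → ⟦ adjH u ⟧ + 1) _) (cong (_+ sum (λ u → ⟦ H u ⟧ * deg E u)) (trans (sum-+ _ _) (cong (A +_) sum-1))))))
        (≤-trans (sum-mono pt₂) (≤-trans (≤-reflexive
        (trans (sum-+ (λ u → ((f u + deg E u) + 2 * ⟦ H u ⟧) + 2 * ⟦ inSp u ⟧) _) (cong (_+ count fake) (trans (sum-+ (λ u → (f u + deg E u) + 2 * ⟦ H u ⟧) _) (cong₂ _+_ (trans (sum-+ (λ u → f u + deg E u) _) (cong₂ _+_ (trans (sum-+ f _) (cong (_+ sum (deg E)) LH≡)) (sum-* 2 _))) (sum-* 2 _))))))
        (+-mono-≤ (+-mono-≤ (+-mono-≤ (+-monoʳ-≤ LH sumE) (*-monoʳ-≤ 2 H≤)) (*-monoʳ-≤ 2 (≤-trans (count-∈ᵇ Sp) Sp≤))) fake≤k)))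

      arith : ∀ A p h σ k n B L η → n ≤ (((A + p) + h) + σ) + k → 20 * p ≤ n → 20 * h ≤ n → (A + n) + B ≤ (((L + 2 * n) + 2 * η) + 2 * σ) + k → A ≤ B →
        16 * n ≤ 20 * L + (80 * σ + 60 * k + 40 * η)
      arith A p h σ k n B L η h1 h2 h3 h4 h5 = lin 0 (+-mono-≤ (+-mono-≤ (+-mono-≤ (+-mono-≤ (*-monoʳ-≤ 40 h1) (*-monoʳ-≤ 2 h2)) (*-monoʳ-≤ 2 h3)) (*-monoʳ-≤ 20 h4)) (*-monoʳ-≤ 20 h5)) (eq A p h σ k n B L η)
        where
        eq : ∀ A p h σ k n B L η → (20 * L + (80 * σ + 60 * k + 40 * η)) + (40 * n + 2 * (20 * p) + 2 * (20 * h) + 20 * ((A + n) + B) + 20 * A)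
          ≡ 16 * n + (40 * ((((A + p) + h) + σ) + k) + 2 * n + 2 * n + 20 * ((((L + 2 * n) + 2 * η) + 2 * σ) + k) + 20 * B) + 0
        eq = solve-∀

      -- Up to bounded terms, `tot₁` makes `A` at least 9n/10, and `tot₂` with `A≤` makes `LH` at
      -- least 2A - n, that is 4n/5.
      LH≥ : 16 * n ≤ 20 * LH + (80 * σ + 60 * k + 40 * η)
      LH≥ = arith A (count pool) (count hi) σ k n _ LH η tot₁ few hi≤ tot₂ A≤

      -- A single vertex accounts for at most 3n/5 of these 4n/5 leaves, and `M` leaves at each of
      -- `η` vertices are too few for the remaining n/5.
      contra : ∀ {x} → LH ≤ η * M + x → 5 * x ≤ 3 * n → ⊥
      contra {x} h hx = <-irrefl refl (≤-<-trans (ar n LH (η * M) x (80 * σ + 60 * k + 40 * η) LH≥ h hx) room₂)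
        where
        ar : ∀ n L e x r → 16 * n ≤ 20 * L + r → L ≤ e + x → 5 * x ≤ 3 * n → 4 * n ≤ 20 * e + r
        ar n L e x r h1 h2 h3 = lin 0 (+-mono-≤ (+-mono-≤ h1 (*-monoʳ-≤ 20 h2)) (*-monoʳ-≤ 4 h3)) (eq n L e x r)
          where
          eq : ∀ n L e x r → (20 * e + r) + (16 * n + 20 * L + 4 * (5 * x)) ≡ 4 * n + (20 * L + r + 20 * (e + x) + 4 * (3 * n)) + 0
          eq = solve-∀

      heavy : Fin n → Bool
      heavy h = H h ∧ not (ltb (ℓ h) M)

      heavy⇒ : ∀ {h} → heavy h ≡ true → M ≤ ℓ h
      heavy⇒ {h} e = ltb-false {ℓ h} (not-elim (proj₂ (∧-elim {H h} e)))

      light⇒ : ∀ {h} → H h ≡ true → heavy h ≡ false → ℓ h ≤ M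
      light⇒ {h} p e = <⇒≤ (ltb-true {ℓ h} (¬false e))
        where
        ¬false : heavy h ≡ false → ltb (ℓ h) M ≡ true
        ¬false e with decBool (ltb (ℓ h) M)
        ... | inj₁ q = q
        ... | inj₂ q = ⊥-elim (true≢false (∧-intro p (not-intro q)) e)

      ℓ≤ : ∀ h → ℓ h ≤ deg E h
      ℓ≤ h = count-mono {Q = E h} λ u e → proj₁ (∧-elim e)

      two-heavy : ∃ λ a → ∃ λ b → a ≢ b × M ≤ ℓ a × M ≤ ℓ b
      two-heavy with any? (λ a → heavy a Bool.≟ true)
      ... | no none = ⊥-elim (contra {0} (≤-trans (≤-trans (sum-mono λ h → ⟦⟧*-mono (H h) λ p → light⇒ p (¬true⇒false λ e → none (h , e))) (≤-trans (≤-reflexive (sum-*ʳ M _)) (*-monoˡ-≤ M H≤))) (m≤m+n _ 0)) z≤n)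
      ... | yes (a , ha) with any? (λ b → (heavy b ∧ not (a == b)) Bool.≟ true)
      ...   | yes (b , hb) = a , b , (λ { refl → true≢false (==-refl a) (not-elim (proj₂ (∧-elim {heavy a} hb))) }) , heavy⇒ ha , heavy⇒ (proj₁ (∧-elim hb))
      ...   | no none = ⊥-elim (contra {ℓ a} (≤-trans (sum-mono pt) (≤-trans (≤-reflexive (trans (sum-+ _ _) (cong₂ _+_ (sum-*ʳ M _) (sum-delta a ℓ)))) (+-monoˡ-≤ (ℓ a) (*-monoˡ-≤ M H≤)))) (≤-trans (*-monoʳ-≤ 5 (ℓ≤ a)) (flat a)))
        where
        pt : ∀ h → ⟦ H h ⟧ * ℓ h ≤ ⟦ H h ⟧ * M + ⟦ a == h ⟧ * ℓ h
        pt h with a Fin.≟ h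
        ... | yes refl = ≤-trans (*-monoˡ-≤ (ℓ a) (⟦⟧≤1 (H a))) (m≤n+m _ (⟦ H a ⟧ * M))
        ... | no a≢h = ≤-trans (⟦⟧*-mono (H h) λ p → light⇒ p (¬true⇒false λ e → none (h , ∧-intro e (not-intro (≢⇒== a≢h))))) (m≤m+n _ _)

      finish : (∃ λ a → ∃ λ b → a ≢ b × M ≤ ℓ a × M ≤ ℓ b) → Σ (Cover M d₂ E Sp) Coloured
      finish (a , b , a≢b , Ma , Mb) = record
        { X = X ; X-inj = λ {c} {i} {c′} {i′} e → inj c c′ e
        ; X-deg₁ = λ c i → ≤-reflexive (sym (X1 c i)) ; X-deg = λ c i → ≤-trans (≤-reflexive (X1 c i)) (≤-trans (n≤1+n 1) 2≤D₀)
        ; X-Sp = λ c i m → true≢false (∈⇒∈ᵇ m) (not-elim (proj₂ (∧-elim {leaf E (X c i)} (proj₂ (∧-elim {E (hub c) (X c i)} (Xp c i))))))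
        ; X-ind = λ c i c′ i′ h → notX c c′ i′ (only c i _ h)
        ; AB = a ∷ b ∷ [] ; AB-length = ≤-refl
        ; AB-deg = λ { (here refl) → hub≥ true ; (there (here refl)) → hub≥ false }
        ; X-AB = λ { c i (here e) → notX true c i e ; c i (there (here e)) → notX false c i e }
        ; X-nbr = λ c i v h → inj₁ (inAB c (only c i v h)) }
        , (a ==_) , col-ok
        where
        hub : Bool → Fin n
        hub true = a
        hub false = b
        hub≤ : ∀ c → M ≤ ℓ (hub c)
        hub≤ true = Ma
        hub≤ false = Mb
        chosen : ∀ c → Σ (Fin M → Fin n) λ f → (∀ {i j} → f i ≡ f j → i ≡ j) × (∀ i → E (hub c) (f i) ∧ free (f i) ≡ true)
        chosen c = pick M (λ u → E (hub c) u ∧ free u) (hub≤ c)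
        X : Bool → Fin M → Fin n
        X c = proj₁ (chosen c)
        Xp : ∀ c i → E (hub c) (X c i) ∧ free (X c i) ≡ true
        Xp c = proj₂ (proj₂ (chosen c))
        hubX : ∀ c i → E (X c i) (hub c) ≡ true
        hubX c i = trans (symE _ _) (proj₁ (∧-elim (Xp c i)))
        X1 : ∀ c i → deg E (X c i) ≡ 1
        X1 c i = leaf⇒ E _ (proj₁ (∧-elim (proj₂ (∧-elim {E (hub c) (X c i)} (Xp c i)))))
        only : ∀ c i v → E (X c i) v ≡ true → v ≡ hub c
        only c i v h = leaf-unique E (X1 c i) h (hubX c i)
        hub≥ : ∀ c → 3 ≤ deg E (hub c)
        hub≥ c = ≤-trans 3≤M (≤-trans (hub≤ c) (ℓ≤ (hub c)))
        notX : ∀ c c′ i → X c′ i ≢ hub c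
        notX c c′ i e = <-irrefl refl (≤-trans (s≤s (s≤s z≤n)) (≤-trans (hub≥ c) (≤-reflexive (trans (cong (deg E) (sym e)) (X1 c′ i)))))
        inAB : ∀ {v} c → v ≡ hub c → v ∈ a ∷ b ∷ []
        inAB true refl = here refl
        inAB false refl = there (here refl)
        hub-inj : ∀ c c′ → hub c ≡ hub c′ → c ≡ c′
        hub-inj true true _ = refl
        hub-inj true false e = ⊥-elim (a≢b e)
        hub-inj false true e = ⊥-elim (a≢b (sym e))
        hub-inj false false _ = refl
        inj : ∀ c c′ {i i′} → X c i ≡ X c′ i′ → c ≡ c′ × i ≡ i′
        inj c c′ {i} {i′} e with hub-inj c c′ (only c′ i′ _ (subst (λ z → E z (hub c) ≡ true) e (hubX c i)))
        ... | refl = refl , proj₁ (proj₂ (chosen c)) e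
        col-ok : ∀ c i v → E (X c i) v ≡ true → (a == v) ≡ c
        col-ok true i v h = trans (cong (a ==_) (only true i v h)) (==-refl a)
        col-ok false i v h = trans (cong (a ==_) (only false i v h)) (≢⇒== a≢b)

    cover : Σ (Cover M d₂ E Sp) Coloured
    cover with 20 * count pool ≤? n
    ... | yes few = Few.finish few (Few.two-heavy few)
    ... | no many = Many.finish (≰⇒> many) (Many.selected (≰⇒> many))

-- The assignment of vertices to slots

_≺_ : ∀ {k} → Fin k → Fin k → Set
i ≺ j = toℕ i < toℕ j

-- What the packing argument uses of the trees.  For a tree j that is not star-like and a later star-like tree i,
-- cv j i is the vertex of j placed on the centre of i (unless skip j i), and nx j i its neighbour further up;
-- rk counts star-like trees and R j is one more than the number of path-like trees before j.
record Kits (n k M d₂ : ℕ) : Set where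
  field
    E : Fin k → Gr n
    symE : ∀ j → Symm (E j)
    irrE : ∀ j → Irr (E j)
    isS isP : Fin k → Bool
    rk R : Fin k → ℕ
    rk-inj : ∀ {i i′} → isS i ≡ true → isS i′ ≡ true → rk i ≡ rk i′ → i ≡ i′
    rk-≺ : ∀ {i i′} → isS i ≡ true → isS i′ ≡ true → rk i < rk i′ → i ≺ i′
    R-inj : ∀ {j j′} → isP j ≡ true → isP j′ ≡ true → R j ≡ R j′ → j ≡ j′
    R≥1 : ∀ j → 1 ≤ R j
    -- Tree `j` is short of `j` vertices, so there is one dummy `dm j e` for every earlier tree `e`.
    dm : Fin k → Fin k → Fin n
    dm-iso : ∀ {j e} → e ≺ j → ∀ v → E j (dm j e) v ≡ true → ⊥
    dm-inj : ∀ {j e e′} → e ≺ j → e′ ≺ j → dm j e ≡ dm j e′ → e ≡ e′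
    X : Fin k → Bool → Fin M → Fin n
    W : Fin k → List (Fin n)
    X-inj : ∀ {j b p b′ p′} → X j b p ≡ X j b′ p′ → b ≡ b′ × p ≡ p′
    X-real : ∀ j b p → 1 ≤ deg (E j) (X j b p)
    X-low : ∀ j b p → deg (E j) (X j b p) ≤ d₂
    X-ind : ∀ j b p b′ p′ → E j (X j b p) (X j b′ p′) ≡ true → ⊥
    X∉W : ∀ j b p → ¬ (X j b p ∈ W j)
    X-nbr : ∀ j b p v → E j (X j b p) v ≡ true → v ∈ W j ⊎ deg (E j) v ≤ d₂
    W-real : ∀ {j v} → v ∈ W j → 1 ≤ deg (E j) v
    c : Fin k → Fin n
    c∈W : ∀ {j} → isS j ≡ true → c j ∈ W j
    c-only : ∀ {j} → isS j ≡ true → ∀ b p v → E j (X j b p) v ≡ true → v ≡ c j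
    col : Fin k → Fin n → Bool
    col-X : ∀ {j} → isS j ≡ false → ∀ b p v → E j (X j b p) v ≡ true → col j v ≡ b
    cv nx : Fin k → Fin k → Fin n
    skip : Fin k → Fin k → Bool
    -- Where the path of `j` skips the centre of `i`, tree `j` lays its dummy with index `dmi j i`
    -- there. By `dmi-S` this index is not star-like, so it differs from the dummies that `j` lays
    -- on the centres of earlier star-like trees.
    dmi : Fin k → Fin k → Fin k

  Later : Fin k → Fin k → Set
  Later j i = isS j ≡ false × isS i ≡ true × j ≺ i

  field
    cv-inj : ∀ {j i i′} → Later j i → Later j i′ → cv j i ≡ cv j i′ → i ≡ i′
    cv-real : ∀ {j i} → Later j i → 1 ≤ deg (E j) (cv j i)
    cv-skip : ∀ {j i} → Later j i → skip j i ≡ true → cv j i ∈ W j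
    cv-noskip : ∀ {j i} → Later j i → skip j i ≡ false → ¬ (cv j i ∈ W j)
    cv-X : ∀ {j i} → Later j i → ∀ b p → X j b p ≢ cv j i
    cv-nbrs : ∀ {j i} → Later j i → skip j i ≡ false → ∀ v → E j (cv j i) v ≡ true →
      v ≡ nx j i ⊎ (∃ λ e → Later j e × isP j ≡ true × rk i ≡ rk e + R j × v ≡ cv j e)
    nx-up : ∀ {j i i′} → Later j i → isS i′ ≡ true → isP j ≡ true → rk i′ ≡ rk i + R j → nx j i ≡ cv j i′ × skip j i′ ≡ false
    nx-W : ∀ {j i} → Later j i → (∀ i′ → isS i′ ≡ true → isP j ≡ true → rk i′ ≢ rk i + R j) → nx j i ∈ W j
    skip-P : ∀ {j i} → skip j i ≡ true → isP j ≡ true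
    dmi-≺ : ∀ {j i} → Later j i → skip j i ≡ true → dmi j i ≺ j
    dmi-S : ∀ {j i} → Later j i → skip j i ≡ true → isS (dmi j i) ≡ false
    dmi-inj : ∀ {j i i′} → Later j i → Later j i′ → skip j i ≡ true → skip j i′ ≡ true → dmi j i ≡ dmi j i′ → i ≡ i′

module Plan {n k M d₂ : ℕ} (K : Kits n k M d₂) where
  open Kits K

  Slot : Set
  Slot = Fin k × Fin n

  _≟ˢ_ : (s s′ : Slot) → Dec (s ≡ s′)
  _≟ˢ_ = ≡-dec Fin._≟_ Fin._≟_

  ctr : Fin k → Slot
  ctr i = i , c i

  -- On the path of `j`, the vertex meant for the centre of `i′` comes directly after the one meant
  -- for the centre of `i`.
  Up : Fin k → Fin k → Fin k → Set
  Up j i i′ = isS i′ ≡ true × isP j ≡ true × rk i′ ≡ rk i + R j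

  Flip : Fin k → Fin k → Fin k → Set
  Flip i e j = isS j ≡ false × j ≺ e × skip j e ≡ true × rk i ≡ rk e + R j

  -- AvR i e s: the star-like tree i avoids the slot s on account of the earlier tree e.  The case av-flip occurs when
  -- the path of j skips the centre of e: tree i then avoids the path vertex of j used instead, and e avoids the centre of i.
  data AvR (i e : Fin k) : Slot → Set where
    av-up : isS e ≡ false → ∀ i′ → Up e i i′ → AvR i e (ctr i′)
    av-nx : isS e ≡ false → (∀ i′ → ¬ Up e i i′) → AvR i e (e , nx e i)
    av-flip : isS e ≡ true → ∀ j → Flip i e j → AvR i e (j , cv j e)
    av-c : isS e ≡ true → (∀ j → ¬ Flip i e j) → AvR i e (ctr e)

  av-total : ∀ i e → Σ Slot (AvR i e)
  av-total i e with decBool (isS e)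
  ... | inj₂ h with any? (λ i′ → (isS i′ Bool.≟ true) ×-dec ((isP e Bool.≟ true) ×-dec (rk i′ ≟ rk i + R e)))
  ...   | yes (i′ , u) = _ , av-up h i′ u
  ...   | no none = _ , av-nx h λ i′ u → none (i′ , u)
  av-total i e | inj₁ h with any? (λ j → (isS j Bool.≟ false) ×-dec ((toℕ j <? toℕ e) ×-dec ((skip j e Bool.≟ true) ×-dec (rk i ≟ rk e + R j))))
  ...   | yes (j , f) = _ , av-flip h j f
  ...   | no none = _ , av-c h λ j f → none (j , f)

  opaque
    Av : Fin k → Fin k → Slot
    Av i e = proj₁ (av-total i e)

    av : ∀ i e → AvR i e (Av i e)
    av i e = proj₂ (av-total i e)

  Avoids : Fin k → Slot → Set
  Avoids i s = ∃ λ e → e ≺ i × Av i e ≡ s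

  S≠ : ∀ {j} → isS j ≡ true → isS j ≡ false → ⊥
  S≠ = true≢false

  ≺-R : ∀ {i e j} → isS i ≡ true → isS e ≡ true → rk i ≡ rk e + R j → e ≺ i
  ≺-R {i} {e} {j} hi he eq = rk-≺ he hi (≤-trans (≤-trans (≤-reflexive (+-comm 1 (rk e))) (+-monoʳ-≤ (rk e) (R≥1 j))) (≤-reflexive (sym eq)))

  av-nx-slot : ∀ {j i} → Later j i → (∀ i′ → ¬ Up j i i′) → Avoids i (j , nx j i)
  av-nx-slot {j} {i} (nS , _ , lt) none = j , lt , lem (av i j)
    where
    lem : ∀ {s} → AvR i j s → s ≡ (j , nx j i)
    lem (av-up _ i′ u) = ⊥-elim (none i′ u)
    lem (av-nx _ _) = refl
    lem (av-flip h _ _) = ⊥-elim (S≠ h nS)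
    lem (av-c h _) = ⊥-elim (S≠ h nS)

  av-up-slot : ∀ {j i i′} → Later j i → Up j i i′ → Avoids i (ctr i′)
  av-up-slot {j} {i} {i′} (nS , _ , lt) (S′ , P , eq) = j , lt , lem (av i j)
    where
    lem : ∀ {s} → AvR i j s → s ≡ ctr i′
    lem (av-up _ i″ (S″ , _ , eq″)) = cong ctr (rk-inj S″ S′ (trans eq″ (sym eq)))
    lem (av-nx _ none) = ⊥-elim (none i′ (S′ , P , eq))
    lem (av-flip h _ _) = ⊥-elim (S≠ h nS)
    lem (av-c h _) = ⊥-elim (S≠ h nS)

  -- The rank difference of two centres singles out the only path-like tree that may join them.
  same-R : ∀ {i e j j′} → isP j ≡ true → isP j′ ≡ true → rk i ≡ rk e + R j → rk i ≡ rk e + R j′ → j ≡ j′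
  same-R {i} {e} p p′ eq eq′ = R-inj p p′ (+-cancelˡ-≡ (rk e) _ _ (trans (sym eq) eq′))

  av-flip-slot : ∀ {j i e} → Later j e → isS i ≡ true → skip j e ≡ true → rk i ≡ rk e + R j → Avoids i (j , cv j e)
  av-flip-slot {j} {i} {e} (nS , Se , lt) Si sk eq = e , ≺-R {j = j} Si Se eq , lem (av i e)
    where
    lem : ∀ {s} → AvR i e s → s ≡ (j , cv j e)
    lem (av-up h _ _) = ⊥-elim (S≠ Se h)
    lem (av-nx h _) = ⊥-elim (S≠ Se h)
    lem (av-flip _ j′ (_ , _ , sk′ , eq′)) with same-R {i} {e} (skip-P sk′) (skip-P sk) eq′ eq
    ... | refl = refl
    lem (av-c _ none) = ⊥-elim (none j (nS , lt , sk , eq))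

  av-c-slot : ∀ {j i e} → Later j e → isS i ≡ true → isP j ≡ true → skip j e ≡ false → rk i ≡ rk e + R j → Avoids i (ctr e)
  av-c-slot {j} {i} {e} (nS , Se , lt) Si P sk eq = e , ≺-R {j = j} Si Se eq , lem (av i e)
    where
    lem : ∀ {s} → AvR i e s → s ≡ ctr e
    lem (av-up h _ _) = ⊥-elim (S≠ Se h)
    lem (av-nx h _) = ⊥-elim (S≠ Se h)
    lem (av-flip _ j′ (_ , _ , sk′ , eq′)) with same-R {i} {e} (skip-P sk′) P eq′ eq
    ... | refl = ⊥-elim (true≢false sk′ sk)
    lem (av-c _ _) = refl

  -- The dummy `e` of tree `i` normally lies on the centre of `e`. If a skipped path vertex of some
  -- `j` has claimed it, then tree `e` has its dummy `j` on the centre of `i`, since `Up j e i`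
  -- holds.
  av-S-S : ∀ {e i} → isS e ≡ true → isS i ≡ true → e ≺ i → Avoids i (ctr e) ⊎ Avoids e (ctr i)
  av-S-S {e} {i} Se Si lt = lem (av i e) refl
    where
    lem : ∀ {s} → AvR i e s → Av i e ≡ s → Avoids i (ctr e) ⊎ Avoids e (ctr i)
    lem (av-up h _ _) _ = ⊥-elim (S≠ Se h)
    lem (av-nx h _) _ = ⊥-elim (S≠ Se h)
    lem (av-flip _ j (nS , lt′ , sk , eq)) _ = inj₂ (av-up-slot (nS , Se , lt′) (Si , skip-P sk , eq))
    lem (av-c _ _) eq = inj₁ (e , lt , eq)

  data Kind : Set where
    own : Fin n → Kind
    cov : Bool → Fin M → Kind
    spec : Fin k → Kind
    dum : Fin k → Kind

  interp : Fin k → Kind → Fin n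
  interp j (own v) = v
  interp j (cov b p) = X j b p
  interp j (spec i) = cv j i
  interp j (dum e) = dm j e

  -- For j ≺ i, tree j covers a slot of tree i by its family of the colour of that slot, and tree i covers a slot of tree j
  -- by its family of the opposite colour, so no edge between slots of i and slots of j is used twice.
  colour : Fin k → Fin k → Fin n → Bool
  colour j i v with toℕ j <? toℕ i
  ... | yes _ = col i v
  ... | no _ = not (col i v)

  module Slots (L : List Slot) (pos : Slot → Fin M)
    (L-sound : ∀ {j v} → (j , v) ∈ L → v ∈ W j ⊎ (∃ λ b → ∃ λ p → E j (X j b p) v ≡ true))
    (L-W : ∀ {j v} → v ∈ W j → (j , v) ∈ L)
    (pos-inj : ∀ {s s′} → s ∈ L → s′ ∈ L → pos s ≡ pos s′ → s ≡ s′)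
    (L-nbr : ∀ {i w} → w ∈ W i → ∀ j b v → E j (X j b (pos (i , w))) v ≡ true → (j , v) ∈ L) where

    data KR (j : Fin k) : Slot → Kind → Set where
      k-own : ∀ {v} → KR j (j , v) (own v)
      k-Sdum : ∀ {i v e} → i ≢ j → isS j ≡ true → e ≺ j → Av j e ≡ (i , v) → KR j (i , v) (dum e)
      -- One family is enough for a star-like tree: all its covering vertices hang on the centre, so
      -- its edges to foreign slots leave from that one slot.
      k-Scov : ∀ {i v} → i ≢ j → isS j ≡ true → ¬ Avoids j (i , v) → KR j (i , v) (cov true (pos (i , v)))
      k-spec : ∀ {i} → Later j i → skip j i ≡ false → KR j (ctr i) (spec i)
      k-skip : ∀ {i} → Later j i → skip j i ≡ true → KR j (ctr i) (dum (dmi j i))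
      -- The later tree `j` has a dummy indexed by the earlier `i`, so it uses no edge at all at
      -- this centre.
      k-cdum : ∀ {i} → isS j ≡ false → isS i ≡ true → i ≺ j → KR j (ctr i) (dum i)
      k-cov : ∀ {i v} → i ≢ j → isS j ≡ false → ¬ (isS i ≡ true × v ≡ c i) → KR j (i , v) (cov (colour j i v) (pos (i , v)))

    kind-total : ∀ j s → Σ Kind (KR j s)
    kind-total j (i , v) with i Fin.≟ j
    ... | yes refl = _ , k-own
    ... | no i≢j with decBool (isS j)
    ...   | inj₁ Sj with any? (λ e → (toℕ e <? toℕ j) ×-dec (Av j e ≟ˢ (i , v)))
    ...     | yes (e , lt , eq) = _ , k-Sdum i≢j Sj lt eq
    ...     | no none = _ , k-Scov i≢j Sj none
    kind-total j (i , v) | no i≢j | inj₂ nS with (isS i Bool.≟ true) ×-dec (v Fin.≟ c i)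
    ...   | no none = _ , k-cov i≢j nS none
    ...   | yes (Si , refl) with <-cmp (toℕ j) (toℕ i)
    ...     | tri≈ _ e _ = ⊥-elim (i≢j (sym (Fin.toℕ-injective e)))
    ...     | tri> _ _ gt = _ , k-cdum nS Si gt
    ...     | tri< lt _ _ with decBool (skip j i)
    ...       | inj₁ sk = _ , k-skip (nS , Si , lt) sk
    ...       | inj₂ ns = _ , k-spec (nS , Si , lt) ns

    opaque
      kind : Fin k → Slot → Kind
      kind j s = proj₁ (kind-total j s)

      kr : ∀ j s → KR j s (kind j s)
      kr j s = proj₂ (kind-total j s)

    τ : Fin k → Slot → Fin n
    τ j s = interp j (kind j s)

    Good : Fin k → Kind → Set
    Good j (own v) = v ∈ W j ⊎ (∃ λ b → ∃ λ p → E j (X j b p) v ≡ true)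
    Good j (cov b p) = ⊤
    Good j (spec i) = Later j i × skip j i ≡ false
    Good j (dum e) = e ≺ j

    good : ∀ {j s κ} → s ∈ L → KR j s κ → Good j κ
    good s∈ k-own = L-sound s∈
    good s∈ (k-Sdum _ _ lt _) = lt
    good s∈ (k-Scov _ _ _) = tt
    good s∈ (k-spec l sk) = l , sk
    good s∈ (k-skip l sk) = dmi-≺ l sk
    good s∈ (k-cdum _ _ lt) = lt
    good s∈ (k-cov _ _ _) = tt

    real-nbr : ∀ {j v} → 1 ≤ deg (E j) v → ∃ λ u → E j v u ≡ true
    real-nbr {j} {v} h = let (f , _ , pf) = pick 1 (E j v) h in f zero , pf zero

    own-real : ∀ {j v} → Good j (own v) → 1 ≤ deg (E j) v
    own-real (inj₁ w) = W-real w
    own-real {j} (inj₂ (b , p , e)) = nbr⇒deg (E j) (trans (symE j _ _) e)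

    not-dum : ∀ {j e v} → e ≺ j → 1 ≤ deg (E j) v → v ≢ dm j e
    not-dum {j} {e} lt r refl = let (u , h) = real-nbr r in dm-iso lt u h

    own-cov : ∀ {j v b p} → Good j (own v) → v ≢ X j b p
    own-cov (inj₁ w) refl = X∉W _ _ _ w
    own-cov {j} (inj₂ (b , p , e)) refl = X-ind j _ _ _ _ e

    up? : ∀ j i → (∃ λ i′ → Up j i i′) ⊎ (∀ i′ → ¬ Up j i i′)
    up? j i with any? (λ i′ → (isS i′ Bool.≟ true) ×-dec ((isP j Bool.≟ true) ×-dec (rk i′ ≟ rk i + R j)))
    ... | yes u = inj₁ u
    ... | no none = inj₂ λ i′ u → none (i′ , u)

    later-up : ∀ {j i i′} → Later j i → Up j i i′ → Later j i′
    later-up {j} (nS , Si , lt) (S′ , P , eq) = nS , S′ , <-trans lt (≺-R {j = j} S′ Si eq)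

    data Nbr (j i : Fin k) : Fin n → Set where
      nb-up : ∀ {i′} → Later j i′ → Up j i i′ → skip j i′ ≡ false → Nbr j i (cv j i′)
      nb-nx : (∀ i′ → ¬ Up j i i′) → nx j i ∈ W j → Nbr j i (nx j i)
      nb-down : ∀ {e} → Later j e → isP j ≡ true → rk i ≡ rk e + R j → Nbr j i (cv j e)

    nbr : ∀ {j i v} → Later j i → skip j i ≡ false → E j (cv j i) v ≡ true → Nbr j i v
    nbr {j} {i} {v} l sk h with cv-nbrs l sk v h
    ... | inj₂ (e , le , P , eq , refl) = nb-down le P eq
    ... | inj₁ refl with up? j i
    ...   | inj₁ (i′ , u@(S′ , P , eq)) = subst (Nbr j i) (sym (proj₁ (nx-up l S′ P eq))) (nb-up (later-up l u) u (proj₂ (nx-up l S′ P eq)))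
    ...   | inj₂ none = nb-nx none (nx-W l λ i′ S′ P eq → none i′ (S′ , P , eq))

    spec-cov : ∀ {j i b p} → Later j i → skip j i ≡ false → E j (cv j i) (X j b p) ≡ true → ⊥
    spec-cov {j} {i} {b} {p} l sk h = go refl (nbr l sk h)
      where
      go : ∀ {v} → v ≡ X j b p → Nbr j i v → ⊥
      go e (nb-up l′ _ _) = cv-X l′ b p (sym e)
      go e (nb-nx _ w) = X∉W j b p (subst (_∈ W j) e w)
      go e (nb-down l′ _ _) = cv-X l′ b p (sym e)

    own-spec : ∀ {j i v} → Good j (own v) → Later j i → skip j i ≡ false → v ≢ cv j i
    own-spec (inj₁ w) l sk refl = cv-noskip l sk w
    own-spec {j} (inj₂ (b , p , e)) l sk refl = spec-cov l sk (trans (symE j _ _) e)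

    interp-inj : ∀ {j} κ κ′ → Good j κ → Good j κ′ → interp j κ ≡ interp j κ′ → κ ≡ κ′
    interp-inj (own v) (own v′) g g′ e = cong own e
    interp-inj (own v) (cov b p) g g′ e = ⊥-elim (own-cov g e)
    interp-inj (own v) (spec i) g (l , sk) e = ⊥-elim (own-spec g l sk e)
    interp-inj (own v) (dum x) g g′ e = ⊥-elim (not-dum g′ (own-real g) e)
    interp-inj (cov b p) (own v) g g′ e = ⊥-elim (own-cov g′ (sym e))
    interp-inj (cov b p) (cov b′ p′) g g′ e = let (q , r) = X-inj e in cong₂ cov q r
    interp-inj (cov b p) (spec i) g (l , _) e = ⊥-elim (cv-X l b p e)
    interp-inj {j} (cov b p) (dum x) g g′ e = ⊥-elim (not-dum g′ (X-real j b p) e)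
    interp-inj (spec i) (own v) (l , sk) g′ e = ⊥-elim (own-spec g′ l sk (sym e))
    interp-inj (spec i) (cov b p) (l , _) g′ e = ⊥-elim (cv-X l b p (sym e))
    interp-inj (spec i) (spec i′) (l , _) (l′ , _) e = cong spec (cv-inj l l′ e)
    interp-inj (spec i) (dum x) (l , _) g′ e = ⊥-elim (not-dum g′ (cv-real l) e)
    interp-inj (dum x) (own v) g g′ e = ⊥-elim (not-dum g (own-real g′) (sym e))
    interp-inj {j} (dum x) (cov b p) g g′ e = ⊥-elim (not-dum g (X-real j b p) (sym e))
    interp-inj (dum x) (spec i) g (l , _) e = ⊥-elim (not-dum g (cv-real l) (sym e))
    interp-inj (dum x) (dum y) g g′ e = cong dum (dm-inj g g′ e)

    kind-inj : ∀ {j s s′ κ κ′} → s ∈ L → s′ ∈ L → KR j s κ → KR j s′ κ′ → κ ≡ κ′ → s ≡ s′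
    kind-inj m m′ k-own k-own refl = refl
    kind-inj m m′ (k-Sdum _ _ _ e) (k-Sdum _ _ _ e′) refl = trans (sym e) e′
    kind-inj m m′ (k-Sdum _ S _ _) (k-skip (nS , _) _) _ = ⊥-elim (S≠ S nS)
    kind-inj m m′ (k-Sdum _ S _ _) (k-cdum nS _ _) _ = ⊥-elim (S≠ S nS)
    kind-inj m m′ (k-skip (nS , _) _) (k-Sdum _ S _ _) _ = ⊥-elim (S≠ S nS)
    kind-inj {j} m m′ (k-skip {i} l sk) (k-skip {i′} l′ sk′) e = cong ctr (dmi-inj l l′ sk sk′ (dum-inj e))
      where
      dum-inj : ∀ {x y} → dum x ≡ dum y → x ≡ y
      dum-inj refl = refl
    kind-inj m m′ (k-skip l sk) (k-cdum _ Si _) refl = ⊥-elim (S≠ Si (dmi-S l sk))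
    kind-inj m m′ (k-cdum nS _ _) (k-Sdum _ S _ _) _ = ⊥-elim (S≠ S nS)
    kind-inj m m′ (k-cdum _ Si _) (k-skip l sk) refl = ⊥-elim (S≠ Si (dmi-S l sk))
    kind-inj m m′ (k-cdum _ _ _) (k-cdum _ _ _) refl = refl
    kind-inj m m′ (k-spec _ _) (k-spec _ _) refl = refl
    kind-inj m m′ (k-Scov _ _ _) (k-Scov _ _ _) e = pos-inj m m′ (cov-inj e)
      where
      cov-inj : ∀ {b b′ p p′} → cov b p ≡ cov b′ p′ → p ≡ p′
      cov-inj refl = refl
    kind-inj m m′ (k-Scov _ S _) (k-cov _ nS _) _ = ⊥-elim (S≠ S nS)
    kind-inj m m′ (k-cov _ nS _) (k-Scov _ S _) _ = ⊥-elim (S≠ S nS)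
    kind-inj m m′ (k-cov _ _ _) (k-cov _ _ _) e = pos-inj m m′ (cov-inj e)
      where
      cov-inj : ∀ {b b′ p p′} → cov b p ≡ cov b′ p′ → p ≡ p′
      cov-inj refl = refl

    τ-inj : ∀ j {s s′} → s ∈ L → s′ ∈ L → τ j s ≡ τ j s′ → s ≡ s′
    τ-inj j {s} {s′} m m′ e = kind-inj m m′ (kr j s) (kr j s′) (interp-inj _ _ (good m (kr j s)) (good m′ (kr j s′)) e)

    -- The edges that tree `j` may use between slots, directed away from a slot of `j` or, in `C-C`,
    -- from lower to higher rank. The arguments record the dummies and colours by which `clash` and
    -- `clash′` tell two trees apart.
    data Edge (j : Fin k) : Slot → Slot → Set where
      both : ∀ {v v′} → Edge j (j , v) (j , v′)
      S-out : ∀ {i v} → isS j ≡ true → i ≢ j → ¬ Avoids j (i , v) → Edge j (ctr j) (i , v)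
      X-out : ∀ {v i v′} → isS j ≡ false → i ≢ j → ¬ (isS i ≡ true × v′ ≡ c i) → col j v ≡ colour j i v′ → Edge j (j , v) (i , v′)
      C-out : ∀ {v i} → Later j i → Avoids i (j , v) → Edge j (j , v) (ctr i)
      C-C : ∀ {i i′} → isS j ≡ false → Up j i i′ → isS i ≡ true → Avoids i (ctr i′) → Avoids i′ (ctr i) → Edge j (ctr i) (ctr i′)

    own-spec-edge : ∀ {j i v} → (j , v) ∈ L → Later j i → skip j i ≡ false → E j (cv j i) v ≡ true → Edge j (j , v) (ctr i)
    own-spec-edge {j} {i} m l sk h = go m (nbr l sk h)
      where
      go : ∀ {v} → (j , v) ∈ L → Nbr j i v → Edge j (j , v) (ctr i)
      go m (nb-up l′ _ sk′) = ⊥-elim (own-spec (L-sound m) l′ sk′ refl)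
      go m (nb-nx none _) = C-out l (av-nx-slot l none)
      go m (nb-down {e} l′ P eq) with decBool (skip j e)
      ... | inj₁ sk′ = C-out l (av-flip-slot l′ (proj₁ (proj₂ l)) sk′ eq)
      ... | inj₂ sk′ = ⊥-elim (own-spec (L-sound m) l′ sk′ refl)

    C-C′ : ∀ {j i i′} → Later j i → Later j i′ → skip j i ≡ false → Up j i i′ → Edge j (ctr i) (ctr i′)
    C-C′ l@(nS , Si , _) (_ , S′ , _) sk u@(_ , P , eq) = C-C nS u Si (av-up-slot l u) (av-c-slot l S′ P sk eq)

    spec-spec-edge : ∀ {j i i′} → Later j i → Later j i′ → skip j i ≡ false → skip j i′ ≡ false → E j (cv j i) (cv j i′) ≡ true →
      Edge j (ctr i) (ctr i′) ⊎ Edge j (ctr i′) (ctr i)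
    spec-spec-edge {j} {i} {i′} l l′ sk sk′ h = go refl (nbr l sk h)
      where
      go : ∀ {v} → v ≡ cv j i′ → Nbr j i v → Edge j (ctr i) (ctr i′) ⊎ Edge j (ctr i′) (ctr i)
      go e (nb-up l″ u _) with cv-inj l″ l′ e
      ... | refl = inj₁ (C-C′ l l′ sk u)
      go e (nb-nx _ w) = ⊥-elim (cv-noskip l′ sk′ (subst (_∈ W j) e w))
      go e (nb-down l″ P eq) with cv-inj l″ l′ e
      ... | refl = inj₂ (C-C′ l′ l sk′ (proj₁ (proj₂ l) , P , eq))

    Edges : Fin k → Slot → Slot → Set
    Edges j s s′ = Edge j s s′ ⊎ Edge j s′ s

    own-cov-edge : ∀ {j v s κ} → KR j s κ → ∀ {b p} → κ ≡ cov b p → E j v (X j b p) ≡ true → Edge j (j , v) s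
    own-cov-edge {j} {v} (k-Scov i≢j Sj na) refl h with c-only Sj _ _ v (trans (symE j _ _) h)
    ... | refl = S-out Sj i≢j na
    own-cov-edge {j} {v} (k-cov i≢j nS nc) refl h = X-out nS i≢j nc (col-X nS _ _ v (trans (symE j _ _) h))

    kind-own : ∀ {j s v} → KR j s (own v) → s ≡ (j , v)
    kind-own k-own = refl

    kind-spec : ∀ {j s i} → KR j s (spec i) → s ≡ ctr i × Later j i × skip j i ≡ false
    kind-spec (k-spec l sk) = refl , l , sk

    edge′ : ∀ {j s s′ κ κ′} → s ∈ L → s′ ∈ L → KR j s κ → KR j s′ κ′ → E j (interp j κ) (interp j κ′) ≡ true → Edges j s s′
    edge′ {κ = dum e} m m′ r r′ h = ⊥-elim (dm-iso (good m r) _ h)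
    edge′ {j} {κ = own _} {dum e} m m′ r r′ h = ⊥-elim (dm-iso (good m′ r′) _ (trans (symE j _ _) h))
    edge′ {j} {κ = cov _ _} {dum e} m m′ r r′ h = ⊥-elim (dm-iso (good m′ r′) _ (trans (symE j _ _) h))
    edge′ {j} {κ = spec _} {dum e} m m′ r r′ h = ⊥-elim (dm-iso (good m′ r′) _ (trans (symE j _ _) h))
    edge′ {κ = own v} {own v′} m m′ r r′ h rewrite kind-own r | kind-own r′ = inj₁ both
    edge′ {κ = own v} {cov b p} m m′ r r′ h rewrite kind-own r = inj₁ (own-cov-edge r′ refl h)
    edge′ {j} {κ = cov b p} {own v} m m′ r r′ h rewrite kind-own r′ = inj₂ (own-cov-edge r refl (trans (symE j _ _) h))
    edge′ {j} {κ = own v} {spec i} m m′ r r′ h with kind-own r | kind-spec r′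
    ... | refl | refl , l , sk = inj₁ (own-spec-edge m l sk (trans (symE j _ _) h))
    edge′ {j} {κ = spec i} {own v} m m′ r r′ h with kind-own r′ | kind-spec r
    ... | refl | refl , l , sk = inj₂ (own-spec-edge m′ l sk h)
    edge′ {j} {κ = cov b p} {cov b′ p′} m m′ r r′ h = ⊥-elim (X-ind j b p b′ p′ h)
    edge′ {j} {κ = cov b p} {spec i} m m′ r r′ h = let (_ , l , sk) = kind-spec r′ in ⊥-elim (spec-cov l sk (trans (symE j _ _) h))
    edge′ {j} {κ = spec i} {cov b p} m m′ r r′ h = let (_ , l , sk) = kind-spec r in ⊥-elim (spec-cov l sk h)
    edge′ {j} {κ = spec i} {spec i′} m m′ r r′ h with kind-spec r | kind-spec r′
    ... | refl , l , sk | refl , l′ , sk′ = spec-spec-edge l l′ sk sk′ h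

    edge : ∀ j {s s′} → s ∈ L → s′ ∈ L → E j (τ j s) (τ j s′) ≡ true → Edges j s s′
    edge j {s} {s′} m m′ h = edge′ m m′ (kr j s) (kr j s′) h

    R-irr : ∀ {i j} → rk i ≢ rk i + R j
    R-irr {i} {j} e = <-irrefl e (≤-trans (≤-reflexive (+-comm 1 (rk i))) (+-monoʳ-≤ (rk i) (R≥1 j)))

    colour-< : ∀ {j i v} → j ≺ i → colour j i v ≡ col i v
    colour-< {j} {i} lt with toℕ j <? toℕ i
    ... | yes _ = refl
    ... | no ¬lt = ⊥-elim (¬lt lt)

    colour-> : ∀ {j i v} → i ≺ j → colour j i v ≡ not (col i v)
    colour-> {j} {i} gt with toℕ j <? toℕ i
    ... | yes lt = ⊥-elim (<-asym lt gt)
    ... | no _ = refl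

    not-≡ : ∀ {b : Bool} → b ≢ not b
    not-≡ {true} ()
    not-≡ {false} ()

    clash : ∀ {j j′ s s′} → j ≢ j′ → Edge j s s′ → Edge j′ s s′ → ⊥
    clash ne both both = ne refl
    clash ne both (S-out _ _ _) = ne refl
    clash ne both (X-out _ _ _ _) = ne refl
    clash ne both (C-out _ _) = ne refl
    clash ne both (C-C {i} nS (_ , _ , eq) _ _ _) = R-irr {i} eq
    clash ne (S-out _ _ _) both = ne refl
    clash ne (S-out _ _ _) (S-out _ _ _) = ne refl
    clash ne (S-out _ _ _) (X-out _ _ _ _) = ne refl
    clash ne (S-out _ _ _) (C-out _ _) = ne refl
    clash ne (S-out _ _ na) (C-C _ _ _ a _) = na a
    clash ne (X-out _ _ _ _) both = ne refl
    clash ne (X-out _ _ _ _) (S-out _ _ _) = ne refl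
    clash ne (X-out _ _ _ _) (X-out _ _ _ _) = ne refl
    clash ne (X-out _ _ _ _) (C-out _ _) = ne refl
    clash ne (X-out nS _ _ _) (C-C _ _ S _ _) = S≠ S nS
    clash ne (C-out _ _) both = ne refl
    clash ne (C-out _ _) (S-out _ _ _) = ne refl
    clash ne (C-out _ _) (X-out _ _ _ _) = ne refl
    clash ne (C-out _ _) (C-out _ _) = ne refl
    clash ne (C-out (nS , _) _) (C-C _ _ S _ _) = S≠ S nS
    clash ne (C-C {i} nS (_ , _ , eq) _ _ _) both = R-irr {i} eq
    clash ne (C-C _ _ _ a _) (S-out _ _ na) = na a
    clash ne (C-C _ _ S _ _) (X-out nS _ _ _) = S≠ S nS
    clash ne (C-C _ _ S _ _) (C-out (nS , _) _) = S≠ S nS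
    clash ne (C-C {i} _ (_ , P , eq) _ _ _) (C-C _ (_ , P′ , eq′) _ _ _) = ne (same-R {e = i} P P′ eq eq′)

    -- The critical comparison is crosswise, each tree covering a slot of the other. Two star-like
    -- trees are separated by `av-S-S`, two trees covering by their families by opposite colours,
    -- and the edges of a centre from those of a special cover by the slots that the centre avoids.
    clash′ : ∀ {j j′ s s′} → j ≢ j′ → Edge j s s′ → Edge j′ s′ s → ⊥
    clash′ ne both both = ne refl
    clash′ ne both (S-out _ _ _) = ne refl
    clash′ ne both (X-out _ _ _ _) = ne refl
    clash′ ne both (C-out _ _) = ne refl
    clash′ ne both (C-C {i} nS (_ , _ , eq) _ _ _) = R-irr {i} eq
    clash′ ne (S-out _ i≢ _) both = i≢ refl
    clash′ {j} {j′} ne (S-out Sj _ na) (S-out Sj′ _ na′) with <-cmp (toℕ j) (toℕ j′)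
    ... | tri< lt _ _ = [ na′ , na ]′ (av-S-S Sj Sj′ lt)
    ... | tri≈ _ e _ = ne (Fin.toℕ-injective e)
    ... | tri> _ _ gt = [ na , na′ ]′ (av-S-S Sj′ Sj gt)
    clash′ ne (S-out Sj _ _) (X-out _ _ nc _) = nc (Sj , refl)
    clash′ ne (S-out _ _ na) (C-out _ a) = na a
    clash′ ne (S-out _ _ na) (C-C _ _ _ _ a) = na a
    clash′ ne (X-out _ i≢ _ _) both = i≢ refl
    clash′ ne (X-out _ _ nc _) (S-out Sj _ _) = nc (Sj , refl)
    clash′ {j} {j′} ne (X-out {v} {i} {v′} _ _ _ e) (X-out _ _ _ e′) with <-cmp (toℕ j) (toℕ j′)
    ... | tri< lt _ _ = not-≡ (trans e (trans (colour-< {j} {j′} {v′} lt) (trans e′ (colour-> {j′} {j} {v} lt))))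
    ... | tri≈ _ q _ = ne (Fin.toℕ-injective q)
    ... | tri> _ _ gt = not-≡ (trans e′ (trans (colour-< {j′} {j} {v} gt) (trans e (colour-> {j} {j′} {v′} gt))))
    clash′ ne (X-out nS _ _ _) (C-out (_ , S , _) _) = S≠ S nS
    clash′ ne (X-out nS _ _ _) (C-C _ (S , _) _ _ _) = S≠ S nS
    clash′ ne (C-out (nS , S , _) _) both = S≠ S nS
    clash′ ne (C-out _ a) (S-out _ _ na) = na a
    clash′ ne (C-out (_ , S , _) _) (X-out nS _ _ _) = S≠ S nS
    clash′ ne (C-out (nS , _) _) (C-out (_ , S , _) _) = S≠ S nS
    clash′ ne (C-out (nS , _) _) (C-C _ (S , _) _ _ _) = S≠ S nS
    clash′ ne (C-C {i} nS (_ , _ , eq) _ _ _) both = R-irr {i} eq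
    clash′ ne (C-C _ _ _ _ a) (S-out _ _ na) = na a
    clash′ ne (C-C _ (S , _) _ _ _) (X-out nS _ _ _) = S≠ S nS
    clash′ ne (C-C _ (S , _) _ _ _) (C-out (nS , _) _) = S≠ S nS
    clash′ {j} {j′} ne (C-C {i} {i′} _ (S′ , _ , eq) S _ _) (C-C _ (_ , _ , eq′) _ _ _) = <-asym (≺-R {j = j} S′ S eq) (≺-R {j = j′} S S′ eq′)

    disjoint : ∀ {j j′} → j ≢ j′ → ∀ {s s′} → s ∈ L → s′ ∈ L → E j (τ j s) (τ j s′) ≡ true → E j′ (τ j′ s) (τ j′ s′) ≡ true → ⊥
    disjoint {j} {j′} ne m m′ h h′ with edge j m m′ h | edge j′ m m′ h′
    ... | inj₁ e | inj₁ e′ = clash ne e e′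
    ... | inj₁ e | inj₂ e′ = clash′ ne e e′
    ... | inj₂ e | inj₁ e′ = clash′ ne e e′
    ... | inj₂ e | inj₂ e′ = clash ne e e′

    τ-own : ∀ j v → τ j (j , v) ≡ v
    τ-own j v = go (kr j (j , v))
      where
      go : ∀ {κ} → KR j (j , v) κ → interp j κ ≡ v
      go k-own = refl
      go (k-Sdum ne _ _ _) = ⊥-elim (ne refl)
      go (k-Scov ne _ _) = ⊥-elim (ne refl)
      go (k-spec (nS , S , _) _) = ⊥-elim (S≠ S nS)
      go (k-skip (nS , S , _) _) = ⊥-elim (S≠ S nS)
      go (k-cdum nS S _) = ⊥-elim (S≠ S nS)
      go (k-cov ne _ _) = ⊥-elim (ne refl)

    τ-spec : ∀ j i → Later j i → skip j i ≡ false → τ j (ctr i) ≡ cv j i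
    τ-spec j i l@(nS , Si , lt) sk = go (kr j (ctr i)) refl
      where
      go : ∀ {s κ} → KR j s κ → s ≡ ctr i → interp j κ ≡ cv j i
      go k-own refl = ⊥-elim (<-irrefl refl lt)
      go (k-Sdum _ S _ _) refl = ⊥-elim (S≠ S nS)
      go (k-Scov _ S _) refl = ⊥-elim (S≠ S nS)
      go (k-spec _ _) refl = refl
      go (k-skip _ sk′) refl = ⊥-elim (true≢false sk′ sk)
      go (k-cdum _ _ gt) refl = ⊥-elim (<-asym lt gt)
      go (k-cov _ _ nc) refl = ⊥-elim (nc (Si , refl))

    -- Covering vertices have their neighbours on slots by the choice of `L`. The neighbours of a
    -- special cover sit on other centres or, at chain ends, leaf parents and skipped vertices, on
    -- slots of `j` itself. Dummies have none.
    closed : ∀ {i w} → w ∈ W i → ∀ j → j ≢ i → ∀ v → E j (τ j (i , w)) v ≡ true → ∃ λ s → s ∈ L × τ j s ≡ v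
    closed {i} {w} m j ne v h = go (kr j (i , w)) refl h
      where
      mine : ∀ {v} → (j , v) ∈ L → ∃ λ s → s ∈ L × τ j s ≡ v
      mine {v} q = (j , v) , q , τ-own j v
      nb : ∀ {i v} → Nbr j i v → ∃ λ s → s ∈ L × τ j s ≡ v
      nb (nb-up {i′} l u sk) = ctr i′ , L-W (c∈W (proj₁ (proj₂ l))) , τ-spec j i′ l sk
      nb (nb-nx _ q) = mine (L-W q)
      nb (nb-down {e} l P eq) with decBool (skip j e)
      ... | inj₁ sk = mine (L-W (cv-skip l sk))
      ... | inj₂ sk = ctr e , L-W (c∈W (proj₁ (proj₂ l))) , τ-spec j e l sk
      go : ∀ {s κ} → KR j s κ → s ≡ (i , w) → E j (interp j κ) v ≡ true → ∃ λ s → s ∈ L × τ j s ≡ v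
      go k-own refl _ = ⊥-elim (ne refl)
      go (k-Sdum _ _ lt _) refl h = ⊥-elim (dm-iso lt v h)
      go (k-Scov _ _ _) refl h = mine (L-nbr m j true v h)
      go (k-spec l sk) refl h = nb (nbr l sk h)
      go (k-skip l sk) refl h = ⊥-elim (dm-iso (dmi-≺ l sk) v h)
      go (k-cdum _ _ lt) refl h = ⊥-elim (dm-iso lt v h)
      go (k-cov _ _ _) refl h = mine (L-nbr m j _ v h)

    low : ∀ {i v} → (i , v) ∈ L → ¬ (v ∈ W i) → ∀ j → deg (E j) (τ j (i , v)) ≤ d₂
    low {i} {v} m nw j = go (kr j (i , v)) refl
      where
      dum-deg : ∀ {e} → e ≺ j → deg (E j) (dm j e) ≤ d₂
      dum-deg lt = ≤-trans (≤-reflexive (trans (sum-cong λ b → ⟦⟧-false (¬true⇒false λ h → dm-iso lt b h)) sum-0)) z≤n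
      go : ∀ {s κ} → KR j s κ → s ≡ (i , v) → deg (E j) (interp j κ) ≤ d₂
      go k-own refl with L-sound m
      ... | inj₁ w = ⊥-elim (nw w)
      ... | inj₂ (b , p , h) = [ (λ w → ⊥-elim (nw w)) , id ]′ (X-nbr i b p v h)
      go (k-Sdum _ _ lt _) refl = dum-deg lt
      go (k-Scov _ _ _) refl = X-low j _ _
      go (k-spec (_ , S , _) _) refl = ⊥-elim (nw (c∈W S))
      go (k-skip l sk) refl = dum-deg (dmi-≺ l sk)
      go (k-cdum _ _ lt) refl = dum-deg lt
      go (k-cov _ _ _) refl = X-low j _ _

-- Slots as vertices of the complete graph

members : (Fin n → Bool) → List (Fin n)
members {n} P = filter (λ u → P u Bool.≟ true) (allFin n)

∈-members⁺ : (P : Fin n → Bool) {v : Fin n} → P v ≡ true → v ∈ members P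
∈-members⁺ P {v} h = ∈-filter⁺ (λ u → P u Bool.≟ true) (∈-allFin v) h

∈-members⁻ : (P : Fin n → Bool) {v : Fin n} → v ∈ members P → P v ≡ true
∈-members⁻ {n} P {v} m = proj₂ (∈-filter⁻ (λ u → P u Bool.≟ true) {xs = allFin n} m)

length-members : (P : Fin n → Bool) → length (members P) ≤ count P
length-members {n} P = ≤-trans (≤-reflexive (length-filter-tabulate (λ u → P u Bool.≟ true) id)) (count-mono λ i h → lem i h)
  where
  lem : ∀ i → does (P i Bool.≟ true) ≡ true → P i ≡ true
  lem i h with P i
  ... | true = refl

length-concatMap : {A B : Set} (f : A → List B) (c : ℕ) → (∀ x → length (f x) ≤ c) → ∀ l → length (concatMap f l) ≤ length l * c
length-concatMap f c h [] = z≤n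
length-concatMap f c h (x ∷ l) = ≤-trans (≤-reflexive (List.length-++ (f x))) (+-mono-≤ (h x) (length-concatMap f c h l))

length-allFin : ∀ k → length (allFin k) ≡ k
length-allFin k = List.length-tabulate id

module Index {A : Set} (_≟ᴬ_ : DecidableEquality A) where
  idx : A → List A → ℕ
  idx s [] = 0
  idx s (x ∷ l) with s ≟ᴬ x
  ... | yes _ = 0
  ... | no _ = suc (idx s l)

  idx-< : ∀ {s} l l′ → s ∈ l → idx s (l ++ l′) < length l
  idx-< {s} (x ∷ l) l′ m with s ≟ᴬ x
  ... | yes _ = s≤s z≤n
  ... | no ne with m
  ...   | here e = ⊥-elim (ne e)
  ...   | there m′ = s≤s (idx-< l l′ m′)

  idx-inj : ∀ {s s′} l → s ∈ l → s′ ∈ l → idx s l ≡ idx s′ l → s ≡ s′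
  idx-inj {s} {s′} (x ∷ l) m m′ e with s ≟ᴬ x | s′ ≟ᴬ x
  ... | yes refl | yes refl = refl
  ... | no ne | no ne′ with m | m′
  ...   | here p | _ = ⊥-elim (ne p)
  ...   | there _ | here p = ⊥-elim (ne′ p)
  ...   | there q | there q′ = idx-inj l q q′ (suc-injective e)

-- One transposition of values for each new position; the earlier values keep clear of both
-- exchanged points, by injectivity of the permutation and of `t`.
extend-perm : {A : Set} (l : List A) (h t : A → Fin n) →
  (∀ {s s′} → s ∈ l → s′ ∈ l → h s ≡ h s′ → s ≡ s′) → (∀ {s s′} → s ∈ l → s′ ∈ l → t s ≡ t s′ → s ≡ s′) →
  Σ (Permutation′ n) λ ψ → ∀ {s} → s ∈ l → ψ ⟨$⟩ʳ (h s) ≡ t s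
extend-perm [] h t hi ti = Perm.id , λ ()
extend-perm {n} {A} (x ∷ l) h t hi ti = go (extend-perm l h t (λ m m′ → hi (there m) (there m′)) (λ m m′ → ti (there m) (there m′)))
  where
  go : (Σ (Permutation′ n) λ ψ → ∀ {s} → s ∈ l → ψ ⟨$⟩ʳ (h s) ≡ t s) → Σ (Permutation′ n) λ ψ → ∀ {s} → s ∈ x ∷ l → ψ ⟨$⟩ʳ (h s) ≡ t s
  go (ψ , ok) with Any.any? (λ s → h s Fin.≟ h x) l
  ... | yes a = let (s , m , e) = find a in ψ , λ { (here refl) → trans (cong (ψ ⟨$⟩ʳ_) (sym e)) (trans (ok m) (cong t (hi (there m) (here refl) e))) ; (there q) → ok q }
  ... | no na = ψ ∘ₚ Perm.transpose (ψ ⟨$⟩ʳ h x) (t x) , ok′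
    where
    ok′ : ∀ {s} → s ∈ x ∷ l → (ψ ∘ₚ Perm.transpose (ψ ⟨$⟩ʳ h x) (t x)) ⟨$⟩ʳ (h s) ≡ t s
    ok′ (here refl) = transp-l (ψ ⟨$⟩ʳ h x) (t x)
    ok′ {s} (there m) = trans (transp-o (ψ ⟨$⟩ʳ h x) (t x) (λ e → na (lose m (perm-inj ψ e))) (λ e → na (lose m (cong h (ti (there m) (here refl) (trans (sym (ok m)) e))))))
      (ok m)

module Hosts {n k w₀ : ℕ} {d₁ d₂ : ℕ} where
  -- At most `KW` slots are owned through `W`. The `KY` others receive the neighbours, at most `D₀`
  -- each, of the first `KW` vertices in both families of every tree.
  KW KY M : ℕ
  KW = k * w₀
  KY = k * (2 * (KW * D₀))
  M = KW + KY

  module Pack (K : Kits n k M d₂) (1≤k : 1 ≤ k) (1≤n : 1 ≤ n) (p₀ : Fin M) (M≤n : M ≤ n) (d₂≤d₁ : d₂ ≤ d₁)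
    (W-length : ∀ j → length (Kits.W K j) ≤ w₀) (X-D₀ : ∀ j b p → deg (Kits.E K j) (Kits.X K j b p) ≤ D₀)
    (big∈W : ∀ j v → d₁ < deg (Kits.E K j) v → v ∈ Kits.W K j)
    (sumE : ∀ j → sum (deg (Kits.E K j)) ≤ 2 * n)
    (small-d : (c2160 * k) * (k * d₁) ≤ n) (small-M : 8 * M ≤ n) (small-M′ : (8 * k) * (M * d₂) ≤ n) where
    open Kits K
    open Plan K
    open Index _≟ˢ_

    nbrs : Fin k → Fin n → List Slot
    nbrs j v = map (j ,_) (members (E j v))

    -- Closing up stops after one round. The slots of `W` come first in `L`, so they are covered by
    -- early vertices, and only these must have all neighbours on slots; the other slots merely
    -- carry vertices of degree at most `d₂`.
    early : Fin KW → Fin M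
    early a = a ↑ˡ KY

    nY : Fin k → Bool → Fin KW → List Slot
    nY j b a = nbrs j (X j b (early a))

    bY : Fin k → Bool → List Slot
    bY j b = concatMap (nY j b) (allFin KW)

    fY : Fin k → List Slot
    fY j = concatMap (bY j) (true ∷ false ∷ [])

    LW LY L : List Slot
    LW = concatMap (λ j → map (j ,_) (W j)) (allFin k)
    LY = concatMap fY (allFin k)
    L = LW ++ LY

    LW≤ : length LW ≤ KW
    LW≤ = ≤-trans (length-concatMap _ w₀ (λ j → ≤-trans (≤-reflexive (List.length-map (j ,_) (W j))) (W-length j)) (allFin k)) (≤-reflexive (cong (_* w₀) (length-allFin k)))

    nY≤ : ∀ j b a → length (nY j b a) ≤ D₀
    nY≤ j b a = ≤-trans (≤-reflexive (List.length-map (j ,_) (members (E j (X j b (early a)))))) (≤-trans (length-members (E j (X j b (early a)))) (X-D₀ j b (early a)))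

    bY≤ : ∀ j b → length (bY j b) ≤ KW * D₀
    bY≤ j b = ≤-trans (length-concatMap (nY j b) D₀ (nY≤ j b) (allFin KW)) (≤-reflexive (cong (_* D₀) (length-allFin KW)))

    LY≤ : length LY ≤ KY
    LY≤ = ≤-trans (length-concatMap fY (2 * (KW * D₀)) (λ j → length-concatMap (bY j) (KW * D₀) (bY≤ j) (true ∷ false ∷ [])) (allFin k))
      (≤-reflexive (cong (_* (2 * (KW * D₀))) (length-allFin k)))

    L≤ : length L ≤ M
    L≤ = ≤-trans (≤-reflexive (List.length-++ LW)) (+-mono-≤ LW≤ LY≤)

    pos : Slot → Fin M
    pos s with idx s L <? M
    ... | yes lt = fromℕ< lt
    ... | no _ = p₀

    pos-toℕ : ∀ {s} → s ∈ L → toℕ (pos s) ≡ idx s L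
    pos-toℕ {s} m with idx s L <? M
    ... | yes lt = Fin.toℕ-fromℕ< lt
    ... | no nlt = ⊥-elim (nlt (<-≤-trans (subst (λ l → idx s l < length L) (List.++-identityʳ L) (idx-< L [] m)) L≤))

    pos-inj : ∀ {s s′} → s ∈ L → s′ ∈ L → pos s ≡ pos s′ → s ≡ s′
    pos-inj m m′ e = idx-inj L m m′ (trans (sym (pos-toℕ m)) (trans (cong toℕ e) (pos-toℕ m′)))

    LW⁺ : ∀ {j v} → v ∈ W j → (j , v) ∈ LW
    LW⁺ {j} {v} m = ∈-concatMap⁺ (λ j → map (j ,_) (W j)) (lose (∈-allFin j) (∈-map⁺ (j ,_) m))

    LW⁻ : ∀ {j v} → (j , v) ∈ LW → v ∈ W j
    LW⁻ m with find (∈-concatMap⁻ (λ j → map (j ,_) (W j)) {xs = allFin k} m)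
    ... | (j , _ , q) with ∈-map⁻ (j ,_) q
    ...   | (v , q′ , refl) = q′

    L-W : ∀ {j v} → v ∈ W j → (j , v) ∈ L
    L-W m = ∈-++⁺ˡ (LW⁺ m)

    LY⁻ : ∀ {j v} → (j , v) ∈ LY → ∃ λ b → ∃ λ p → E j (X j b p) v ≡ true
    LY⁻ m with find (∈-concatMap⁻ fY {xs = allFin k} m)
    ... | (j , _ , q) with find (∈-concatMap⁻ (bY j) {xs = true ∷ false ∷ []} q)
    ...   | (b , _ , q′) with find (∈-concatMap⁻ (nY j b) {xs = allFin KW} q′)
    ...     | (a , _ , q″) with ∈-map⁻ (j ,_) q″
    ...       | (v , r , refl) = b , early a , ∈-members⁻ (E j (X j b (early a))) r

    bool∈ : ∀ (b : Bool) → b ∈ true ∷ false ∷ []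
    bool∈ true = here refl
    bool∈ false = there (here refl)

    LY⁺ : ∀ {j v} b a → E j (X j b (early a)) v ≡ true → (j , v) ∈ LY
    LY⁺ {j} {v} b a h = ∈-concatMap⁺ fY (lose (∈-allFin j) (∈-concatMap⁺ (bY j) (lose (bool∈ b) (∈-concatMap⁺ (nY j b) (lose (∈-allFin a) (∈-map⁺ (j ,_) (∈-members⁺ (E j (X j b (early a))) h)))))))

    L-sound : ∀ {j v} → (j , v) ∈ L → v ∈ W j ⊎ (∃ λ b → ∃ λ p → E j (X j b p) v ≡ true)
    L-sound m = [ (λ q → inj₁ (LW⁻ q)) , (λ q → inj₂ (LY⁻ q)) ]′ (∈-++⁻ LW m)

    L-nbr : ∀ {i w} → w ∈ W i → ∀ j b v → E j (X j b (pos (i , w))) v ≡ true → (j , v) ∈ L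
    L-nbr {i} {w} m j b v h = ∈-++⁺ʳ LW (LY⁺ b (fromℕ< lt) (subst (λ p → E j (X j b p) v ≡ true) eq h))
      where
      lt : idx (i , w) L < KW
      lt = <-≤-trans (idx-< LW LY (LW⁺ m)) LW≤
      eq : pos (i , w) ≡ early (fromℕ< lt)
      eq = Fin.toℕ-injective (trans (pos-toℕ (L-W m)) (sym (trans (Fin.toℕ-↑ˡ (fromℕ< lt) KY) (Fin.toℕ-fromℕ< lt))))

    open Slots L pos L-sound L-W pos-inj L-nbr

    hst : Slot → Fin n
    hst s = inject≤ (pos s) M≤n

    hst-inj : ∀ {s s′} → s ∈ L → s′ ∈ L → hst s ≡ hst s′ → s ≡ s′
    hst-inj m m′ e = pos-inj m m′ (Fin.inject≤-injective M≤n M≤n _ _ e)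

    opaque
      placing : ∀ j → Σ (Permutation′ n) λ ψ → ∀ {s} → s ∈ L → ψ ⟨$⟩ʳ (hst s) ≡ τ j s
      placing j = extend-perm L hst (τ j) hst-inj (τ-inj j)

    ψ : Fin k → Permutation′ n
    ψ j = proj₁ (placing j)

    ψ-hst : ∀ j {s} → s ∈ L → ψ j ⟨$⟩ʳ (hst s) ≡ τ j s
    ψ-hst j = proj₂ (placing j)

    H : Fin k → Gr n
    H j = E j ^ ψ j

    SL Wh : Fin n → Bool
    SL a = a ∈ᵇ map hst L
    Wh a = a ∈ᵇ map hst LW

    SL⁻ : ∀ {a} → SL a ≡ true → ∃ λ s → s ∈ L × a ≡ hst s
    SL⁻ h = ∈-map⁻ hst (∈ᵇ⇒∈ h)

    SL⁺ : ∀ {s} → s ∈ L → SL (hst s) ≡ true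
    SL⁺ m = ∈⇒∈ᵇ (∈-map⁺ hst m)

    Wh⁻ : ∀ {a} → Wh a ≡ true → ∃ λ s → s ∈ LW × a ≡ hst s
    Wh⁻ h = ∈-map⁻ hst (∈ᵇ⇒∈ h)

    SL-τ : ∀ j {b s} → s ∈ L → τ j s ≡ ψ j ⟨$⟩ʳ b → SL b ≡ true
    SL-τ j {b} {s} m e = subst (λ z → SL z ≡ true) (perm-inj (ψ j) (trans (ψ-hst j m) e)) (SL⁺ m)

    count-SL : count SL ≤ M
    count-SL = ≤-trans (count-∈ᵇ (map hst L)) (≤-trans (≤-reflexive (List.length-map hst L)) L≤)

    packed : Σ (Fin k → Permutation′ n) λ π → ∀ i j → i ≢ j → (E i ^ π i) ⟂ (E j ^ π j)
    packed = let (π , disj) = result in (λ j → π j ∘ₚ ψ j) , disj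
      where
      open Sequential {n} {K = k} {d = d₁} {SL = SL} 1≤n 1≤k small-d (≤-trans (*-monoʳ-≤ 8 count-SL) small-M)
      degH : ∀ j a → SL a ≡ false → deg (H j) a ≤ d₁
      degH j a ns = ≤-trans (≤-reflexive (deg-^ (E j) (ψ j) a)) (≮⇒≥ λ lt → true≢false (SL-τ j (L-W (big∈W j _ lt)) (τ-own j _)) ns)
      degY : ∀ j a → SL a ≡ true → Wh a ≡ false → deg (H j) a ≤ d₂
      degY j a h nw with SL⁻ h
      ... | ((i , v) , m , refl) = ≤-trans (≤-reflexive (trans (deg-^ (E j) (ψ j) a) (cong (deg (E j)) (ψ-hst j m))))
        (low m (λ w → true≢false (∈⇒∈ᵇ (∈-map⁺ hst (LW⁺ w))) nw) j)
      closedH : ∀ a → Wh a ≡ true → ∃ λ o → ∀ j → j ≢ o → ∀ b → H j a b ≡ true → SL b ≡ true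
      closedH a h with Wh⁻ h
      ... | ((i , w) , m , refl) = i , λ j ne b e →
        let (s , q , eq) = closed (LW⁻ m) j ne (ψ j ⟨$⟩ʳ b) (subst (λ z → E j z (ψ j ⟨$⟩ʳ b) ≡ true) (ψ-hst j (∈-++⁺ˡ m)) e) in SL-τ j q eq
      disjH : ∀ i j → i ≢ j → ∀ a b → SL a ≡ true → SL b ≡ true → H i a b ≡ true → H j a b ≡ true → ⊥
      disjH i j ne a b ha hb e e′ with SL⁻ ha | SL⁻ hb
      ... | (s , m , refl) | (s′ , m′ , refl) = disjoint ne m m′
        (subst₂ (λ y z → E i y z ≡ true) (ψ-hst i m) (ψ-hst i m′) e) (subst₂ (λ y z → E j y z ≡ true) (ψ-hst j m) (ψ-hst j m′) e′)
      result = pack-heavy (k , ≤-refl) {d₂} Wh H d₂≤d₁ (≤-trans (*-monoʳ-≤ (8 * k) (*-monoˡ-≤ d₂ count-SL)) small-M′)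
        (λ j u v → symE j _ _) (λ j v → irrE j _) (λ j → ≤-trans (≤-reflexive (sum-deg-^ (E j) (ψ j))) (sumE j))
        degH degY closedH disjH
        (λ a h → let (s , m , e) = Wh⁻ h in subst (λ z → SL z ≡ true) (sym e) (SL⁺ (∈-++⁺ˡ m)))

-- Covering the centres of star-like trees

before : (ℕ → Bool) → ℕ → ℕ
before P zero = 0
before P (suc j) = before P j + ⟦ P j ⟧

before-mono : ∀ P {i} j → i ≤ j → before P i ≤ before P j
before-mono P zero z≤n = ≤-refl
before-mono P {i} (suc j) h with m≤n⇒m<n∨m≡n h
... | inj₂ refl = ≤-refl
... | inj₁ (s≤s h′) = ≤-trans (before-mono P j h′) (m≤m+n _ _)

before-< : ∀ P {i} j → i < j → P i ≡ true → before P i < before P j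
before-< P {i} j lt h = ≤-trans (≤-reflexive (trans (+-comm 1 _) (cong (before P i +_) (sym (⟦⟧-true h))))) (before-mono P j lt)

before-+ : ∀ P a d → before P (d + a) ≤ before P a + d
before-+ P a zero = ≤-reflexive (sym (+-identityʳ _))
before-+ P a (suc d) = ≤-trans (+-mono-≤ (before-+ P a d) (⟦⟧≤1 _)) (≤-reflexive (trans (+-assoc (before P a) d 1) (cong (before P a +_) (+-comm d 1))))

before-find : ∀ P j r → r < before P j → ∃ λ e → e < j × P e ≡ true × before P e ≡ r
before-find P (suc j) r lt with r <? before P j
... | yes lt′ = let (e , a , b , c) = before-find P j r lt′ in e , ≤-trans a (n≤1+n j) , b , c
... | no nlt with P j in eq
...   | true = j , ≤-refl , eq , ≤-antisym (≮⇒≥ nlt) (≤-pred (≤-trans lt (≤-reflexive (+-comm _ 1))))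
...   | false = ⊥-elim (nlt (≤-trans lt (≤-reflexive (+-identityʳ _))))

extend : ∀ {k} → (Fin k → Bool) → ℕ → Bool
extend {k} P x with x <? k
... | yes lt = P (fromℕ< lt)
... | no _ = false

extend-toℕ : ∀ {k} (P : Fin k → Bool) i → extend P (toℕ i) ≡ P i
extend-toℕ {k} P i with toℕ i <? k
... | yes lt = cong P (Fin.fromℕ<-toℕ i lt)
... | no nlt = ⊥-elim (nlt (Fin.toℕ<n i))

extend-true : ∀ {k} (P : Fin k → Bool) x → extend P x ≡ true → ∃ λ i → toℕ i ≡ x × P i ≡ true
extend-true {k} P x h with x <? k
... | yes lt = fromℕ< lt , Fin.toℕ-fromℕ< lt , h

module Rank {k : ℕ} (P : Fin k → Bool) where
  opaque
    rank : Fin k → ℕ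
    rank i = before (extend P) (toℕ i)

    rank-≤ : ∀ {i j} → toℕ i ≤ toℕ j → rank i ≤ rank j
    rank-≤ {i} {j} h = before-mono _ (toℕ j) h

    rank-< : ∀ {i j} → i ≺ j → P i ≡ true → rank i < rank j
    rank-< {i} {j} h p = before-< _ (toℕ j) h (trans (extend-toℕ P i) p)

    -- `j` itself is not counted, which saves the one needed for the path vertices to suffice.
    rank-gap : ∀ {j i} → P j ≡ false → j ≺ i → rank i < rank j + (toℕ i ∸ toℕ j)
    rank-gap {j} {i} np lt = ≤-trans (s≤s (≤-trans (≤-reflexive (cong (before (extend P)) (sym (m∸n+n≡m lt)))) (≤-trans (before-+ (extend P) (suc (toℕ j)) (toℕ i ∸ suc (toℕ j))) (+-monoˡ-≤ (toℕ i ∸ suc (toℕ j)) (≤-reflexive (trans (cong (λ b → rank j + ⟦ b ⟧) (trans (extend-toℕ P j) np)) (+-identityʳ _)))))))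
      (≤-reflexive (trans (sym (+-suc (rank j) _)) (cong (rank j +_) (sym (+-∸-assoc 1 lt)))))

    rank-find : ∀ {j} r → r < rank j → ∃ λ e → e ≺ j × P e ≡ true × rank e ≡ r
    rank-find {j} r lt with before-find (extend P) (toℕ j) r lt
    ... | (x , x< , px , bx) with extend-true P x px
    ...   | (e , refl , pe) = e , x< , pe , bx

  rank-inj : ∀ {i j} → P i ≡ true → P j ≡ true → rank i ≡ rank j → i ≡ j
  rank-inj {i} {j} pi pj e with <-cmp (toℕ i) (toℕ j)
  ... | tri< lt _ _ = ⊥-elim (<-irrefl e (rank-< lt pi))
  ... | tri≈ _ q _ = Fin.toℕ-injective q
  ... | tri> _ _ gt = ⊥-elim (<-irrefl (sym e) (rank-< gt pj))

  rank-≺ : ∀ {i j} → rank i < rank j → i ≺ j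
  rank-≺ {i} {j} lt with <-cmp (toℕ i) (toℕ j)
  ... | tri< l _ _ = l
  ... | tri≈ _ q _ = ⊥-elim (<-irrefl refl (<-≤-trans lt (rank-≤ (≤-reflexive (sym q)))))
  ... | tri> _ _ gt = ⊥-elim (<-irrefl refl (<-≤-trans lt (rank-≤ (<⇒≤ gt))))

-- The numbers below u listed residue class by residue class modulo R; pos t is the place of t in that list.
record Chains (R u : ℕ) : Set where
  field
    pos : ℕ → ℕ
    pos-< : ∀ {t} → t < u → pos t < u
    pos-inj : ∀ {t t′} → t < u → t′ < u → pos t ≡ pos t′ → t ≡ t′
    pos-0 : pos 0 ≡ 0
    pos-+ : ∀ {t} → t + R < u → pos (t + R) ≡ suc (pos t)

chains : ∀ R u → 1 ≤ R → Chains R u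
chains R zero _ = record { pos = id ; pos-< = id ; pos-inj = λ _ _ e → e ; pos-0 = refl ; pos-+ = λ () }
chains R (suc u) 1≤R = grow (chains R u 1≤R)
  where
  grow : Chains R u → Chains R (suc u)
  grow C with R <? suc u
  ... | no R>u = record
    { pos = pos′ ; pos-< = lt′ ; pos-inj = inj′ ; pos-0 = z′ ; pos-+ = λ {t} h → ⊥-elim (R>u (≤-<-trans (m≤n+m R t) h)) }
    where
    open Chains C
    pos′ : ℕ → ℕ
    pos′ t = t
    lt′ : ∀ {t} → t < suc u → pos′ t < suc u
    lt′ h = h
    inj′ : ∀ {t t′} → t < suc u → t′ < suc u → pos′ t ≡ pos′ t′ → t ≡ t′
    inj′ _ _ e = e
    z′ : pos′ 0 ≡ 0
    z′ = refl
  ... | yes (s≤s R≤u) = record { pos = pos′ ; pos-< = lt′ ; pos-inj = inj′ ; pos-0 = z′ ; pos-+ = plus′ }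
    where
    open Chains C
    a p : ℕ
    a = u ∸ R
    p = pos a
    a+R : a + R ≡ u
    a+R = m∸n+n≡m R≤u
    a<u : a < u
    a<u = ≤-trans (≤-trans (≤-reflexive (+-comm 1 a)) (+-monoʳ-≤ a 1≤R)) (≤-reflexive a+R)
    -- `u` is inserted directly behind `u ∸ R`, so far the last member of its residue class; the
    -- places behind move up by one.
    shift : ℕ → ℕ
    shift x with p <? x
    ... | yes _ = suc x
    ... | no _ = x
    shift-> : ∀ {x} → p < x → shift x ≡ suc x
    shift-> {x} h with p <? x
    ... | yes _ = refl
    ... | no nh = ⊥-elim (nh h)
    shift-≤ : ∀ {x} → x ≤ p → shift x ≡ x
    shift-≤ {x} h with p <? x
    ... | yes h′ = ⊥-elim (<-irrefl refl (<-≤-trans h′ h))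
    ... | no _ = refl
    shift≢ : ∀ x → shift x ≢ suc p
    shift≢ x e with p <? x
    ... | yes h = <-irrefl (sym (suc-injective e)) h
    ... | no nh = nh (≤-reflexive (sym e))
    shift-inj : ∀ {x y} → shift x ≡ shift y → x ≡ y
    shift-inj {x} {y} e with p <? x | p <? y
    ... | yes _ | yes _ = suc-injective e
    ... | no _ | no _ = e
    ... | yes h | no nh = ⊥-elim (nh (≤-trans h (≤-trans (n≤1+n x) (≤-reflexive e))))
    ... | no nh | yes h = ⊥-elim (nh (≤-trans h (≤-trans (n≤1+n y) (≤-reflexive (sym e)))))
    shift-< : ∀ {x} → x < u → shift x < suc u
    shift-< {x} h with p <? x
    ... | yes _ = s≤s h
    ... | no _ = ≤-trans h (n≤1+n u)
    pos′ : ℕ → ℕ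
    pos′ t with t ≟ u
    ... | yes _ = suc p
    ... | no _ = shift (pos t)
    pos-old : ∀ {t} → t < u → pos′ t ≡ shift (pos t)
    pos-old {t} h with t ≟ u
    ... | yes refl = ⊥-elim (<-irrefl refl h)
    ... | no _ = refl
    below : ∀ {t} → t < suc u → t ≢ u → t < u
    below (s≤s h) ne = ≤∧≢⇒< h ne
    lt′ : ∀ {t} → t < suc u → pos′ t < suc u
    lt′ {t} h with t ≟ u
    ... | yes _ = s≤s (pos-< a<u)
    ... | no ne = shift-< (pos-< (below h ne))
    inj′ : ∀ {t t′} → t < suc u → t′ < suc u → pos′ t ≡ pos′ t′ → t ≡ t′
    inj′ {t} {t′} h h′ e with t ≟ u | t′ ≟ u
    ... | yes refl | yes refl = refl
    ... | yes _ | no _ = ⊥-elim (shift≢ (pos t′) (sym e))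
    ... | no _ | yes _ = ⊥-elim (shift≢ (pos t) e)
    ... | no ne | no ne′ = pos-inj (below h ne) (below h′ ne′) (shift-inj {pos t} {pos t′} e)
    z′ : pos′ 0 ≡ 0
    z′ with 0 ≟ u
    ... | yes refl = ⊥-elim (n≮0 a<u)
    ... | no _ = trans (shift-≤ (≤-trans (≤-reflexive pos-0) z≤n)) pos-0
    plus′ : ∀ {t} → t + R < suc u → pos′ (t + R) ≡ suc (pos′ t)
    plus′ {t} h with t + R ≟ u
    ... | yes e = cong suc (sym (trans (pos-old t<u) (trans (cong (shift ∘ pos) t≡a) (shift-≤ ≤-refl))))
      where
      t≡a : t ≡ a
      t≡a = +-cancelʳ-≡ R t a (trans e (sym a+R))
      t<u : t < u
      t<u = subst (_< u) (sym t≡a) a<u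
    ... | no ne = trans (trans (cong shift (pos-+ lt)) go) (cong suc (sym (pos-old t<u)))
      where
      lt : t + R < u
      lt = below h ne
      t<u : t < u
      t<u = ≤-<-trans (m≤m+n t R) lt
      go : shift (suc (pos t)) ≡ suc (shift (pos t))
      go with <-cmp (pos t) p
      ... | tri< l _ _ = trans (shift-≤ l) (cong suc (sym (shift-≤ (<⇒≤ l))))
      ... | tri≈ _ e _ = ⊥-elim (<-irrefl (trans (cong (_+ R) (pos-inj t<u a<u e)) a+R) lt)
      ... | tri> _ _ g = trans (shift-> (≤-trans g (n≤1+n _))) (cong suc (sym (shift-> g)))

module Spec {n k : ℕ} (isS isP : Fin k → Bool) where
  open Rank isS public using () renaming (rank to rk; rank-< to rk-<; rank-≤ to rk-≤; rank-gap to rk-gap; rank-find to rk-find; rank-inj to rk-inj; rank-≺ to rk-≺)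
  module RP = Rank isP

  R : Fin k → ℕ
  R j = suc (RP.rank j)

  Later : Fin k → Fin k → Set
  Later j i = isS j ≡ false × isS i ≡ true × j ≺ i

  NoUp : Fin k → Fin k → Set
  NoUp j i = ∀ i′ → isS i′ ≡ true → isP j ≡ true → rk i′ ≢ rk i + R j

  record SpecialCover (E : Gr n) (j : Fin k) : Set where
    field
      cv nx : Fin k → Fin n
      skip : Fin k → Bool
      dmi : Fin k → Fin k
      cv-inj : ∀ {i i′} → Later j i → Later j i′ → cv i ≡ cv i′ → i ≡ i′
      cv-real : ∀ {i} → Later j i → 1 ≤ deg E (cv i)
      cv-low : ∀ {i} → Later j i → deg E (cv i) ≤ 2
      nx-real : ∀ {i} → Later j i → 1 ≤ deg E (nx i)
      cv-nbrs : ∀ {i} → Later j i → skip i ≡ false → ∀ v → E (cv i) v ≡ true →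
        v ≡ nx i ⊎ (∃ λ e → Later j e × isP j ≡ true × rk i ≡ rk e + R j × v ≡ cv e)
      nx-up : ∀ {i i′} → Later j i → isS i′ ≡ true → isP j ≡ true → rk i′ ≡ rk i + R j → nx i ≡ cv i′ × skip i′ ≡ false
      -- Such an `nx i′` is going to own a slot of `j`, while `cv i` belongs on the centre of `i`.
      cv-nx : ∀ {i i′} → Later j i → Later j i′ → skip i ≡ false → NoUp j i′ → cv i ≢ nx i′
      skip-P : ∀ {i} → skip i ≡ true → isP j ≡ true
      dmi-≺ : ∀ {i} → Later j i → skip i ≡ true → dmi i ≺ j
      dmi-S : ∀ {i} → Later j i → skip i ≡ true → isS (dmi i) ≡ false
      dmi-inj : ∀ {i i′} → Later j i → Later j i′ → skip i ≡ true → skip i′ ≡ true → dmi i ≡ dmi i′ → i ≡ i′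

  -- Exactly `k ∸ 1 ∸ toℕ j` indices follow `j`; the hypothesis on leaves and pending paths supplies
  -- one vertex for each.
  gap : ∀ {j i : Fin k} → j ≺ i → toℕ i ∸ suc (toℕ j) < k ∸ 1 ∸ toℕ j
  gap {j} {i} lt = ≤-trans (∸-monoˡ-< (Fin.toℕ<n i) lt) (≤-reflexive (sym (∸-+-assoc k 1 (toℕ j))))

  module ByLeaves (E : Gr n) (symE : Symm E) (j : Fin k) (notP : isP j ≡ false)
    (ℓ : Fin (k ∸ 1 ∸ toℕ j) → Fin n) (ℓ-inj : ∀ {a b} → ℓ a ≡ ℓ b → a ≡ b) (ℓ-leaf : ∀ a → deg E (ℓ a) ≡ 1)
    (no-K₂ : ∀ a b → E (ℓ a) (ℓ b) ≡ true → ⊥) (v₀ : Fin n) where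

    parent : ∀ a → ∃ λ v → E (ℓ a) v ≡ true
    parent a = let (f , _ , pf) = pick 1 (E (ℓ a)) (≤-reflexive (sym (ℓ-leaf a))) in f zero , pf zero

    num : ∀ i → j ≺ i → Fin (k ∸ 1 ∸ toℕ j)
    num i lt = fromℕ< (gap lt)

    cv nx : Fin k → Fin n
    cv i with toℕ j <? toℕ i
    ... | yes lt = ℓ (num i lt)
    ... | no _ = v₀
    nx i with toℕ j <? toℕ i
    ... | yes lt = proj₁ (parent (num i lt))
    ... | no _ = v₀

    data Form (i : Fin k) : Fin n → Fin n → Set where
      form : ∀ a → toℕ a ≡ toℕ i ∸ suc (toℕ j) → Form i (ℓ a) (proj₁ (parent a))

    cv-form : ∀ {i} → j ≺ i → Form i (cv i) (nx i)
    cv-form {i} lt with toℕ j <? toℕ i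
    ... | yes lt′ = form (num i lt′) (Fin.toℕ-fromℕ< (gap lt′))
    ... | no nlt = ⊥-elim (nlt lt)

    special : SpecialCover E j
    special = record
      { cv = cv ; nx = nx ; skip = λ _ → false ; dmi = id
      ; cv-inj = λ (_ , _ , lt) (_ , _ , lt′) e → inj lt lt′ (cv-form lt) (cv-form lt′) e
      ; cv-real = λ (_ , _ , lt) → real (cv-form lt)
      ; cv-low = λ (_ , _ , lt) → lowd (cv-form lt)
      ; nx-real = λ (_ , _ , lt) → nreal (cv-form lt)
      ; cv-nbrs = λ (_ , _ , lt) _ v h → inj₁ (only (cv-form lt) h)
      ; nx-up = λ _ _ P _ → ⊥-elim (true≢false P notP)
      ; cv-nx = λ (_ , _ , lt) (_ , _ , lt′) _ _ e → sep (cv-form lt) (cv-form lt′) e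
      ; skip-P = λ () ; dmi-≺ = λ _ () ; dmi-S = λ _ () ; dmi-inj = λ _ _ () }
      where
      inj : ∀ {i i′ x y x′ y′} → j ≺ i → j ≺ i′ → Form i x y → Form i′ x′ y′ → x ≡ x′ → i ≡ i′
      inj lt lt′ (form a ea) (form b eb) e with ℓ-inj e
      ... | refl = Fin.toℕ-injective (∸-cancelʳ-≡ lt lt′ (trans (sym ea) eb))
      real : ∀ {i x y} → Form i x y → 1 ≤ deg E x
      real (form a _) = ≤-reflexive (sym (ℓ-leaf a))
      lowd : ∀ {i x y} → Form i x y → deg E x ≤ 2
      lowd (form a _) = ≤-trans (≤-reflexive (ℓ-leaf a)) (n≤1+n 1)
      nreal : ∀ {i x y} → Form i x y → 1 ≤ deg E y
      nreal (form a _) = nbr⇒deg E (trans (symE _ _) (proj₂ (parent a)))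
      only : ∀ {i x y v} → Form i x y → E x v ≡ true → v ≡ y
      only (form a _) h = leaf-unique E (ℓ-leaf a) h (proj₂ (parent a))
      sep : ∀ {i i′ x y x′ y′} → Form i x y → Form i′ x′ y′ → x ≢ y′
      sep (form a _) (form b _) e = no-K₂ b a (subst (λ z → E (ℓ b) z ≡ true) (sym e) (proj₂ (parent b)))

  -- The centre of the later star-like tree i goes to the vertex pos (rk i ∸ rk j) of the path.  Tree j then uses edges
  -- between centres only if their ranks differ by R j, and R takes different values on different path-like trees.
  module ByPath (E : Gr n) (symE : Symm E) (j : Fin k) (isPj : isP j ≡ true) (P⇒¬S : ∀ i → isP i ≡ true → isS i ≡ false)
    (q : ℕ → Fin n) (q-inj : ∀ {l l′} → l ≤ k ∸ 1 ∸ toℕ j → l′ ≤ k ∸ 1 ∸ toℕ j → q l ≡ q l′ → l ≡ l′)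
    (q-step : ∀ {l} → l < k ∸ 1 ∸ toℕ j → E (q l) (q (suc l)) ≡ true)
    (q-low : ∀ {l} → l < k ∸ 1 ∸ toℕ j → deg E (q l) ≤ 2)
    (q-nbrs : ∀ {l} → l < k ∸ 1 ∸ toℕ j → ∀ v → E (q l) v ≡ true → v ≡ q (suc l) ⊎ (∃ λ l′ → l ≡ suc l′ × v ≡ q l′)) where

    u : ℕ
    u = k ∸ 1 ∸ toℕ j

    open Chains (chains (R j) u (s≤s z≤n))

    t : Fin k → ℕ
    t i = rk i ∸ rk j

    rk-t : ∀ {i} → j ≺ i → rk i ≡ rk j + t i
    rk-t lt = sym (m+[n∸m]≡n (rk-≤ (<⇒≤ lt)))

    t<u : ∀ {i} → Later j i → t i < u
    t<u {i} (nS , _ , lt) = ≤-trans (+-cancelˡ-≤ (rk j) _ _ (≤-trans (≤-reflexive (trans (+-suc (rk j) (t i)) (cong suc (sym (rk-t lt))))) (≤-trans (rk-gap nS lt) (≤-reflexive (cong (rk j +_) (+-∸-assoc 1 lt)))))) (gap lt)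

    -- These are the first members of all chains but that of 0. Their lower neighbour on the path
    -- ends another chain and is not a step `R j` below, so no dummy is meant for it. Member 0 is
    -- the free end of the path and has no lower neighbour.
    skip : Fin k → Bool
    skip i = ltb 0 (t i) ∧ ltb (t i) (R j)

    data Unskipped (i : Fin k) : Set where
      first : t i ≡ 0 → Unskipped i
      later : ∀ s → t i ≡ s + R j → Unskipped i

    unskipped : ∀ i → skip i ≡ false → Unskipped i
    unskipped i h with decBool (ltb 0 (t i))
    ... | inj₂ e = first (n≤0⇒n≡0 (ltb-false {0} e))
    ... | inj₁ e = later (t i ∸ R j) (sym (m∸n+n≡m (ltb-false {t i} {R j} (¬true⇒false λ e′ → true≢false (∧-intro e e′) h))))

    no-skip : ∀ {i s} → t i ≡ s + R j → skip i ≡ false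
    no-skip {i} {s} e = ¬true⇒false λ h → <-irrefl refl (<-≤-trans (ltb-true {t i} (proj₂ (∧-elim {ltb 0 (t i)} h))) (≤-trans (m≤n+m (R j) s) (≤-reflexive (sym e))))

    t-inj : ∀ {i i′} → Later j i → Later j i′ → t i ≡ t i′ → i ≡ i′
    t-inj (_ , S , lt) (_ , S′ , lt′) e = rk-inj S S′ (trans (rk-t lt) (trans (cong (rk j +_) e) (sym (rk-t lt′))))

    up-t : ∀ {i i′} → Later j i → isS i′ ≡ true → rk i′ ≡ rk i + R j → Later j i′ × t i′ ≡ t i + R j
    up-t {i} {i′} (nS , S , lt) S′ e = (nS , S′ , lt′) , trans (cong (_∸ rk j) (trans e (trans (cong (_+ R j) (rk-t lt)) (+-assoc (rk j) (t i) (R j))))) (m+n∸m≡n (rk j) _)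
      where
      lt′ : j ≺ i′
      lt′ = <-trans lt (rk-≺ (≤-trans (≤-trans (≤-reflexive (+-comm 1 (rk i))) (+-monoʳ-≤ (rk i) (s≤s z≤n))) (≤-reflexive (sym e))))

    down : ∀ {i s} → Later j i → t i ≡ s + R j → ∃ λ e → Later j e × rk i ≡ rk e + R j × t e ≡ s
    down {i} {s} (nS , S , lt) eq = let (e , e≺i , Se , re) = rk-find (rk j + s) less in
      e , (nS , Se , j≺ Se re) , trans rki (cong (_+ R j) (sym re)) , trans (cong (_∸ rk j) re) (m+n∸m≡n (rk j) s)
      where
      rki : rk i ≡ (rk j + s) + R j
      rki = trans (rk-t lt) (trans (cong (rk j +_) eq) (sym (+-assoc (rk j) s (R j))))
      less : rk j + s < rk i
      less = ≤-trans (≤-trans (≤-reflexive (+-comm 1 (rk j + s))) (+-monoʳ-≤ (rk j + s) (s≤s z≤n))) (≤-reflexive (sym rki))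
      j≺ : ∀ {e} → isS e ≡ true → rk e ≡ rk j + s → j ≺ e
      j≺ {e} Se re with <-cmp (toℕ j) (toℕ e)
      ... | tri< l _ _ = l
      ... | tri≈ _ x _ = ⊥-elim (true≢false Se (trans (cong isS (sym (Fin.toℕ-injective x))) nS))
      ... | tri> _ _ g = ⊥-elim (<-irrefl refl (<-≤-trans (rk-< g Se) (≤-trans (m≤m+n (rk j) s) (≤-reflexive (sym re)))))

    cv nx : Fin k → Fin n
    cv i = q (pos (t i))
    nx i = q (suc (pos (t i)))

    p<u : ∀ {i} → Later j i → pos (t i) < u
    p<u l = pos-< (t<u l)

    pos-step : ∀ {i s} → Later j i → t i ≡ s + R j → pos (t i) ≡ suc (pos s)
    pos-step l e = trans (cong pos e) (pos-+ (subst (_< u) e (t<u l)))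

    skip-t : ∀ {i} → skip i ≡ true → pred (t i) < RP.rank j × suc (pred (t i)) ≡ t i
    skip-t {i} h with ∧-elim {ltb 0 (t i)} h
    ... | (a , b) = ≤-pred (≤-trans (s≤s (≤-reflexive (suc-pred′ (ltb-true {0} a)))) (ltb-true {t i} b)) , suc-pred′ (ltb-true {0} a)
      where
      suc-pred′ : ∀ {x} → 0 < x → suc (pred x) ≡ x
      suc-pred′ (s≤s _) = refl

    -- The skipped values of `t` lie strictly between 0 and `R j`, so they are no more than the
    -- path-like trees before `j`. A value `t i` takes the dummy of the tree of rank `pred (t i)`;
    -- `j` is only a default.
    dmi : Fin k → Fin k
    dmi i with pred (t i) <? RP.rank j
    ... | yes lt = proj₁ (RP.rank-find (pred (t i)) lt)
    ... | no _ = j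

    dmi-ok : ∀ {i} → skip i ≡ true → dmi i ≺ j × isP (dmi i) ≡ true × RP.rank (dmi i) ≡ pred (t i)
    dmi-ok {i} h with pred (t i) <? RP.rank j
    ... | yes lt = proj₂ (RP.rank-find (pred (t i)) lt)
    ... | no nlt = ⊥-elim (nlt (proj₁ (skip-t {i} h)))

    special : SpecialCover E j
    special = record
      { cv = cv ; nx = nx ; skip = skip ; dmi = dmi
      ; cv-inj = λ l l′ e → t-inj l l′ (pos-inj (t<u l) (t<u l′) (q-inj (<⇒≤ (p<u l)) (<⇒≤ (p<u l′)) e))
      ; cv-real = λ l → nbr⇒deg E (q-step (p<u l))
      ; cv-low = λ l → q-low (p<u l)
      ; nx-real = λ l → nbr⇒deg E (trans (symE _ _) (q-step (p<u l)))
      ; cv-nbrs = nbrs ; nx-up = up ; cv-nx = sep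
      ; skip-P = λ _ → isPj
      ; dmi-≺ = λ _ h → proj₁ (dmi-ok h)
      ; dmi-S = λ _ h → P⇒¬S _ (proj₁ (proj₂ (dmi-ok h)))
      ; dmi-inj = λ {i} {i′} l l′ h h′ e → t-inj l l′ (trans (sym (proj₂ (skip-t {i} h))) (trans (cong suc (trans (sym (proj₂ (proj₂ (dmi-ok h)))) (trans (cong RP.rank e) (proj₂ (proj₂ (dmi-ok h′)))))) (proj₂ (skip-t {i′} h′)))) }
      where
      nbrs : ∀ {i} → Later j i → skip i ≡ false → ∀ v → E (cv i) v ≡ true →
        v ≡ nx i ⊎ (∃ λ e → Later j e × isP j ≡ true × rk i ≡ rk e + R j × v ≡ cv e)
      nbrs {i} l sk v h with q-nbrs (p<u l) v h
      ... | inj₁ e = inj₁ e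
      ... | inj₂ (l′ , el , ev) with unskipped i sk
      ...   | first t0 with trans (sym (trans (cong pos t0) pos-0)) el
      ...     | ()
      nbrs {i} l sk v h | inj₂ (l′ , el , ev) | later s ts = let (e , le , re , te) = down l ts in
        inj₂ (e , le , isPj , re , trans ev (cong q (trans (suc-injective (trans (sym el) (pos-step l ts))) (cong pos (sym te)))))
      up : ∀ {i i′} → Later j i → isS i′ ≡ true → isP j ≡ true → rk i′ ≡ rk i + R j → nx i ≡ cv i′ × skip i′ ≡ false
      up {i} {i′} l S′ _ e = let (l′ , te) = up-t l S′ e in cong q (sym (pos-step l′ te)) , no-skip {i′} te
      -- If `cv i` came right after `cv i′`, then `i′` would precede `i` in its chain, against
      -- `NoUp`; and position 0 comes after nothing.
      sep : ∀ {i i′} → Later j i → Later j i′ → skip i ≡ false → NoUp j i′ → cv i ≢ nx i′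
      sep {i} {i′} l l′ sk none e with unskipped i sk
      ... | first t0 with trans (sym (trans (cong pos t0) pos-0)) (q-inj (<⇒≤ (p<u l)) (p<u l′) e)
      ...   | ()
      sep {i} {i′} l l′ sk none e | later s ts = let (e₁ , le , re , te) = down l ts in
        none i (proj₁ (proj₂ l)) isPj (trans re (cong (λ x → rk x + R j) (t-inj le l′ (trans te (pos-inj (s<u ts) (t<u l′) (suc-injective (trans (sym (pos-step l ts)) (q-inj (<⇒≤ (p<u l)) (p<u l′) e))))))))
        where
        s<u : ∀ {s} → t i ≡ s + R j → s < u
        s<u {s} ts = ≤-<-trans (m≤m+n s (R j)) (subst (_< u) ts (t<u l))

-- Trees with dummy vertices

module Ext {m n : ℕ} (m≤n : m ≤ n) (A : Gr m) where

  ι : Fin m → Fin n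
  ι u = inject≤ u m≤n

  ι-inj : ∀ {u v} → ι u ≡ ι v → u ≡ v
  ι-inj = Fin.inject≤-injective m≤n m≤n _ _

  real : Fin n → Bool
  real a = ltb (toℕ a) m

  ι-real : ∀ u → real (ι u) ≡ true
  ι-real u = ltb-intro (≤-trans (s≤s (≤-reflexive (Fin.toℕ-inject≤ u m≤n))) (Fin.toℕ<n u))

  real⁻ : ∀ {a} → real a ≡ true → ∃ λ u → a ≡ ι u
  real⁻ {a} h = fromℕ< lt , Fin.toℕ-injective (sym (trans (Fin.toℕ-inject≤ _ m≤n) (Fin.toℕ-fromℕ< lt)))
    where
    lt : toℕ a < m
    lt = ltb-true {toℕ a} h

  E : Gr n
  E a b with toℕ a <? m | toℕ b <? m
  ... | yes p | yes q = A (fromℕ< p) (fromℕ< q)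
  ... | yes _ | no _ = false
  ... | no _ | _ = false

  fromℕ<-ι : ∀ u (lt : toℕ (ι u) < m) → fromℕ< lt ≡ u
  fromℕ<-ι u lt = Fin.toℕ-injective (trans (Fin.toℕ-fromℕ< lt) (Fin.toℕ-inject≤ u m≤n))

  E-ι : ∀ u v → E (ι u) (ι v) ≡ A u v
  E-ι u v with toℕ (ι u) <? m | toℕ (ι v) <? m
  ... | yes p | yes q = cong₂ A (fromℕ<-ι u p) (fromℕ<-ι v q)
  ... | yes _ | no q = ⊥-elim (q (ltb-true {toℕ (ι v)} (ι-real v)))
  ... | no p | _ = ⊥-elim (p (ltb-true {toℕ (ι u)} (ι-real u)))

  E-real : ∀ {a b} → E a b ≡ true → real a ≡ true × real b ≡ true
  E-real {a} {b} h with toℕ a <? m | toℕ b <? m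
  ... | yes p | yes q = ltb-intro p , ltb-intro q
  E-real {a} {b} () | yes _ | no _
  E-real {a} {b} () | no _ | _

  E⁻ : ∀ {u b} → E (ι u) b ≡ true → ∃ λ v → b ≡ ι v × A u v ≡ true
  E⁻ {u} {b} h with real⁻ (proj₂ (E-real {ι u} {b} h))
  ... | (v , refl) = v , refl , trans (sym (E-ι u v)) h

  symE : Symm A → Symm E
  symE s a b with toℕ a <? m | toℕ b <? m
  ... | yes p | yes q = s _ _
  ... | yes _ | no _ = refl
  ... | no _ | yes _ = refl
  ... | no _ | no _ = refl

  irrE : Irr A → Irr E
  irrE s a with toℕ a <? m
  ... | yes p = s _
  ... | no _ = refl

  count-ι : (Q : Fin n → Bool) (P : Fin m → Bool) → (∀ v → Q (ι v) ≡ P v) → (∀ b → Q b ≡ true → ∃ λ v → b ≡ ι v) → count Q ≡ count P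
  count-ι Q P e s = ≤-antisym (le (pick (count Q) Q ≤-refl)) (ge (pick (count P) P ≤-refl))
    where
    ge : (Σ (Fin (count P) → Fin m) λ f → (∀ {i j} → f i ≡ f j → i ≡ j) × (∀ i → P (f i) ≡ true)) → count P ≤ count Q
    ge (f , inj , pf) = inj-count Q (ι ∘ f) (λ q → inj (ι-inj q)) (λ i → trans (e (f i)) (pf i))
    le : (Σ (Fin (count Q) → Fin n) λ f → (∀ {i j} → f i ≡ f j → i ≡ j) × (∀ i → Q (f i) ≡ true)) → count Q ≤ count P
    le (f , inj , pf) = inj-count P g (λ {i} {j} q → inj (trans (gs i) (trans (cong ι q) (sym (gs j))))) (λ i → trans (sym (e (g i))) (trans (cong Q (sym (gs i))) (pf i)))
      where
      g : Fin (count Q) → Fin m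
      g i = proj₁ (s (f i) (pf i))
      gs : ∀ i → f i ≡ ι (g i)
      gs i = proj₂ (s (f i) (pf i))

  deg-ι : ∀ u → deg E (ι u) ≡ deg A u
  deg-ι u = count-ι (E (ι u)) (A u) (E-ι u) λ b h → let (v , e , _) = E⁻ h in v , e

  deg-fake : ∀ a → real a ≡ false → deg E a ≡ 0
  deg-fake a h = trans (sum-cong λ b → ⟦⟧-false (¬true⇒false λ e → true≢false (proj₁ (E-real {a} {b} e)) h)) sum-0

  sum-deg : sum (deg E) ≤ sum (deg A)
  sum-deg = ≤-trans (sum-mono pt) (≤-reflexive (trans (sum-comm (λ a v → ⟦ ι v == a ⟧ * deg E a)) (sum-cong λ v → trans (sum-delta (ι v) (deg E)) (deg-ι v))))
    where
    pt : ∀ a → deg E a ≤ sum (λ v → ⟦ ι v == a ⟧ * deg E a)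
    pt a with decBool (real a)
    ... | inj₂ h = ≤-trans (≤-reflexive (deg-fake a h)) z≤n
    ... | inj₁ h with real⁻ h
    ...   | (u , refl) = ≤-trans (≤-reflexive (sym (trans (cong (λ b → ⟦ b ⟧ * deg E (ι u)) (==-refl (ι u))) (+-identityʳ _)))) (term≤sum (λ v → ⟦ ι v == ι u ⟧ * deg E (ι u)) u)

  fake-count : count (λ a → not (real a)) ≤ n ∸ m
  fake-count = go (pick (count (λ a → not (real a))) (λ a → not (real a)) ≤-refl)
    where
    go : (Σ (Fin (count (λ a → not (real a))) → Fin n) λ f → (∀ {i j} → f i ≡ f j → i ≡ j) × (∀ i → not (real (f i)) ≡ true)) → count (λ a → not (real a)) ≤ n ∸ m
    go (f , inj , pf) = Fin.injective⇒≤ {f = λ i → fromℕ< (lt i)} λ {i} {j} e → inj (Fin.toℕ-injective (∸-cancelʳ-≡ (ge i) (ge j) (trans (sym (Fin.toℕ-fromℕ< (lt i))) (trans (cong toℕ e) (Fin.toℕ-fromℕ< (lt j))))))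
      where
      ge : ∀ i → m ≤ toℕ (f i)
      ge i = ltb-ge (not-elim (pf i))
        where
        ltb-ge : ∀ {x y} → ltb x y ≡ false → y ≤ x
        ltb-ge {x} {y} h = ltb-false {x} {y} h
      lt : ∀ i → toℕ (f i) ∸ m < n ∸ m
      lt i = ∸-monoˡ-< (Fin.toℕ<n (f i)) (ge i)

-- Trees with at least three vertices, and pending paths

module TreeFacts {m : ℕ} (G : Graph m) (3≤m : 3 ≤ m) (conn : Connected G) where

  outside : ∀ (l : List (Fin m)) → length l ≤ 2 → ∃ λ z → ¬ (z ∈ l)
  outside l h with any? (λ z → (z ∈ᵇ l) Bool.≟ false)
  ... | yes (z , e) = z , λ q → true≢false (∈⇒∈ᵇ q) e
  ... | no none = ⊥-elim (<-irrefl refl (≤-trans 3≤m (≤-trans (≤-reflexive (sym (count-full full))) (≤-trans (count-∈ᵇ l) h))))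
    where
    full : ∀ z → (z ∈ᵇ l) ≡ true
    full z with decBool (z ∈ᵇ l)
    ... | inj₁ e = e
    ... | inj₂ e = ⊥-elim (none (z , e))

  deg≥1 : ∀ v → 1 ≤ deg (adj G) v
  deg≥1 v = let (w , w∉) = outside (v ∷ []) (s≤s z≤n) in last (λ e → w∉ (here e)) (conn w v)
    where
    last : ∀ {w} → w ≢ v → Reach G w v → 1 ≤ deg (adj G) v
    last w≢v here = ⊥-elim (w≢v refl)
    last w≢v (step {w = x} _ e) = nbr⇒deg (adj G) (trans (Graph.sym G v x) (T⇒≡ e))

  -- Two adjacent leaves form a whole component, so connectivity would leave no third vertex.
  no-K₂ : ∀ a b → deg (adj G) a ≡ 1 → deg (adj G) b ≡ 1 → adj G a b ≡ true → ⊥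
  no-K₂ a b da db ab = let (z , z∉) = outside (a ∷ b ∷ []) ≤-refl in stay z∉ (conn a z)
    where
    inside : ∀ {z} → Reach G a z → z ∈ a ∷ b ∷ []
    inside here = here refl
    inside (step r e) with inside r
    ... | here refl = there (here (leaf-unique (adj G) da (T⇒≡ e) ab))
    ... | there (here refl) = here (leaf-unique (adj G) db (T⇒≡ e) (trans (Graph.sym G b a) ab))
    stay : ∀ {z} → ¬ (z ∈ a ∷ b ∷ []) → Reach G a z → ⊥
    stay nz r = nz (inside r)

three-nbrs : (A : Gr m) {x a b c : Fin m} → A x a ≡ true → A x b ≡ true → A x c ≡ true → a ≢ b → a ≢ c → b ≢ c → 3 ≤ deg A x
three-nbrs A ha hb hc ab ac bc = unique≤count ((ab ∷ ac ∷ []) ∷ ((bc ∷ []) ∷ ([] ∷ []))) (ha ∷ hb ∷ hc ∷ [])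

-- A pending path listed from its free end, followed by the vertex it hangs from.
record Pending (A : Gr m) (t : ℕ) : Set where
  field
    q : ℕ → Fin m
    q-inj : ∀ {l l′} → l ≤ t → l′ ≤ t → q l ≡ q l′ → l ≡ l′
    q-step : ∀ {l} → l < t → A (q l) (q (suc l)) ≡ true
    q-low : ∀ {l} → l < t → deg A (q l) ≤ 2
    q-nbrs : ∀ {l} → l < t → ∀ v → A (q l) v ≡ true → v ≡ q (suc l) ⊎ (∃ λ l′ → l ≡ suc l′ × v ≡ q l′)

module _ (G : Graph m) where
  private A = adj G

  opposite-suc : ∀ {t} (i j : Fin t) → suc (toℕ (opposite i)) ≡ toℕ (opposite j) → suc (toℕ j) ≡ toℕ i
  opposite-suc {t} i j e = sym (∸-cancelˡ-≡ (<⇒≤ (Fin.toℕ<n i)) (Fin.toℕ<n j)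
    (trans (sym (trans (sym (+-∸-assoc 1 (Fin.toℕ<n i))) refl)) (trans (cong suc (sym (Fin.opposite-prop i))) (trans e (Fin.opposite-prop j)))))

  opposite-consec : ∀ {t} (i j : Fin t) → Consec G (opposite i) (opposite j) → Consec G i j
  opposite-consec i j (inj₁ e) = inj₂ (opposite-suc i j e)
  opposite-consec i j (inj₂ e) = inj₁ (opposite-suc j i e)

  module _ {t : ℕ} (a b : Fin m) (ab : A a b ≡ true) (p : Fin t → Fin m) (p-inj : ∀ {i j} → p i ≡ p j → i ≡ j)
    (reach→ : ∀ v → ReachAvoid G a b b v → ∃ λ i → p i ≡ v) (→reach : ∀ i → ReachAvoid G a b b (p i))
    (consec : ∀ i j → A (p i) (p j) ≡ true → Consec G i j) (adjacent : ∀ i j → Consec G i j → A (p i) (p j) ≡ true)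
    (low : ∀ i → deg A (p i) ≤ 2) where

    i₀ : Fin t
    i₀ = proj₁ (reach→ b here)

    p-i₀ : p i₀ ≡ b
    p-i₀ = proj₂ (reach→ b here)

    -- For the case that `a` lies on the path: `Sd` is the part on the side of `b` once the edge to
    -- `a` is cut, and a walk avoiding that edge cannot leave it.
    module Side (i′ : Fin t) (p-i′ : p i′ ≡ a) (Sd : Fin t → Set) (S₀ : Sd i₀)
      (closed : ∀ l l′ → Sd l → Consec G l l′ → ¬ (l ≡ i₀ × l′ ≡ i′) → Sd l′) (¬S : ¬ Sd i′) where
      stay : ∀ {v} → ReachAvoid G a b b v → ∃ λ l → p l ≡ v × Sd l
      stay here = i₀ , p-i₀ , S₀
      stay r@(step {w = w} {x = x} r′ e ne) =
        let (l , pl , Sl) = stay r′ ; (l′ , pl′) = reach→ x r in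
        l′ , pl′ , closed l l′ Sl (consec l l′ (subst₂ (λ y z → A y z ≡ true) (sym pl) (sym pl′) (T⇒≡ e)))
          λ (el , el′) → ne (inj₂ (trans (sym pl) (trans (cong p el) p-i₀) , trans (sym pl′) (trans (cong p el′) p-i′)))
      absurd : ⊥
      absurd = let (l , pl , Sl) = stay (→reach i′) in ¬S (subst Sd (p-inj pl) Sl)

    -- Were `a` on the path, it would be consecutive to `b`, and cutting the edge between them would
    -- separate it from `b`.
    a∉p : ∀ i → p i ≢ a
    a∉p i e with consec i i₀ (subst₂ (λ y z → A y z ≡ true) (sym e) (sym p-i₀) ab)
    ... | inj₁ s = Side.absurd i e (λ l → toℕ i₀ ≤ toℕ l) ≤-refl cl (λ le → <-irrefl refl (≤-trans (≤-reflexive s) le))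
      where
      cl : ∀ l l′ → toℕ i₀ ≤ toℕ l → Consec G l l′ → ¬ (l ≡ i₀ × l′ ≡ i) → toℕ i₀ ≤ toℕ l′
      cl l l′ le (inj₁ c) _ = ≤-trans le (≤-trans (n≤1+n _) (≤-reflexive c))
      cl l l′ le (inj₂ c) ne with m≤n⇒m<n∨m≡n le
      ... | inj₁ lt = ≤-pred (≤-trans lt (≤-reflexive (sym c)))
      ... | inj₂ eq = ⊥-elim (ne (Fin.toℕ-injective (sym eq) , Fin.toℕ-injective (suc-injective (trans c (trans (sym eq) (sym s))))))
    ... | inj₂ s = Side.absurd i e (λ l → toℕ l ≤ toℕ i₀) ≤-refl cl (λ le → <-irrefl refl (≤-trans (≤-reflexive s) le))
      where
      cl : ∀ l l′ → toℕ l ≤ toℕ i₀ → Consec G l l′ → ¬ (l ≡ i₀ × l′ ≡ i) → toℕ l′ ≤ toℕ i₀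
      cl l l′ le (inj₂ c) _ = ≤-trans (≤-trans (n≤1+n _) (≤-reflexive c)) le
      cl l l′ le (inj₁ c) ne with m≤n⇒m<n∨m≡n le
      ... | inj₁ lt = ≤-trans (≤-reflexive (sym c)) lt
      ... | inj₂ eq = ⊥-elim (ne (Fin.toℕ-injective eq , Fin.toℕ-injective (trans (sym c) (trans (cong suc eq) s))))

    ba : A b a ≡ true
    ba = trans (Graph.sym G b a) ab

    -- At an inner position `b` would have two neighbours on the path and `a` as a third.
    ends : toℕ i₀ ≡ 0 ⊎ suc (toℕ i₀) ≡ t
    ends = split (toℕ i₀) refl (m≤n⇒m<n∨m≡n (Fin.toℕ<n i₀))
     where
     split : ∀ x → toℕ i₀ ≡ x → suc (toℕ i₀) < t ⊎ suc (toℕ i₀) ≡ t → toℕ i₀ ≡ 0 ⊎ suc (toℕ i₀) ≡ t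
     split zero e₀ _ = inj₁ e₀
     split (suc x) e₀ (inj₂ e) = inj₂ e
     split (suc x) e₀ (inj₁ lt) = ⊥-elim (<-irrefl refl (≤-trans (three-nbrs A {b} {p prv} {p nxt} {a}
        (subst (λ z → A z (p prv) ≡ true) p-i₀ (adjacent i₀ prv (inj₂ prv-suc)))
        (subst (λ z → A z (p nxt) ≡ true) p-i₀ (adjacent i₀ nxt (inj₁ nxt-suc))) ba
        (λ e → <-irrefl (trans (cong toℕ (p-inj e)) (trans (sym nxt-suc) (cong suc (sym prv-suc)))) (≤-trans (s≤s (n≤1+n _)) ≤-refl)) (a∉p prv) (a∉p nxt))
        (subst (λ z → deg A z ≤ 2) p-i₀ (low i₀))))
      where
      prv nxt : Fin t
      prv = fromℕ< {x} (≤-trans (≤-trans (n≤1+n _) (≤-reflexive (cong suc (sym e₀)))) (Fin.toℕ<n i₀))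
      nxt = fromℕ< lt
      prv-suc : suc (toℕ prv) ≡ toℕ i₀
      prv-suc = trans (cong suc (Fin.toℕ-fromℕ< _)) (sym e₀)
      nxt-suc : suc (toℕ i₀) ≡ toℕ nxt
      nxt-suc = sym (Fin.toℕ-fromℕ< lt)

    -- `f` reads the path so that `b` comes last. The listing then goes on to `a`, the value of `q`
    -- at index `t` and beyond.
    module Last (f : Fin t → Fin t) (f-inj : ∀ {i j} → f i ≡ f j → i ≡ j)
      (f-consec : ∀ i j → Consec G (f i) (f j) → Consec G i j) (f-consec′ : ∀ i j → Consec G i j → Consec G (f i) (f j))
      (f-surj : ∀ i → ∃ λ j → f j ≡ i) (i₁ : Fin t) (f-i₁ : f i₁ ≡ i₀) (i₁-last : suc (toℕ i₁) ≡ t) where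

      q : ℕ → Fin m
      q l with l <? t
      ... | yes lt = p (f (fromℕ< lt))
      ... | no _ = a

      q-path : ∀ i → q (toℕ i) ≡ p (f i)
      q-path i with toℕ i <? t
      ... | yes lt = cong (p ∘ f) (Fin.fromℕ<-toℕ i lt)
      ... | no nlt = ⊥-elim (nlt (Fin.toℕ<n i))

      q-end : q t ≡ a
      q-end with t <? t
      ... | yes lt = ⊥-elim (<-irrefl refl lt)
      ... | no _ = refl

      data Pos (l : ℕ) : Set where
        on : (i : Fin t) → l ≡ toℕ i → Pos l
        end : l ≡ t → Pos l

      position : ∀ {l} → l ≤ t → Pos l
      position le with m≤n⇒m<n∨m≡n le
      ... | inj₁ lt = on (fromℕ< lt) (sym (Fin.toℕ-fromℕ< lt))
      ... | inj₂ e = end e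

      pending : Pending A t
      pending = record { q = q ; q-inj = inj ; q-step = stp ; q-low = lw ; q-nbrs = nb }
        where
        inj : ∀ {l l′} → l ≤ t → l′ ≤ t → q l ≡ q l′ → l ≡ l′
        inj {l} {l′} h h′ e with position {l} h | position {l′} h′
        ... | on i refl | on i′ refl = cong toℕ (f-inj (p-inj (trans (sym (q-path i)) (trans e (q-path i′)))))
        ... | on i refl | end refl = ⊥-elim (a∉p (f i) (trans (sym (q-path i)) (trans e q-end)))
        ... | end refl | on i refl = ⊥-elim (a∉p (f i) (trans (sym (q-path i)) (trans (sym e) q-end)))
        ... | end refl | end refl = refl
        stp : ∀ {l} → l < t → A (q l) (q (suc l)) ≡ true
        stp {l} h with position {l} (<⇒≤ h) | position {suc l} h
        ... | end refl | _ = ⊥-elim (<-irrefl refl h)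
        ... | on i refl | on i′ e = subst₂ (λ y z → A y z ≡ true) (sym (q-path i)) (trans (sym (q-path i′)) (cong q (sym e))) (adjacent (f i) (f i′) (f-consec′ i i′ (inj₁ e)))
        ... | on i refl | end e = subst₂ (λ y z → A y z ≡ true) (sym (trans (q-path i) (trans (cong (p ∘ f) i≡i₁) (trans (cong p f-i₁) p-i₀)))) (sym (trans (cong q e) q-end)) ba
          where
          i≡i₁ : i ≡ i₁
          i≡i₁ = Fin.toℕ-injective (suc-injective (trans e (sym i₁-last)))
        lw : ∀ {l} → l < t → deg A (q l) ≤ 2
        lw {l} h with position {l} (<⇒≤ h)
        ... | end refl = ⊥-elim (<-irrefl refl h)
        ... | on i refl = ≤-trans (≤-reflexive (cong (deg A) (q-path i))) (low (f i))
        nb : ∀ {l} → l < t → ∀ v → A (q l) v ≡ true → v ≡ q (suc l) ⊎ (∃ λ l′ → l ≡ suc l′ × v ≡ q l′)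
        nb {l} h v e with position {l} (<⇒≤ h)
        ... | end refl = ⊥-elim (<-irrefl refl h)
        ... | on i refl = go (subst (λ z → A z v ≡ true) (q-path i) e)
          where
          go : A (p (f i)) v ≡ true → v ≡ q (suc (toℕ i)) ⊎ (∃ λ l′ → toℕ i ≡ suc l′ × v ≡ q l′)
          go e with p (f i) Fin.≟ b | v Fin.≟ a
          ... | yes eb | yes refl = inj₁ (sym (trans (cong q (trans (cong (suc ∘ toℕ) (f-inj (trans (p-inj (trans eb (sym p-i₀))) (sym f-i₁)))) i₁-last)) q-end))
          ... | yes eb | no nv = reached (step (→reach (f i)) (≡⇒T e) λ { (inj₁ (x , _)) → a∉p (f i) x ; (inj₂ (_ , y)) → nv y })
            where
            reached : ReachAvoid G a b b v → v ≡ q (suc (toℕ i)) ⊎ (∃ λ l′ → toℕ i ≡ suc l′ × v ≡ q l′)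
            reached r with reach→ v r
            ... | (i′ , refl) with f-surj i′
            ...   | (j , refl) with f-consec i j (consec (f i) (f j) e)
            ...     | inj₁ s = inj₁ (sym (trans (cong q s) (q-path j)))
            ...     | inj₂ s = inj₂ (toℕ j , sym s , sym (q-path j))
          ... | no nb | _ = reached (step (→reach (f i)) (≡⇒T e) λ { (inj₁ (x , _)) → a∉p (f i) x ; (inj₂ (x , _)) → nb x })
            where
            reached : ReachAvoid G a b b v → v ≡ q (suc (toℕ i)) ⊎ (∃ λ l′ → toℕ i ≡ suc l′ × v ≡ q l′)
            reached r with reach→ v r
            ... | (i′ , refl) with f-surj i′
            ...   | (j , refl) with f-consec i j (consec (f i) (f j) e)
            ...     | inj₁ s = inj₁ (sym (trans (cong q s) (q-path j)))
            ...     | inj₂ s = inj₂ (toℕ j , sym s , sym (q-path j))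

    oriented : Pending A t
    oriented with ends
    ... | inj₂ e = Last.pending id id (λ _ _ → id) (λ _ _ → id) (λ i → i , refl) i₀ refl e
    ... | inj₁ e = Last.pending opposite (λ {i} {j} q → trans (sym (Fin.opposite-involutive i)) (trans (cong opposite q) (Fin.opposite-involutive j)))
        opposite-consec (λ i j c → opposite-consec (opposite i) (opposite j) (subst₂ (Consec G) (sym (Fin.opposite-involutive i)) (sym (Fin.opposite-involutive j)) c))
        (λ i → opposite i , Fin.opposite-involutive i) (opposite i₀) (Fin.opposite-involutive i₀)
        (trans (cong suc (Fin.opposite-prop i₀)) (trans (sym (+-∸-assoc 1 (Fin.toℕ<n i₀))) (cong (t ∸_) e)))

  pending-path : ∀ {t} → PendingPath G t → Pending A t
  pending-path (a , b , ab , p , p-inj , comp , path , low) = oriented a b (T⇒≡ ab) p p-inj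
    (λ v r → Equivalence.to (comp v) r) (λ i → Equivalence.from (comp (p i)) (i , refl))
    (λ i j e → Equivalence.to (path i j) (≡⇒T e)) (λ i j c → T⇒≡ (Equivalence.from (path i j) c))
    (λ i → ≤-trans (≤-reflexive (sym (degree≡deg G (p i)))) (low i))

-- Choice of the constants

-- d₁ bounds the degrees outside the slots, d₂ the degrees at the slots without an owner, w₀ the number of slots a tree owns.
record Sizes (k n : ℕ) : Set where
  field
    B w₀ d₁ d₂ η : ℕ
  M : ℕ
  M = Hosts.M {n} {k} {w₀} {d₁} {d₂}
  field
    w₀≥ : B + (2 + (k + k)) ≤ w₀
    M≥3 : 3 ≤ M
    big-count : ∀ c → c * suc d₁ ≤ 2 * n → c ≤ B
    high-count : ∀ c → c * suc d₂ ≤ 2 * n → c ≤ η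
    D₀≤d₂ : D₀ ≤ d₂
    d₂≤d₁ : d₂ ≤ d₁
    small-d : (c2160 * k) * (k * d₁) ≤ n
    small-M : 8 * M ≤ n
    small-M′ : (8 * k) * (M * d₂) ≤ n
    room₁ : 20 * ((M + M) * (1 + D₀ + D₀ * d₂)) ≤ n
    room₂ : 20 * (η * M) + (80 * (k + k) + 60 * k + 40 * η) < 4 * n
    room-S : 5 * ((M + M) + k + 1) ≤ n
    n>k+2 : 3 + k ≤ n

-- `n` is at most `Q * suc (n / Q)`. So a degree threshold that is a fixed fraction of `n` is
-- exceeded by a number of vertices bounded independently of `n`.
div-count : ∀ n Q .{{_ : NonZero Q}} c → c * suc (n / Q) ≤ 2 * n → c ≤ 2 * Q
div-count n Q c h = *-cancelʳ-≤ c (2 * Q) (suc (n / Q)) (≤-trans h (≤-trans (*-monoʳ-≤ 2 n≤) (≤-reflexive (sym (*-assoc 2 Q (suc (n / Q)))))))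
  where
  n≤ : n ≤ Q * suc (n / Q)
  n≤ = ≤-trans (≤-reflexive (m≡m%n+[m/n]*n n Q)) (≤-trans (+-monoˡ-≤ ((n / Q) * Q) (<⇒≤ (m%n<n n Q))) (≤-reflexive (trans (cong (Q +_) (*-comm (n / Q) Q)) (sym (*-suc Q (n / Q))))))

div-≤ : ∀ n Q .{{_ : NonZero Q}} P → P ≤ Q → P * (n / Q) ≤ n
div-≤ n Q P h = ≤-trans (*-monoˡ-≤ (n / Q) h) (≤-trans (≤-reflexive (*-comm Q (n / Q))) (m/n*n≤m n Q))

div-≥ : ∀ n Q .{{_ : NonZero Q}} x → x * Q ≤ n → x ≤ n / Q
div-≥ n Q x h = ≤-trans (≤-reflexive (sym (m*n/n≡m x Q))) (/-monoˡ-≤ Q h)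

module Choice (k : ℕ) (1≤k : 1 ≤ k) where
  opaque
    -- The order of choice breaks a circle. `Q₁` depends on `k` only and determines the bound `w` on
    -- the slots owned by a tree; this bounds the number `M′` of all slots, and `n / Q₂`, the degree
    -- allowed at slots without an owner, is then chosen small against n / M′.
    Q₁ w M′ Q₂ : ℕ
    Q₁ = (c2160 * k) * k
    w = 2 * Q₁ + (2 + (k + k))
    M′ = k * w + k * (2 * ((k * w) * D₀))
    Q₂ = Q₁ + ((8 * k) * M′ + 20 * ((M′ + M′) * (2 + D₀)))

    w≡ : w ≡ 2 * Q₁ + (2 + (k + k))
    w≡ = refl

    M′≡ : M′ ≡ k * w + k * (2 * ((k * w) * D₀))
    M′≡ = refl

    Q₁≡ : Q₁ ≡ (c2160 * k) * k
    Q₁≡ = refl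

    Q₁≤Q₂ : Q₁ ≤ Q₂
    Q₁≤Q₂ = m≤m+n _ _

    Q₂≥₁ : (8 * k) * M′ ≤ Q₂
    Q₂≥₁ = ≤-trans (m≤m+n _ _) (m≤n+m _ Q₁)

    Q₂≥₂ : 20 * ((M′ + M′) * (2 + D₀)) ≤ Q₂
    Q₂≥₂ = ≤-trans (m≤n+m _ ((8 * k) * M′)) (m≤n+m _ Q₁)

    η : ℕ
    η = 2 * Q₂

    η≡ : η ≡ 2 * Q₂
    η≡ = refl

    bound₂ boundS : ℕ
    bound₂ = 20 * (η * M′) + (80 * (k + k) + 60 * k + 40 * η)
    boundS = 5 * ((M′ + M′) + k + 1)

    bound₂≡ : bound₂ ≡ 20 * (η * M′) + (80 * (k + k) + 60 * k + 40 * η)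
    bound₂≡ = refl

    boundS≡ : boundS ≡ 5 * ((M′ + M′) + k + 1)
    boundS≡ = refl

    n₀ : ℕ
    n₀ = D₀ * Q₂ + (bound₂ + (boundS + (8 * M′ + (3 + k))))

    n₀≥₁ : D₀ * Q₂ ≤ n₀
    n₀≥₁ = m≤m+n _ _

    n₀≥₂ : bound₂ ≤ n₀
    n₀≥₂ = ≤-trans (m≤m+n _ _) (m≤n+m _ (D₀ * Q₂))

    n₀≥₃ : boundS ≤ n₀
    n₀≥₃ = ≤-trans (≤-trans (m≤m+n _ _) (m≤n+m _ bound₂)) (m≤n+m _ (D₀ * Q₂))

    n₀≥₄ : 8 * M′ ≤ n₀
    n₀≥₄ = ≤-trans (≤-trans (≤-trans (m≤m+n _ (3 + k)) (m≤n+m _ boundS)) (m≤n+m _ bound₂)) (m≤n+m _ (D₀ * Q₂))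

    n₀≥₅ : 3 + k ≤ n₀
    n₀≥₅ = ≤-trans (≤-trans (≤-trans (m≤n+m (3 + k) (8 * M′)) (m≤n+m _ boundS)) (m≤n+m _ bound₂)) (m≤n+m _ (D₀ * Q₂))

  c2160≥1 : 1 ≤ c2160
  c2160≥1 = ≤-trans (s≤s z≤n) 81≤c2160

  1≤Q₁ : 1 ≤ Q₁
  1≤Q₁ = ≤-trans (*-mono-≤ (*-mono-≤ c2160≥1 1≤k) 1≤k) (≤-reflexive (sym Q₁≡))

  instance
    Q₁≢0 : NonZero Q₁
    Q₁≢0 = >-nonZero 1≤Q₁
    Q₂≢0 : NonZero Q₂
    Q₂≢0 = >-nonZero (≤-trans 1≤Q₁ Q₁≤Q₂)

  3≤M′ : 3 ≤ M′
  3≤M′ = ≤-trans (≤-trans (≤-trans (≤-trans (+-monoʳ-≤ 2 (≤-trans 1≤k (m≤m+n k k))) (m≤n+m _ (2 * Q₁))) (≤-reflexive (sym w≡))) (≤-trans (≤-reflexive (sym (*-identityˡ w))) (*-monoˡ-≤ w 1≤k))) (≤-trans (m≤m+n (k * w) _) (≤-reflexive (sym M′≡)))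

  1≤D₀ : 1 ≤ D₀
  1≤D₀ = ≤-trans (s≤s z≤n) 2≤D₀

  sizes : ∀ n → n₀ < n → Sizes k n
  sizes n lt = record
    { B = 2 * Q₁ ; w₀ = w ; d₁ = d₁ ; d₂ = d₂ ; η = η
    ; w₀≥ = ≤-reflexive (sym w≡)
    ; M≥3 = ≤-trans 3≤M′ (≤-reflexive M′≡)
    ; big-count = λ c h → div-count n Q₁ c h
    ; high-count = λ c h → ≤-trans (div-count n Q₂ c h) (≤-reflexive (sym η≡))
    ; D₀≤d₂ = D₀≤d₂
    ; d₂≤d₁ = /-monoʳ-≤ n Q₁≤Q₂
    ; small-d = ≤-trans (≤-reflexive (trans (sym (*-assoc (c2160 * k) k d₁)) (cong (_* d₁) (sym Q₁≡)))) (div-≤ n Q₁ Q₁ ≤-refl)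
    ; small-M = ≤-trans (*-monoʳ-≤ 8 (≤-reflexive (sym M′≡))) (≤-trans n₀≥₄ n₀≤n)
    ; small-M′ = ≤-trans (*-monoʳ-≤ (8 * k) (*-monoˡ-≤ d₂ (≤-reflexive (sym M′≡)))) (≤-trans (≤-reflexive (sym (*-assoc (8 * k) M′ d₂))) (div-≤ n Q₂ ((8 * k) * M′) Q₂≥₁))
    ; room₁ = subst (λ x → 20 * ((x + x) * (1 + D₀ + D₀ * d₂)) ≤ n) M′≡ r₁
    ; room₂ = subst (λ x → 20 * (η * x) + (80 * (k + k) + 60 * k + 40 * η) < 4 * n) M′≡ (≤-trans (s≤s (≤-trans (≤-reflexive (sym bound₂≡)) n₀≥₂)) (≤-trans lt (m≤m+n n _)))
    ; room-S = subst (λ x → 5 * ((x + x) + k + 1) ≤ n) M′≡ (≤-trans (≤-reflexive (sym boundS≡)) (≤-trans n₀≥₃ n₀≤n))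
    ; n>k+2 = ≤-trans n₀≥₅ n₀≤n }
    where
    d₁ d₂ : ℕ
    d₁ = n / Q₁
    d₂ = n / Q₂
    n₀≤n : n₀ ≤ n
    n₀≤n = <⇒≤ lt
    D₀≤d₂ : D₀ ≤ d₂
    D₀≤d₂ = div-≥ n Q₂ D₀ (≤-trans n₀≥₁ n₀≤n)
    r₁ : 20 * ((M′ + M′) * (1 + D₀ + D₀ * d₂)) ≤ n
    -- As 1 and `D₀` are at most `d₂`, the bound on bad partners turns into a multiple of `d₂`.
    r₁ = ≤-trans (*-monoʳ-≤ 20 (*-monoʳ-≤ (M′ + M′) (+-monoˡ-≤ (D₀ * d₂) (+-mono-≤ (≤-trans 1≤D₀ D₀≤d₂) D₀≤d₂))))
      (≤-trans (≤-reflexive (eq (M′ + M′) D₀ d₂)) (div-≤ n Q₂ (20 * ((M′ + M′) * (2 + D₀))) Q₂≥₂))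
      where
      aux : ∀ u x D d → u * (x * (d + d + D * d)) ≡ (u * (x * (2 + D))) * d
      aux = solve-∀
      eq : ∀ x D d → 20 * (x * (d + d + D * d)) ≡ (20 * (x * (2 + D))) * d
      eq x D d = aux 20 x D d

-- Assembling the packing

does-true : {A : Set} (d : Dec A) → does d ≡ true → A
does-true (yes a) _ = a

does-false : {A : Set} (d : Dec A) → does d ≡ false → ¬ A
does-false (no na) _ = na

module Assembly (k n : ℕ) (1≤k : 1 ≤ k) (sz : Sizes k n) (Tr : (j : Fin k) → Graph (n ∸ toℕ j)) (tree : ∀ j → IsTree (Tr j))
  (hyp : ∀ j → (k ∸ 1 ∸ toℕ j ≤ leaves (Tr j)) ⊎ PendingPath (Tr j) (k ∸ 1 ∸ toℕ j)) where
  open Sizes sz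

  k≤n : k ≤ n
  k≤n = ≤-trans (m≤n+m k 3) n>k+2

  1≤n : 1 ≤ n
  1≤n = ≤-trans 1≤k k≤n

  v₀ : Fin n
  v₀ = fromℕ< 1≤n

  module T (j : Fin k) where
    order : ℕ
    order = n ∸ toℕ j
    j≤n : toℕ j ≤ n
    j≤n = ≤-trans (<⇒≤ (Fin.toℕ<n j)) k≤n
    3≤m : 3 ≤ order
    3≤m = ≤-trans (≤-reflexive (sym (m+n∸n≡m 3 k))) (≤-trans (∸-monoˡ-≤ k n>k+2) (∸-monoʳ-≤ n (<⇒≤ (Fin.toℕ<n j))))
    open Ext (m∸n≤m n (toℕ j)) (adj (Tr j)) public
    open TreeFacts (Tr j) 3≤m (proj₁ (proj₂ (tree j))) public

    sE : Symm E
    sE = symE (Graph.sym (Tr j))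

    iE : Irr E
    iE = irrE (Graph.irrefl (Tr j))

    sumE : sum (deg E) ≤ 2 * n
    sumE = ≤-trans sum-deg (≤-trans (Cycles.acyclic-deg (Tr j) (proj₂ (proj₂ (tree j)))) (*-monoʳ-≤ 2 (m∸n≤m n (toℕ j))))

    fake≤ : count (λ a → not (real a)) ≤ k
    fake≤ = ≤-trans fake-count (≤-trans (≤-reflexive (m∸[m∸n]≡n j≤n)) (<⇒≤ (Fin.toℕ<n j)))

    real≥1 : ∀ a → real a ≡ true → 1 ≤ deg E a
    real≥1 a h with real⁻ h
    ... | (u , refl) = ≤-trans (deg≥1 u) (≤-reflexive (sym (deg-ι u)))

    open Forest {n} {k} E sE iE sumE real fake≤ real≥1 public using (star-cover; module Dichotomy)

    star? : Dec (∃ λ v → 3 * n ≤ 5 * deg E v)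
    star? = any? (λ v → 3 * n ≤? 5 * deg E v)

    big : Fin n → Bool
    big v = ltb d₁ (deg E v)

    big-length : length (members big) ≤ B
    big-length = ≤-trans (length-members big) (big-count (count big) (≤-trans (markov (suc d₁) big (deg E) λ v h → ltb-true {d₁} h) sumE))

    dm : Fin k → Fin n
    dm e with order + toℕ e <? n
    ... | yes lt = fromℕ< lt
    ... | no _ = v₀

    dm-toℕ : ∀ {e} → e ≺ j → toℕ (dm e) ≡ order + toℕ e
    dm-toℕ {e} lt with order + toℕ e <? n
    ... | yes p = Fin.toℕ-fromℕ< p
    ... | no np = ⊥-elim (np (≤-trans (+-monoʳ-< order lt) (≤-reflexive (m∸n+n≡m j≤n))))

    dm-iso : ∀ {e} → e ≺ j → ∀ v → E (dm e) v ≡ true → ⊥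
    dm-iso {e} lt v h = <-irrefl refl (≤-trans (ltb-true {toℕ (dm e)} (proj₁ (E-real {dm e} {v} h))) (≤-trans (m≤m+n order (toℕ e)) (≤-reflexive (sym (dm-toℕ lt)))))

    dm-inj : ∀ {e e′} → e ≺ j → e′ ≺ j → dm e ≡ dm e′ → e ≡ e′
    dm-inj {e} {e′} lt lt′ q = Fin.toℕ-injective (+-cancelˡ-≡ order _ _ (trans (sym (dm-toℕ lt)) (trans (cong toℕ q) (dm-toℕ lt′))))

  opaque
    isS : Fin k → Bool
    isS j = does (T.star? j)

    isS-true : ∀ j → isS j ≡ true → ∃ λ v → 3 * n ≤ 5 * deg (T.E j) v
    isS-true j = does-true (T.star? j)

    isS-false : ∀ j → isS j ≡ false → ¬ (∃ λ v → 3 * n ≤ 5 * deg (T.E j) v)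
    isS-false j = does-false (T.star? j)

  path? : ∀ {A B : Set} → A ⊎ B → Bool
  path? (inj₁ _) = false
  path? (inj₂ _) = true

  isP : Fin k → Bool
  isP j = not (isS j) ∧ path? (hyp j)

  P⇒¬S : ∀ i → isP i ≡ true → isS i ≡ false
  P⇒¬S i h = not-elim (proj₁ (∧-elim {not (isS i)} h))

  open Spec {n} {k} isS isP

  special : ∀ j → isS j ≡ false → SpecialCover (T.E j) j
  special j nS = build (hyp j) refl
    where
    open T j
    build : (s : (k ∸ 1 ∸ toℕ j ≤ leaves (Tr j)) ⊎ PendingPath (Tr j) (k ∸ 1 ∸ toℕ j)) → hyp j ≡ s → SpecialCover E j
    build (inj₁ h) e = go (pick _ (λ v → does (degree (Tr j) v ≟ 1)) (≤-trans h (≤-reflexive (leaves≡ (Tr j)))))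
      where
      go : (Σ (Fin (k ∸ 1 ∸ toℕ j) → Fin order) λ f → (∀ {a b} → f a ≡ f b → a ≡ b) × (∀ a → does (degree (Tr j) (f a) ≟ 1) ≡ true)) → SpecialCover E j
      go (f , inj , pf) = ByLeaves.special E sE j (trans (cong (λ s → not (isS j) ∧ path? s) e) (Bool.∧-zeroʳ _))
        (ι ∘ f) (λ q → inj (ι-inj q)) (λ a → trans (deg-ι (f a)) (one a))
        (λ a b h → no-K₂ (f a) (f b) (one a) (one b) (trans (sym (E-ι (f a) (f b))) h)) v₀
        where
        one : ∀ a → deg (adj (Tr j)) (f a) ≡ 1
        one a = trans (sym (degree≡deg (Tr j) (f a))) (does-true (degree (Tr j) (f a) ≟ 1) (pf a))
    build (inj₂ h) e = ByPath.special E sE j (trans (cong (λ s → not (isS j) ∧ path? s) e) (trans (Bool.∧-identityʳ _) (not-intro nS))) P⇒¬S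
      (ι ∘ q) (λ a b p → q-inj a b (ι-inj p)) (λ a → trans (E-ι _ _) (q-step a)) (λ a → ≤-trans (≤-reflexive (deg-ι _)) (q-low a))
      λ a v p → let (w , ev , pw) = E⁻ p in [ (λ x → inj₁ (trans ev (cong ι x))) , (λ { (l′ , x , y) → inj₂ (l′ , x , trans ev (cong ι y)) }) ]′ (q-nbrs a w pw)
      where open Pending (pending-path (Tr j) h)

  record Part (j : Fin k) : Set where
    open T j using (E)
    field
      X : Bool → Fin M → Fin n
      W : List (Fin n)
      X-inj : ∀ {b p b′ p′} → X b p ≡ X b′ p′ → b ≡ b′ × p ≡ p′
      X-real : ∀ b p → 1 ≤ deg E (X b p)
      X-D₀ : ∀ b p → deg E (X b p) ≤ D₀
      X-ind : ∀ b p b′ p′ → E (X b p) (X b′ p′) ≡ true → ⊥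
      X∉W : ∀ b p → ¬ (X b p ∈ W)
      X-nbr : ∀ b p v → E (X b p) v ≡ true → v ∈ W ⊎ deg E v ≤ d₂
      W-real : ∀ {v} → v ∈ W → 1 ≤ deg E v
      W-length : length W ≤ w₀
      big∈W : ∀ v → d₁ < deg E v → v ∈ W
      c : Fin n
      c∈W : isS j ≡ true → c ∈ W
      c-only : isS j ≡ true → ∀ b p v → E (X b p) v ≡ true → v ≡ c
      col : Fin n → Bool
      col-X : isS j ≡ false → ∀ b p v → E (X b p) v ≡ true → col v ≡ b
      sp : SpecialCover E j
    open SpecialCover sp
    field
      cv-skip : ∀ {i} → Later j i → skip i ≡ true → cv i ∈ W
      cv-noskip : ∀ {i} → Later j i → skip i ≡ false → ¬ (cv i ∈ W)
      cv-X : ∀ {i} → Later j i → ∀ b p → X b p ≢ cv i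
      nx-W : ∀ {i} → Later j i → NoUp j i → nx i ∈ W

  star-part : ∀ j → isS j ≡ true → Part j
  star-part j S = go (isS-true j S)
    where
    open T j
    absurd : ∀ {i} {A : Set} → Later j i → A
    absurd (nS , _) = ⊥-elim (true≢false S nS)
    none : SpecialCover E j
    none = record
      { cv = λ _ → v₀ ; nx = λ _ → v₀ ; skip = λ _ → false ; dmi = id
      ; cv-inj = λ l → absurd l ; cv-real = λ l → absurd l ; cv-low = λ l → absurd l ; nx-real = λ l → absurd l ; cv-nbrs = λ l → absurd l
      ; nx-up = λ l → absurd l ; cv-nx = λ l → absurd l ; skip-P = λ () ; dmi-≺ = λ l → absurd l ; dmi-S = λ l → absurd l ; dmi-inj = λ l → absurd l }
    go : (∃ λ v → 3 * n ≤ 5 * deg E v) → Part j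
    go (c , hc) = make (star-cover c M d₂ hc room-S M≥3)
      where
      make : Σ (Cover M d₂ E []) (λ C → ∀ b i v → E (Cover.X C b i) v ≡ true → v ≡ c) → Part j
      make (C , only) = record
        { X = X ; W = W ; X-inj = X-inj ; X-real = X-deg₁ ; X-D₀ = X-deg ; X-ind = X-ind
        ; X∉W = λ b p m → [ (λ q → <-irrefl refl (<-≤-trans (ltb-true {d₁} (∈-members⁻ big q)) (≤-trans (X-deg b p) (≤-trans D₀≤d₂ d₂≤d₁)))) , (λ { (here q) → notc b p q }) ]′ (∈-++⁻ (members big) m)
        ; X-nbr = λ b p v h → inj₁ (∈-++⁺ʳ (members big) (here (only b p v h)))
        ; W-real = λ m → [ (λ q → ≤-trans (s≤s z≤n) (ltb-true {d₁} (∈-members⁻ big q))) , (λ { (here refl) → c-real }) ]′ (∈-++⁻ (members big) m)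
        ; W-length = ≤-trans (≤-reflexive (List.length-++ (members big))) (≤-trans (+-mono-≤ big-length (s≤s z≤n)) w₀≥)
        ; big∈W = λ v h → ∈-++⁺ˡ (∈-members⁺ big (ltb-intro h))
        ; c = c ; c∈W = λ _ → ∈-++⁺ʳ (members big) (here refl) ; c-only = λ _ → only
        ; col = λ _ → true ; col-X = λ nS → ⊥-elim (true≢false S nS)
        ; sp = none ; cv-skip = λ l → absurd l ; cv-noskip = λ l → absurd l ; cv-X = λ l → absurd l ; nx-W = λ l → absurd l }
        where
        open Cover C
        W : List (Fin n)
        W = members big ++ (c ∷ [])
        p₀ : Fin M
        p₀ = fromℕ< (≤-trans (s≤s z≤n) M≥3)
        Xc : ∀ b p → E (X b p) c ≡ true
        Xc b p = let (f , _ , pf) = pick 1 (E (X b p)) (X-deg₁ b p) in subst (λ z → E (X b p) z ≡ true) (only b p _ (pf zero)) (pf zero)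
        -- `c` is adjacent to a covering vertex, so by independence it cannot be one itself.
        notc : ∀ b p → X b p ≢ c
        notc b p e = X-ind true p₀ b p (subst (λ z → E (X true p₀) z ≡ true) (sym e) (Xc true p₀))
        c-real : 1 ≤ deg E c
        c-real = nbr⇒deg E (trans (sE c _) (Xc true p₀))

  flat-part : ∀ j → isS j ≡ false → Part j
  flat-part j nS = make (Dichotomy.cover M d₂ η (k + k) Sp Sp≤ M≥3 H≤ flat room₁ room₂)
    where
    open T j
    sp = special j nS
    open SpecialCover sp
    Sp : List (Fin n)
    Sp = map cv (allFin k) ++ map nx (allFin k)
    Sp≤ : length Sp ≤ k + k
    Sp≤ = ≤-reflexive (trans (List.length-++ (map cv (allFin k))) (cong₂ _+_ (trans (List.length-map cv (allFin k)) (length-allFin k)) (trans (List.length-map nx (allFin k)) (length-allFin k))))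
    H≤ : count (λ u → ltb d₂ (deg E u)) ≤ η
    H≤ = high-count _ (≤-trans (markov (suc d₂) (λ u → ltb d₂ (deg E u)) (deg E) λ v h → ltb-true {d₂} h) sumE)
    flat : ∀ v → 5 * deg E v ≤ 3 * n
    flat v = <⇒≤ (≰⇒> λ le → isS-false j nS (v , le))
    later? : ∀ i → Dec (Later j i)
    later? i = (isS j Bool.≟ false) ×-dec ((isS i Bool.≟ true) ×-dec (toℕ j <? toℕ i))
    up? : ∀ i → Dec (∃ λ i′ → isS i′ ≡ true × isP j ≡ true × rk i′ ≡ rk i + R j)
    up? i = any? (λ i′ → (isS i′ Bool.≟ true) ×-dec ((isP j Bool.≟ true) ×-dec (rk i′ ≟ rk i + R j)))
    top? : ∀ i → Dec (Later j i × ¬ (∃ λ i′ → isS i′ ≡ true × isP j ≡ true × rk i′ ≡ rk i + R j))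
    top? i = later? i ×-dec ¬? (up? i)
    skip? : ∀ i → Dec (Later j i × skip i ≡ true)
    skip? i = later? i ×-dec (skip i Bool.≟ true)
    -- Vertices that may be adjacent to special covers without taking a centre: the parent of a
    -- leaf, the vertex after the end of a chain, and the skipped path vertices. They own slots so
    -- that the neighbours of special covers always lie on slots.
    tops skips : List (Fin n)
    tops = map nx (filter top? (allFin k))
    skips = map cv (filter skip? (allFin k))
    make : Σ (Cover M d₂ E Sp) Coloured → Part j
    make (C , col , col-ok) = record
      { X = X ; W = W ; X-inj = X-inj ; X-real = X-deg₁ ; X-D₀ = X-deg ; X-ind = X-ind
      ; X∉W = λ b p m → X∉ b p (W⁻ m)
      ; X-nbr = λ b p v h → [ (λ q → inj₁ (AB⊆W q)) , inj₂ ]′ (X-nbr b p v h)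
      ; W-real = λ m → W-rl (W⁻ m)
      ; W-length = W-len
      ; big∈W = λ v h → ∈-++⁺ˡ (∈-members⁺ big (ltb-intro h))
      ; c = v₀ ; c∈W = λ S → ⊥-elim (true≢false S nS) ; c-only = λ S → ⊥-elim (true≢false S nS)
      ; col = col ; col-X = λ _ → col-ok ; sp = sp
      ; cv-skip = λ {i} l sk → ∈-++⁺ʳ (members big) (∈-++⁺ʳ AB (∈-++⁺ʳ tops (∈-map⁺ cv (∈-filter⁺ skip? (∈-allFin i) (l , sk)))))
      ; cv-noskip = λ l sk m → noskip l sk (W⁻ m)
      ; cv-X = λ {i} l b p e → X-Sp b p (subst (_∈ Sp) (sym e) (∈-++⁺ˡ (∈-map⁺ cv (∈-allFin i))))
      ; nx-W = λ {i} l nu → ∈-++⁺ʳ (members big) (∈-++⁺ʳ AB (∈-++⁺ˡ (∈-map⁺ nx (∈-filter⁺ top? (∈-allFin i) (l , λ { (i′ , a , b , c) → nu i′ a b c }))))) }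
      where
      open Cover C
      W : List (Fin n)
      W = members big ++ (AB ++ (tops ++ skips))
      AB⊆W : ∀ {v} → v ∈ AB → v ∈ W
      AB⊆W q = ∈-++⁺ʳ (members big) (∈-++⁺ˡ q)
      filter-length : ∀ {Q : Fin k → Set} (f : Fin k → Fin n) (Q? : ∀ i → Dec (Q i)) → length (map f (filter Q? (allFin k))) ≤ k
      filter-length f Q? = ≤-trans (≤-reflexive (List.length-map f (filter Q? (allFin k)))) (≤-trans (List.length-filter Q? (allFin k)) (≤-reflexive (length-allFin k)))
      W-len : length W ≤ w₀
      W-len = ≤-trans (≤-reflexive (trans (List.length-++ (members big)) (cong (length (members big) +_) (trans (List.length-++ AB) (cong (length AB +_) (List.length-++ tops))))))
        (≤-trans (+-mono-≤ big-length (+-mono-≤ AB-length (+-mono-≤ (filter-length nx top?) (filter-length cv skip?)))) w₀≥)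
      data InW (v : Fin n) : Set where
        w-big : d₁ < deg E v → InW v
        w-AB : v ∈ AB → InW v
        w-top : ∀ i → Later j i → NoUp j i → v ≡ nx i → InW v
        w-skip : ∀ i → Later j i → skip i ≡ true → v ≡ cv i → InW v
      from-top : ∀ {v} → (∃ λ i → i ∈ filter top? (allFin k) × v ≡ nx i) → InW v
      from-top (i , qi , e) = go (proj₂ (∈-filter⁻ top? {xs = allFin k} qi)) e
        where
        go : ∀ {v} → Later j i × ¬ (∃ λ i′ → isS i′ ≡ true × isP j ≡ true × rk i′ ≡ rk i + R j) → v ≡ nx i → InW v
        go (l , ¬up) = w-top i l λ i′ a b c → ¬up (i′ , a , b , c)
      from-skip : ∀ {v} → (∃ λ i → i ∈ filter skip? (allFin k) × v ≡ cv i) → InW v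
      from-skip (i , qi , e) = go (proj₂ (∈-filter⁻ skip? {xs = allFin k} qi)) e
        where
        go : ∀ {v} → Later j i × skip i ≡ true → v ≡ cv i → InW v
        go (l , sk) = w-skip i l sk
      W⁻ : ∀ {v} → v ∈ W → InW v
      W⁻ m = [ (λ q → w-big (ltb-true {d₁} (∈-members⁻ big q)))
             , (λ m′ → [ w-AB , (λ m″ → [ (λ q → from-top (∈-map⁻ nx q)) , (λ q → from-skip (∈-map⁻ cv q)) ]′ (∈-++⁻ tops m″)) ]′ (∈-++⁻ AB m′)) ]′ (∈-++⁻ (members big) m)
      D₀≤d₁ : D₀ ≤ d₁
      D₀≤d₁ = ≤-trans D₀≤d₂ d₂≤d₁
      X∉ : ∀ b p → InW (X b p) → ⊥
      X∉ b p (w-big h) = <-irrefl refl (<-≤-trans h (≤-trans (X-deg b p) D₀≤d₁))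
      X∉ b p (w-AB q) = X-AB b p q
      X∉ b p (w-top i _ _ e) = X-Sp b p (subst (_∈ Sp) (sym e) (∈-++⁺ʳ (map cv (allFin k)) (∈-map⁺ nx (∈-allFin i))))
      X∉ b p (w-skip i _ _ e) = X-Sp b p (subst (_∈ Sp) (sym e) (∈-++⁺ˡ (∈-map⁺ cv (∈-allFin i))))
      W-rl : ∀ {v} → InW v → 1 ≤ deg E v
      W-rl (w-big h) = ≤-trans (s≤s z≤n) h
      W-rl (w-AB q) = ≤-trans (s≤s z≤n) (AB-deg q)
      W-rl (w-top i l _ refl) = nx-real l
      W-rl (w-skip i l _ refl) = cv-real l
      noskip : ∀ {i} → Later j i → skip i ≡ false → InW (cv i) → ⊥
      noskip l sk (w-big h) = <-irrefl refl (<-≤-trans h (≤-trans (cv-low l) (≤-trans 2≤D₀ D₀≤d₁)))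
      noskip l sk (w-AB q) = <-irrefl refl (≤-trans (AB-deg q) (cv-low l))
      noskip l sk (w-top i′ l′ nu e) = cv-nx l l′ sk nu e
      noskip l sk (w-skip i′ l′ sk′ e) with cv-inj l l′ e
      ... | refl = true≢false sk′ sk

  opaque
    part : ∀ j → Part j
    part j = [ star-part j , flat-part j ]′ (decBool (isS j))

  module P (j : Fin k) = Part (part j)
  module SC (j : Fin k) = SpecialCover (Part.sp (part j))

  kits : Kits n k M d₂
  kits = record
    { E = T.E ; symE = T.sE ; irrE = T.iE ; isS = isS ; isP = isP ; rk = rk ; R = R
    ; rk-inj = rk-inj ; rk-≺ = λ _ _ → rk-≺ ; R-inj = λ p p′ e → RP.rank-inj p p′ (suc-injective e) ; R≥1 = λ _ → s≤s z≤n
    ; dm = T.dm ; dm-iso = λ {j} → T.dm-iso j ; dm-inj = λ {j} → T.dm-inj j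
    ; X = P.X ; W = P.W ; X-inj = λ {j} → P.X-inj j ; X-real = P.X-real ; X-low = λ j b p → ≤-trans (P.X-D₀ j b p) D₀≤d₂ ; X-ind = P.X-ind
    ; X∉W = P.X∉W ; X-nbr = P.X-nbr ; W-real = λ {j} → P.W-real j ; c = P.c ; c∈W = λ {j} → P.c∈W j ; c-only = λ {j} → P.c-only j
    ; col = P.col ; col-X = λ {j} → P.col-X j ; cv = SC.cv ; nx = SC.nx ; skip = SC.skip ; dmi = SC.dmi
    ; cv-inj = λ {j} → SC.cv-inj j ; cv-real = λ {j} → SC.cv-real j ; cv-skip = λ {j} → P.cv-skip j ; cv-noskip = λ {j} → P.cv-noskip j
    ; cv-X = λ {j} → P.cv-X j ; cv-nbrs = λ {j} → SC.cv-nbrs j ; nx-up = λ {j} → SC.nx-up j ; nx-W = λ {j} → P.nx-W j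
    ; skip-P = λ {j} → SC.skip-P j ; dmi-≺ = λ {j} → SC.dmi-≺ j ; dmi-S = λ {j} → SC.dmi-S j ; dmi-inj = λ {j} → SC.dmi-inj j }

  packing : Pack n (λ j → n ∸ toℕ j) Tr
  packing = finish (Hosts.Pack.packed kits 1≤k 1≤n (fromℕ< (≤-trans (s≤s z≤n) M≥3)) (≤-trans (m≤n*m M 8) small-M) d₂≤d₁
    P.W-length P.X-D₀ P.big∈W T.sumE small-d small-M small-M′)
    where
    finish : (Σ (Fin k → Permutation′ n) λ π → ∀ i j → i ≢ j → (T.E i ^ π i) ⟂ (T.E j ^ π j)) → Pack n (λ j → n ∸ toℕ j) Tr
    finish (π , disj) = (λ j → m∸n≤m n (toℕ j)) , f , f-inj , apart
      where
      f : ∀ j → Fin (n ∸ toℕ j) → Fin n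
      f j u = π j ⟨$⟩ˡ (T.ι j u)
      πf : ∀ j u → π j ⟨$⟩ʳ (f j u) ≡ T.ι j u
      πf j u = Perm.inverseʳ (π j)
      f-inj : ∀ j {u v} → f j u ≡ f j v → u ≡ v
      f-inj j {u} {v} e = T.ι-inj j (trans (sym (πf j u)) (trans (cong (π j ⟨$⟩ʳ_) e) (πf j v)))
      edge : ∀ j u v → Adj (Tr j) u v → (T.E j ^ π j) (f j u) (f j v) ≡ true
      edge j u v h = trans (cong₂ (T.E j) (πf j u) (πf j v)) (trans (T.E-ι j u v) (T⇒≡ h))
      apart : ∀ i j → ¬ i ≡ j → ∀ u v x y → Adj (Tr i) u v → Adj (Tr j) x y → f i u ≡ f j x → f i v ≡ f j y → ⊥
      apart i j ne u v x y a b eu ev = disj i j ne (f i u) (f i v) (edge i u v a)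
        (subst₂ (λ s t → (T.E j ^ π j) s t ≡ true) (sym eu) (sym ev) (edge j x y b))

theorem1 : (k : ℕ) → 1 ≤ k → Σ ℕ λ n₀ → (n : ℕ) → n₀ < n →
    (Tr : (j : Fin k) → Graph (n ∸ toℕ j)) →
    (∀ j → IsTree (Tr j)) →
    (∀ j → (k ∸ 1 ∸ toℕ j ≤ leaves (Tr j)) ⊎ PendingPath (Tr j) (k ∸ 1 ∸ toℕ j)) →
    Pack n (λ j → n ∸ toℕ j) Tr
theorem1 k 1≤k = Choice.n₀ k 1≤k , λ n lt Tr tree hyp → Assembly.packing k n 1≤k (Choice.sizes k 1≤k n lt) Tr tree hyp
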